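{- For any integer $s\ge 3$ and any $r\in\{1,2\}$, there is a constant $C$ such that in the $r$-offer $s$-uniform semirandom model there exists a strategy with the following property: for $n$ divisible by $s-1$, the hypergraph $H_t$ obtained after $t=Cn$ rounds asymptotically almost surely (with probability tending to $1$ as $n\to\infty$) contains a loose Hamilton cycle.
   Context: The $r$-offer $s$-uniform semirandom model: a player builds a sequence of $s$-uniform hypergraphs $H_0, H_1, H_2, \ldots$ on vertex set $[n]=\{1,\ldots,n\}$, with $H_0$ empty. In each round $t\ge 1$, a uniformly random set of $r$ vertices of $[n]$ is offered; the player, knowing the offered vertices and the entire history (including $H_{t-1}$), chooses $s-r$ further vertices, and the resulting $s$-set is added as a hyperedge to $H_{t-1}$ to form $H_t$. (The player may also ignore an offer, which still counts as a round.) A strategy is a rule for these choices. A loose Hamilton cycle in an $s$-uniform hypergraph on $[n]$ ($n$ divisible by $s-1$) is a collection of $m=n/(s-1)$ hyperedges $e_1,\ldots,e_m$ such that for some cyclic ordering $v_1,\ldots,v_n$ of $[n]$, each $e_i$ consists of $s$ consecutive vertices $v_{(i-1)(s-1)+1},\ldots,v_{(i-1)(s-1)+s}$ (indices mod $n$); thus consecutive hyperedges share exactly one vertex and all vertices are covered. -}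

module Defs where

open import Data.Nat using (ℕ; zero; suc; _+_; _*_; _∸_; _^_; _≤_; NonZero)
open import Data.Nat.DivMod using (_mod_)
open import Data.Nat.Divisibility using (_∣_)
open import Data.Nat.Combinatorics using (_C_)
open import Data.Fin using (Fin; toℕ)
open import Data.Fin.Subset using (Subset; ∣_∣; _∪_; _∩_; ⁅_⁆; ⋃; ⊥)
open import Data.Fin.Permutation using (Permutation′; _⟨$⟩ʳ_)
open import Data.List using (List; []; _∷_; length; map; allFin)
open import Data.List.Membership.Propositional using (_∈_)
open import Data.List.Relation.Unary.All using (All)
open import Data.List.Relation.Unary.Unique.Propositional using (Unique)
open import Data.Vec using (Vec; []; _∷_)
open import Data.Maybe using (Maybe; just; nothing)
open import Data.Product using (Σ; ∃; _×_; _,_; proj₁)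
open import Relation.Binary.PropositionalEquality using (_≡_)

Offer : ℕ → ℕ → Set
Offer n r = Σ (Subset n) λ A → ∣ A ∣ ≡ r

-- The player's response to offer A: either ignore it (nothing), or
-- an (s-r)-set B of further vertices, disjoint from A; the hyperedge is A ∪ B.
Response : (n r s : ℕ) → Offer n r → Set
Response n r s A = Maybe (Σ (Subset n) λ B → (∣ B ∣ ≡ s ∸ r) × (proj₁ A ∩ B ≡ ⊥))

Round : (n r s : ℕ) → Set
Round n r s = Σ (Offer n r) (Response n r s)

-- A (deterministic) strategy on vertex set [n]: given the entire history
-- (list of previous rounds, most recent first) and the current offer, respond.
Strategy : (n r s : ℕ) → Set
Strategy n r s = List (Round n r s) → (A : Offer n r) → Response n r s A

edgesOf : ∀ {n r s} → List (Round n r s) → List (Subset n)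
edgesOf [] = []
edgesOf ((A , nothing) ∷ h) = edgesOf h
edgesOf ((A , just (B , _)) ∷ h) = (proj₁ A ∪ B) ∷ edgesOf h

play : ∀ {n r s t} → Strategy n r s → List (Round n r s) → Vec (Offer n r) t → List (Round n r s)
play σ h [] = h
play σ h (A ∷ ω) = play σ ((A , σ h A) ∷ h) ω

hypergraph : ∀ {n r s t} → Strategy n r s → Vec (Offer n r) t → List (Subset n)
hypergraph σ ω = edgesOf (play σ [] ω)

-- For a cyclic ordering v (a permutation: position ↦ vertex), the i-th
-- segment {v_{i(s-1)+j mod n} : 0 ≤ j < s} (0-indexed positions).
segment : ∀ {n} .{{_ : NonZero n}} → (s : ℕ) → Permutation′ n → ℕ → Subset n
segment {n} s v i = ⋃ (map (λ (j : Fin s) → ⁅ v ⟨$⟩ʳ ((i * (s ∸ 1) + toℕ j) mod n) ⁆) (allFin s))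

ContainsLooseHamCycle : ∀ {n} .{{_ : NonZero n}} → (s : ℕ) → List (Subset n) → Set
ContainsLooseHamCycle {n} s H =
  ∃ λ (v : Permutation′ n) → ∃ λ (m : ℕ) → (m * (s ∸ 1) ≡ n) ×
    ((i : Fin m) → segment s v (toℕ i) ∈ H)

-- The vertices are split into junctions x_0 , … , x_ℓ, tokens, and blocks of s − 3 vertices. For r = 2, an offer
-- {x_(j+1) , t} of a first, random phase is completed by x_j and the j-th block, so that the token t becomes an
-- option for the slot x_j x_(j+1). The random bipartite graph of slots and tokens is sparse on small sets and has
-- edges between any two large ones, so after the deletion of few bad slots and few bad tokens it satisfies Hall's
-- condition, even if some reserved slots and tokens are removed later.
--
-- Close the slots to a cycle through a few tokens, among them all bad ones; all its links except the good slots are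
-- missing. A missing link p q is repaired by a 2-opt move: an offer {c , v} of a reserved junction c and token v is
-- completed by p, and a later offer {y , v′} of the successor y of c by q; then c p and y q replace p q and c y.
-- One missing link needs of the order of √n rounds, but treating all of them simultaneously, in stages that divide
-- their number by 16 in geometrically decreasing time, takes linear time. Finally the remaining slots are matched
-- perfectly to the remaining tokens by Hall's theorem.
--
-- For r = 1, two consecutive offers play the role of one offered pair. Probabilities are counted: F bounds the
-- number of offer sequences that fail.

module Submission where

open import Data.Bool using (Bool; true; false; _∧_; _∨_; not; if_then_else_) renaming (_≟_ to _≟ᵇ_)
open import Data.Bool.Properties using (T-≡; ⇔→≡; ∧-zeroʳ; ∧-comm)
open import Data.Empty using (⊥; ⊥-elim)
open import Data.Fin using (Fin; zero; suc; toℕ; fromℕ; fromℕ<; inject₁; splitAt; join; combine; remQuot; cast; _↑ˡ_; _↑ʳ_)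
open import Data.Fin.Permutation using (Permutation′; permutation)
import Data.Fin.Properties as FinP
open import Data.Fin.Subset using (Subset; ∣_∣; ⁅_⁆; _∪_; _∩_; inside; outside)
import Data.Fin.Subset as Sub
import Data.Fin.Subset.Properties as SubP
open import Data.List using (List; []; _∷_; _++_; length; map; concatMap; allFin; replicate; take; filter; tabulate; reverse)
import Data.List.Membership.DecPropositional
open import Data.List.Membership.Propositional using (_∈_; _∉_)
open import Data.List.Membership.Propositional.Properties using (∈-++⁺ˡ; ∈-++⁺ʳ; ∈-++⁻; ∈-∃++; ∈-allFin; ∈-map⁺; ∈-map⁻; ∈-filter⁻; ∈-filter⁺; ∈-tabulate⁻; ∈-tabulate⁺)
open import Data.List.Properties using (++-assoc; ++-identityʳ; ∷-injectiveˡ; ∷-injectiveʳ; length-map; length-++; length-tabulate; length-replicate; tabulate-cong; map-tabulate; map-++; map-∘; unfold-reverse; reverse-involutive)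
open import Data.List.Relation.Binary.Permutation.Propositional using (_↭_; ↭-refl; ↭-reflexive; ↭-sym; ↭-trans; prep; swap; refl; module PermutationReasoning) renaming (trans to ptrans)
open import Data.List.Relation.Binary.Permutation.Propositional.Properties using (↭-length; ↭-reverse; ↭-map-inv; shift; shifts; ∈-resp-↭; map⁺; ++⁺; ++⁺ˡ; ++⁺ʳ; drop-∷; All-resp-↭; ++-comm)
open import Data.List.Relation.Unary.All using (All; []; _∷_)
import Data.List.Relation.Unary.All as All
import Data.List.Relation.Unary.All.Properties as AllP
open import Data.List.Relation.Unary.AllPairs using ([]; _∷_)
open import Data.List.Relation.Unary.Any using (here; there)
import Data.List.Relation.Unary.Any as Any
open import Data.List.Relation.Unary.Unique.Propositional using (Unique)
import Data.List.Relation.Unary.Unique.Propositional.Properties as UP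
open import Data.Maybe using (just; nothing)
open import Data.Nat
open import Data.Nat.Combinatorics using (_C_; nCk+nC[k+1]≡[n+1]C[k+1]; nC1≡n)
open import Data.Nat.DivMod using (_/_; m/n*n≤m; m*n/n≡m; /-monoˡ-≤; _mod_; _%_; [m+kn]%n≡m%n; m<n⇒m%n≡m)
open import Data.Nat.Divisibility using (_∣_; _∣?_; divides)
open import Data.Nat.Properties
open import Data.Nat.Tactic.RingSolver using (solve-∀)
open import Data.Product using (Σ; ∃; _×_; _,_; proj₁; proj₂; Σ-syntax)
open import Data.Sum using (_⊎_; inj₁; inj₂)
open import Data.Sum.Properties using (inj₁-injective; inj₂-injective)
open import Data.Vec using (Vec; []; _∷_)
import Data.Vec
open import Data.Vec.Properties using () renaming (≡-dec to Vec-≡-dec)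
open import Function using (_∘_; id; mk⇔; module Equivalence)
open import Relation.Binary.PropositionalEquality using (_≡_; _≢_; refl; sym; trans; cong; cong₂; subst; subst₂; module ≡-Reasoning)
open import Relation.Nullary using (¬_; Dec; yes; no)
open import Relation.Nullary.Decidable using (⌊_⌋; ¬?; _→-dec_; _×-dec_)
open import Defs

-- With linearly many offers a positive fraction of the slots gets no option, and waiting for
-- prescribed vertices would cost a logarithmic factor. One link needs about h + n/h rounds, whence
-- √n. For many links at once, the stored centres together are kept within a small multiple of d =
-- 16^I, which is a fixed fraction of n up to a factor 16.
--
-- Two demands on the random phase pull against each other. Sets of size at most d span few edges
-- only if k exceeds a multiple of the mean number of edges from a slot into d tokens; yet few
-- deletions suffice only if d + 1 slots and q tokens always span more than k(d + 1) edges. Both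
-- hold once q is a large multiple of d, and this forces d to be a small fraction of n.

private variable
  A B : Set

-- Finite sums over lists, and lists without repetitions

∑ : List A → (A → ℕ) → ℕ
∑ [] f = 0
∑ (x ∷ xs) f = f x + ∑ xs f

⟦_⟧ : Bool → ℕ
⟦ true ⟧ = 1
⟦ false ⟧ = 0

∑-mono : ∀ (xs : List A) {f g} → (∀ x → f x ≤ g x) → ∑ xs f ≤ ∑ xs g
∑-mono [] h = z≤n
∑-mono (x ∷ xs) h = +-mono-≤ (h x) (∑-mono xs h)

∑-cong : ∀ (xs : List A) {f g} → (∀ x → f x ≡ g x) → ∑ xs f ≡ ∑ xs g
∑-cong [] h = refl
∑-cong (x ∷ xs) h = cong₂ _+_ (h x) (∑-cong xs h)

∑-cong-∈ : ∀ (xs : List A) {f g} → (∀ x → x ∈ xs → f x ≡ g x) → ∑ xs f ≡ ∑ xs g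
∑-cong-∈ [] h = refl
∑-cong-∈ (x ∷ xs) h = cong₂ _+_ (h x (here refl)) (∑-cong-∈ xs (λ y m → h y (there m)))

∑-const : ∀ (xs : List A) c → ∑ xs (λ _ → c) ≡ length xs * c
∑-const [] c = refl
∑-const (x ∷ xs) c = cong (c +_) (∑-const xs c)

∑-+ : ∀ (xs : List A) f g → ∑ xs (λ x → f x + g x) ≡ ∑ xs f + ∑ xs g
∑-+ [] f g = refl
∑-+ (x ∷ xs) f g rewrite ∑-+ xs f g = lem (f x) (g x) (∑ xs f) (∑ xs g)
  where lem : ∀ a b c d → a + b + (c + d) ≡ a + c + (b + d)
        lem = solve-∀

∑-*ˡ : ∀ (xs : List A) c f → ∑ xs (λ x → c * f x) ≡ c * ∑ xs f
∑-*ˡ [] c f = sym (*-zeroʳ c)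
∑-*ˡ (x ∷ xs) c f rewrite ∑-*ˡ xs c f = sym (*-distribˡ-+ c (f x) (∑ xs f))

∑-*ʳ : ∀ (xs : List A) c f → ∑ xs (λ x → f x * c) ≡ ∑ xs f * c
∑-*ʳ xs c f = trans (∑-cong xs (λ x → *-comm (f x) c)) (trans (∑-*ˡ xs c f) (*-comm c (∑ xs f)))

∑-++ : ∀ (xs ys : List A) f → ∑ (xs ++ ys) f ≡ ∑ xs f + ∑ ys f
∑-++ [] ys f = refl
∑-++ (x ∷ xs) ys f rewrite ∑-++ xs ys f = sym (+-assoc (f x) (∑ xs f) (∑ ys f))

∑-map : ∀ (g : A → B) xs f → ∑ (map g xs) f ≡ ∑ xs (f ∘ g)
∑-map g [] f = refl
∑-map g (x ∷ xs) f = cong (f (g x) +_) (∑-map g xs f)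

∑-concatMap : ∀ (g : A → List B) xs f → ∑ (concatMap g xs) f ≡ ∑ xs (λ x → ∑ (g x) f)
∑-concatMap g [] f = refl
∑-concatMap g (x ∷ xs) f = trans (∑-++ (g x) (concatMap g xs) f) (cong (∑ (g x) f +_) (∑-concatMap g xs f))

∑-↭ : ∀ {xs ys : List A} f → xs ↭ ys → ∑ xs f ≡ ∑ ys f
∑-↭ f refl = refl
∑-↭ f (prep x p) = cong (f x +_) (∑-↭ f p)
∑-↭ f (swap {xs} {ys} x y p) rewrite ∑-↭ f p = lem (f x) (f y) (∑ ys f)
  where lem : ∀ a b c → a + (b + c) ≡ b + (a + c)
        lem = solve-∀
∑-↭ f (ptrans p q) = trans (∑-↭ f p) (∑-↭ f q)

∑-swap : ∀ (xs : List A) (ys : List B) (f : A → B → ℕ) → ∑ xs (λ x → ∑ ys (f x)) ≡ ∑ ys (λ y → ∑ xs (λ x → f x y))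
∑-swap [] ys f = sym (trans (∑-const ys 0) (*-zeroʳ (length ys)))
∑-swap (x ∷ xs) ys f rewrite ∑-swap xs ys f = sym (∑-+ ys (f x) (λ y → ∑ xs (λ x′ → f x′ y)))

∈⇒≤∑ : ∀ {xs : List A} {x} f → x ∈ xs → f x ≤ ∑ xs f
∈⇒≤∑ {xs = y ∷ xs} f (here refl) = m≤m+n (f y) (∑ xs f)
∈⇒≤∑ {xs = y ∷ xs} f (there m) = ≤-trans (∈⇒≤∑ f m) (m≤n+m (∑ xs f) (f y))

∑-zero : ∀ {xs : List A} f → ∑ xs f ≡ 0 → ∀ {x} → x ∈ xs → f x ≡ 0
∑-zero f e m = n≤0⇒n≡0 (subst (f _ ≤_) e (∈⇒≤∑ f m))

length-allFin : ∀ n → length (allFin n) ≡ n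
length-allFin n = length-tabulate (id {A = Fin n})

-- The list `zs` plays the role of a complement: with `ys` listing all indices or all offers, it
-- splits the whole space into a chosen part and the rest.
unique-⊆⇒↭ : ∀ {xs ys : List A} → Unique xs → (∀ {x} → x ∈ xs → x ∈ ys) → ∃ λ zs → ys ↭ xs ++ zs
unique-⊆⇒↭ {xs = []} {ys} u h = ys , ↭-refl
unique-⊆⇒↭ {xs = x ∷ xs} (x∉ ∷ u) h with ∈-∃++ (h (here refl))
... | as , bs , refl with unique-⊆⇒↭ {xs = xs} {as ++ bs} u sub
  where
  sub : ∀ {y} → y ∈ xs → y ∈ as ++ bs
  sub {y} m with ∈-++⁻ as (h (there m))
  ... | inj₁ p = ∈-++⁺ˡ p
  ... | inj₂ (here refl) = ⊥-elim (All.lookup x∉ m refl)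
  ... | inj₂ (there p) = ∈-++⁺ʳ as p
... | zs , p = zs , ↭-trans (shift x as bs) (prep x p)

Unique-resp-↭ : ∀ {xs ys : List A} → xs ↭ ys → Unique xs → Unique ys
Unique-resp-↭ refl u = u
Unique-resp-↭ (prep x p) (a ∷ u) = All-resp-↭ p a ∷ Unique-resp-↭ p u
Unique-resp-↭ (swap x y p) ((x≢y ∷ a) ∷ b ∷ u) =
  ((x≢y ∘ sym) ∷ All-resp-↭ p b) ∷ All-resp-↭ p a ∷ Unique-resp-↭ p u
Unique-resp-↭ (ptrans p q) u = Unique-resp-↭ q (Unique-resp-↭ p u)

Unique-++ˡ : ∀ (xs : List A) {ys} → Unique (xs ++ ys) → Unique xs
Unique-++ˡ [] u = []
Unique-++ˡ (x ∷ xs) (a ∷ u) = AllP.++⁻ˡ xs a ∷ Unique-++ˡ xs u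

Unique-++ʳ : ∀ (xs : List A) {ys} → Unique (xs ++ ys) → Unique ys
Unique-++ʳ [] u = u
Unique-++ʳ (x ∷ xs) (a ∷ u) = Unique-++ʳ xs u

Unique-disj : ∀ (xs : List A) {ys} → Unique (xs ++ ys) → ∀ {x} → x ∈ xs → ¬ (x ∈ ys)
Unique-disj (x ∷ xs) (a ∷ u) (here refl) m = All.lookup a (∈-++⁺ʳ xs m) refl
Unique-disj (x ∷ xs) (a ∷ u) (there k) m = Unique-disj xs u k m

unique-length-≤ : ∀ {xs ys : List A} → Unique xs → (∀ {x} → x ∈ xs → x ∈ ys) → length xs ≤ length ys
unique-length-≤ {xs = xs} u h with unique-⊆⇒↭ u h
... | zs , p = subst (length xs ≤_) (trans (sym (length-++ xs)) (sym (↭-length p))) (m≤m+n (length xs) (length zs))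

∈-take : ∀ n (ys : List A) {y} → y ∈ take n ys → y ∈ ys
∈-take (suc n) (y ∷ ys) (here e) = here e
∈-take (suc n) (y ∷ ys) (there m) = there (∈-take n ys m)

length-take-≤ : ∀ n (ys : List A) → n ≤ length ys → length (take n ys) ≡ n
length-take-≤ zero ys h = refl
length-take-≤ (suc n) (y ∷ ys) (s≤s h) = cong suc (length-take-≤ n ys h)

module Exclude {A : Set} (_≟_ : (x y : A) → Dec (x ≡ y)) where
  open import Data.List.Membership.DecPropositional _≟_ using (_∈?_)

  exclude : List A → List A → List A
  exclude us ex = filter (λ x → ¬? (x ∈? ex)) us

  exclude-unique : ∀ {us} ex → Unique us → Unique (exclude us ex)
  exclude-unique ex u = UP.filter⁺ (λ x → ¬? (x ∈? ex)) u

  exclude-∈ : ∀ us ex {x} → x ∈ exclude us ex → x ∈ us × x ∉ ex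
  exclude-∈ us ex m = ∈-filter⁻ (λ x → ¬? (x ∈? ex)) m

  ∈-exclude : ∀ us ex {x} → x ∈ us → x ∉ ex → x ∈ exclude us ex
  ∈-exclude us ex m n = ∈-filter⁺ (λ x → ¬? (x ∈? ex)) m n

  exclude-length : ∀ {us} ex → Unique us → length us ≤ length (exclude us ex) + length ex
  exclude-length {us} ex u = subst (length us ≤_) (length-++ (exclude us ex)) (unique-length-≤ u sub)
    where
    sub : ∀ {x} → x ∈ us → x ∈ exclude us ex ++ ex
    sub {x} m with x ∈? ex
    ... | yes k = ∈-++⁺ʳ (exclude us ex) k
    ... | no k = ∈-++⁺ˡ (∈-exclude us ex m k)


module _ {A B : Set} {xs xs′ : List A} {ys ys′ : List B} (f : A → B → ℕ) (u v : ℕ)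
  (in-f : ∀ x y → x ∈ xs → y ∈ ys → f x y ≡ u)
  (out-f : ∀ x y → x ∈ xs′ ⊎ y ∈ ys′ → f x y ≡ v) where

  -- A step function with value u on a rectangle and v outside has sum |rectangle| (u - v) +
  -- |everything| v; the negative term stands on the left to avoid truncated subtraction.
  ∑-rectangle : ∑ (xs ++ xs′) (λ x → ∑ (ys ++ ys′) (f x)) + length xs * length ys * v
              ≡ length xs * length ys * u + length (xs ++ xs′) * length (ys ++ ys′) * v
  ∑-rectangle = begin
    ∑ (xs ++ xs′) (λ x → ∑ (ys ++ ys′) (f x)) + p * q * v
      ≡⟨ cong (_+ p * q * v) (∑-++ xs xs′ (λ x → ∑ (ys ++ ys′) (f x))) ⟩
    ∑ xs (λ x → ∑ (ys ++ ys′) (f x)) + ∑ xs′ (λ x → ∑ (ys ++ ys′) (f x)) + p * q * v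
      ≡⟨ cong₂ (λ a b → a + b + p * q * v) rows rows′ ⟩
    p * (q * u + q′ * v) + p′ * ((q + q′) * v) + p * q * v
      ≡⟨ lem p p′ q q′ u v ⟩
    p * q * u + (p + p′) * (q + q′) * v
      ≡⟨ cong₂ (λ a b → p * q * u + a * b * v) (sym (length-++ xs)) (sym (length-++ ys)) ⟩
    p * q * u + length (xs ++ xs′) * length (ys ++ ys′) * v ∎
    where
    open ≡-Reasoning
    p = length xs
    p′ = length xs′
    q = length ys
    q′ = length ys′
    lem : ∀ p p′ q q′ u v → p * (q * u + q′ * v) + p′ * ((q + q′) * v) + p * q * v ≡ p * q * u + (p + p′) * (q + q′) * v
    lem = solve-∀
    rows : ∑ xs (λ x → ∑ (ys ++ ys′) (f x)) ≡ p * (q * u + q′ * v)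
    rows = trans (∑-cong-∈ xs (λ x m → trans (∑-++ ys ys′ (f x))
        (cong₂ _+_ (trans (∑-cong-∈ ys (λ y k → in-f x y m k)) (∑-const ys u))
                   (trans (∑-cong-∈ ys′ (λ y k → out-f x y (inj₂ k))) (∑-const ys′ v)))))
      (∑-const xs _)
    rows′ : ∑ xs′ (λ x → ∑ (ys ++ ys′) (f x)) ≡ p′ * ((q + q′) * v)
    rows′ = trans (∑-cong-∈ xs′ (λ x m → trans (∑-cong (ys ++ ys′) (λ y → out-f x y (inj₁ m)))
        (trans (∑-const (ys ++ ys′) v) (cong (_* v) (length-++ ys)))))
      (∑-const xs′ _)

-- Binomial tails and factorials in integer form

-- G a c T μ counts the sequences of T rounds with fewer than μ successes, when a outcomes succeed and c fail.
G : (a c T μ : ℕ) → ℕ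
G a c T zero = 0
G a c zero (suc μ) = 1
G a c (suc T) (suc μ) = a * G a c T μ + c * G a c T (suc μ)

-- U a c M h counts the sequences of M rounds with at least h successes.
U : (a c M h : ℕ) → ℕ
U a c M zero = (a + c) ^ M
U a c zero (suc h) = 0
U a c (suc M) (suc h) = a * U a c M h + c * U a c M (suc h)

-- Each success halves the weight 2 ^ μ.
G-weight : ∀ a c T μ → 2 ^ T * G a c T μ ≤ 2 ^ μ * (a + 2 * c) ^ T
G-weight a c T zero = ≤-trans (≤-reflexive (*-zeroʳ (2 ^ T))) z≤n
G-weight a c zero (suc μ) = ≤-trans (m^n>0 2 (suc μ)) (≤-reflexive (sym (*-identityʳ (2 ^ suc μ))))
G-weight a c (suc T) (suc μ) = begin
  2 * 2 ^ T * (a * G a c T μ + c * G a c T (suc μ))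
    ≡⟨ lem₁ (2 ^ T) a c (G a c T μ) (G a c T (suc μ)) ⟩
  2 * a * (2 ^ T * G a c T μ) + 2 * c * (2 ^ T * G a c T (suc μ))
    ≤⟨ +-mono-≤ (*-monoʳ-≤ (2 * a) (G-weight a c T μ)) (*-monoʳ-≤ (2 * c) (G-weight a c T (suc μ))) ⟩
  2 * a * (2 ^ μ * X) + 2 * c * (2 * 2 ^ μ * X)
    ≡⟨ lem₂ (2 ^ μ) X a c ⟩
  2 * 2 ^ μ * ((a + 2 * c) * X) ∎
  where
  open ≤-Reasoning
  X = (a + 2 * c) ^ T
  lem₁ : ∀ t a c g g′ → 2 * t * (a * g + c * g′) ≡ 2 * a * (t * g) + 2 * c * (t * g′)
  lem₁ = solve-∀
  lem₂ : ∀ m x a c → 2 * a * (m * x) + 2 * c * (2 * m * x) ≡ 2 * m * ((a + 2 * c) * x)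
  lem₂ = solve-∀

-- Bernoulli's inequality (1 + a/x)^q ≥ 1 + qa/x, multiplied by x^(q+1).
bernoulli : ∀ x a q → x ^ q * (x + q * a) ≤ x * (x + a) ^ q
bernoulli x a zero = ≤-reflexive (lem x) where
  lem : ∀ x → 1 * (x + 0) ≡ x * 1
  lem = solve-∀
bernoulli x a (suc q) = begin
  x * x ^ q * (x + (a + q * a)) ≤⟨ m≤m+n _ (a * (q * a) * x ^ q) ⟩
  x * x ^ q * (x + (a + q * a)) + a * (q * a) * x ^ q ≡⟨ lem₁ x a q (x ^ q) ⟩
  (x + a) * (x ^ q * (x + q * a)) ≤⟨ *-monoʳ-≤ (x + a) (bernoulli x a q) ⟩
  (x + a) * (x * (x + a) ^ q) ≡⟨ lem₂ (x + a) x ((x + a) ^ q) ⟩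
  x * ((x + a) * (x + a) ^ q) ∎
  where
  open ≤-Reasoning
  lem₁ : ∀ x a q y → x * y * (x + (a + q * a)) + a * (q * a) * y ≡ (x + a) * (y * (x + q * a))
  lem₁ = solve-∀
  lem₂ : ∀ u x y → u * (x * y) ≡ x * (u * y)
  lem₂ = solve-∀

^-distribʳ-* : ∀ m n k → (m * n) ^ k ≡ m ^ k * n ^ k
^-distribʳ-* m n zero = refl
^-distribʳ-* m n (suc k) rewrite ^-distribʳ-* m n k = lem m n (m ^ k) (n ^ k)
  where lem : ∀ a b c d → a * b * (c * d) ≡ a * c * (b * d)
        lem = solve-∀

-- By Bernoulli, q factors 1 + a/x with qa ≥ x multiply to at least 2. The M factors contain κ
-- disjoint blocks of q; the remaining ones are at least 1.
decay : ∀ x a q κ M → 1 ≤ x → x ≤ q * a → q * κ ≤ M → 2 ^ κ * x ^ M ≤ (x + a) ^ M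
decay x a q κ M x>0 x≤qa qκ≤M = begin
  2 ^ κ * x ^ M ≡⟨ cong (λ z → 2 ^ κ * x ^ z) (sym (m+[n∸m]≡n qκ≤M)) ⟩
  2 ^ κ * x ^ (q * κ + r) ≡⟨ cong (2 ^ κ *_) (^-distribˡ-+-* x (q * κ) r) ⟩
  2 ^ κ * (x ^ (q * κ) * x ^ r) ≡⟨ sym (*-assoc (2 ^ κ) (x ^ (q * κ)) (x ^ r)) ⟩
  2 ^ κ * x ^ (q * κ) * x ^ r ≡⟨ cong (λ z → 2 ^ κ * z * x ^ r) (sym (^-*-assoc x q κ)) ⟩
  2 ^ κ * (x ^ q) ^ κ * x ^ r ≡⟨ cong (_* x ^ r) (sym (^-distribʳ-* 2 (x ^ q) κ)) ⟩
  (2 * x ^ q) ^ κ * x ^ r ≤⟨ *-mono-≤ (^-monoˡ-≤ κ double) (^-monoˡ-≤ r (m≤m+n x a)) ⟩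
  ((x + a) ^ q) ^ κ * (x + a) ^ r ≡⟨ cong (_* (x + a) ^ r) (^-*-assoc (x + a) q κ) ⟩
  (x + a) ^ (q * κ) * (x + a) ^ r ≡⟨ sym (^-distribˡ-+-* (x + a) (q * κ) r) ⟩
  (x + a) ^ (q * κ + r) ≡⟨ cong ((x + a) ^_) (m+[n∸m]≡n qκ≤M) ⟩
  (x + a) ^ M ∎
  where
  open ≤-Reasoning
  r = M ∸ q * κ
  instance nz : NonZero x
           nz = >-nonZero x>0
  double : 2 * x ^ q ≤ (x + a) ^ q
  double = *-cancelˡ-≤ x (begin
    x * (2 * x ^ q) ≡⟨ lem x (x ^ q) ⟩
    x ^ q * (x + x) ≤⟨ *-monoʳ-≤ (x ^ q) (+-monoʳ-≤ x x≤qa) ⟩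
    x ^ q * (x + q * a) ≤⟨ bernoulli x a q ⟩
    x * (x + a) ^ q ∎)
    where lem : ∀ x y → x * (2 * y) ≡ y * (x + x)
          lem = solve-∀

-- An exponential Markov inequality. If a round succeeds with probability at least 2/q, then q(μ +
-- κ) rounds give μ successes except with probability 2^-κ: `G-weight` leaves the factor 2^μ ((a +
-- 2c) / (2a + 2c))^T, and 2a + 2c exceeds a + 2c by a, so `decay` applies.
G-tail : ∀ {a c} T μ q κ → 1 ≤ a → 2 * (a + c) ≤ q * a → q * (μ + κ) ≤ T → 2 ^ κ * G a c T μ ≤ (a + c) ^ T
G-tail {a} {c} T μ q κ a>0 2N≤qa T-large = *-cancelˡ-≤ (2 ^ T) {{m^n≢0 2 T}} (begin
  2 ^ T * (2 ^ κ * G a c T μ) ≡⟨ lem₁ (2 ^ T) (2 ^ κ) (G a c T μ) ⟩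
  2 ^ κ * (2 ^ T * G a c T μ) ≤⟨ *-monoʳ-≤ (2 ^ κ) (G-weight a c T μ) ⟩
  2 ^ κ * (2 ^ μ * x ^ T) ≡⟨ lem₂ (2 ^ κ) (2 ^ μ) (x ^ T) ⟩
  2 ^ μ * 2 ^ κ * x ^ T ≡⟨ cong (_* x ^ T) (sym (^-distribˡ-+-* 2 μ κ)) ⟩
  2 ^ (μ + κ) * x ^ T
    ≤⟨ decay x a q (μ + κ) T (≤-trans a>0 (m≤m+n a (2 * c))) (≤-trans (≤-trans (m≤m+n x a) (≤-reflexive (lem₃ a c))) 2N≤qa) T-large ⟩
  (x + a) ^ T ≡⟨ cong (_^ T) (lem₃ a c) ⟩
  (2 * (a + c)) ^ T ≡⟨ ^-distribʳ-* 2 (a + c) T ⟩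
  2 ^ T * (a + c) ^ T ∎)
  where
  open ≤-Reasoning
  x = a + 2 * c
  lem₁ : ∀ a b c → a * (b * c) ≡ b * (a * c)
  lem₁ = solve-∀
  lem₂ : ∀ a b c → a * (b * c) ≡ b * a * c
  lem₂ = solve-∀
  lem₃ : ∀ a c → a + 2 * c + a ≡ 2 * (a + c)
  lem₃ = solve-∀

-- The first two terms of the binomial expansion of (x + 1)^(h+1).
binomial-head : ∀ x h → x ^ suc h + suc h * x ^ h ≤ suc x ^ suc h
binomial-head x zero = ≤-reflexive (lem x) where
  lem : ∀ x → x * 1 + 1 ≡ suc x * 1
  lem = solve-∀
binomial-head x (suc h) = begin
  x * (x * p) + suc (suc h) * (x * p) ≤⟨ m≤m+n _ (suc h * p) ⟩
  x * (x * p) + suc (suc h) * (x * p) + suc h * p ≡⟨ lem x h p ⟩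
  suc x * (x * p + suc h * p) ≤⟨ *-monoʳ-≤ (suc x) (binomial-head x h) ⟩
  suc x * suc x ^ suc h ∎
  where
  open ≤-Reasoning
  p = x ^ h
  lem : ∀ x h p → x * (x * p) + suc (suc h) * (x * p) + suc h * p ≡ suc x * (x * p + suc h * p)
  lem = solve-∀

-- The union bound over the sets of h rounds that could all succeed, with M^h / h! in place of the
-- binomial coefficient. Adding a round replaces M^(h+1) by M^(h+1) + (h+1) M^h, which
-- `binomial-head` absorbs.
U-bound : ∀ a c M h → h ! * (a + c) ^ h * U a c M h ≤ (M * a) ^ h * (a + c) ^ M
U-bound a c M zero = ≤-refl
U-bound a c zero (suc h) = ≤-trans (≤-reflexive (*-zeroʳ (suc h ! * (a + c) ^ suc h))) z≤n
U-bound a c (suc M) (suc h) = begin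
  suc h * h ! * (N * N ^ h) * (a * u + c * u′)
    ≡⟨ lem₁ (suc h) (h !) N (N ^ h) a c u u′ ⟩
  a * N * suc h * (h ! * N ^ h * u) + c * (suc h * h ! * (N * N ^ h) * u′)
    ≤⟨ +-mono-≤ (*-monoʳ-≤ (a * N * suc h) (U-bound a c M h)) (*-mono-≤ (m≤n+m c a) (U-bound a c M (suc h))) ⟩
  a * N * suc h * ((M * a) ^ h * N ^ M) + N * (M * a * (M * a) ^ h * N ^ M)
    ≡⟨ cong (λ z → a * N * suc h * (z * N ^ M) + N * (M * a * z * N ^ M)) (^-distribʳ-* M a h) ⟩
  a * N * suc h * (M ^ h * a ^ h * N ^ M) + N * (M * a * (M ^ h * a ^ h) * N ^ M)
    ≡⟨ lem₂ a N (suc h) (M ^ h) (a ^ h) (N ^ M) M ⟩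
  (M * M ^ h + suc h * M ^ h) * (a * a ^ h) * (N * N ^ M)
    ≤⟨ *-monoˡ-≤ (N * N ^ M) (*-monoˡ-≤ (a * a ^ h) (binomial-head M h)) ⟩
  suc M ^ suc h * (a * a ^ h) * (N * N ^ M)
    ≡⟨ cong (_* (N * N ^ M)) (sym (^-distribʳ-* (suc M) a (suc h))) ⟩
  (suc M * a) ^ suc h * (N * N ^ M) ∎
  where
  open ≤-Reasoning
  N = a + c
  u = U a c M h
  u′ = U a c M (suc h)
  lem₁ : ∀ s f N n a c u v → s * f * (N * n) * (a * u + c * v) ≡ a * N * s * (f * n * u) + c * (s * f * (N * n) * v)
  lem₁ = solve-∀
  lem₂ : ∀ a N s m b p M → a * N * s * (m * b * p) + N * (M * a * (m * b) * p) ≡ (M * m + s * m) * (a * b) * (N * p)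
  lem₂ = solve-∀

n!≤n^n : ∀ n → n ! ≤ n ^ n
n!≤n^n zero = ≤-refl
n!≤n^n (suc n) = *-monoʳ-≤ (suc n) (≤-trans (n!≤n^n n) (^-monoˡ-≤ n (n≤1+n n)))

-- For y = h + 1 the difference y^k - h^k is at most k y^(k-1), and 2k ≤ y makes this at most half
-- of y^k.
[1+h]^k≤2h^k : ∀ h k → 2 * k ≤ suc h → suc h ^ k ≤ 2 * h ^ k
[1+h]^k≤2h^k h k 2k≤ = *-cancelˡ-≤ y (+-cancelʳ-≤ (y * y ^ k) _ _ (begin
  y * y ^ k + y * y ^ k ≡⟨ lem₁ y (y ^ k) ⟩
  2 * (y * y ^ k) ≤⟨ *-monoʳ-≤ 2 (convex k) ⟩
  2 * (y * h ^ k + k * y ^ k) ≡⟨ lem₂ y (h ^ k) k (y ^ k) ⟩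
  y * (2 * h ^ k) + 2 * k * y ^ k ≤⟨ +-monoʳ-≤ _ (*-monoˡ-≤ (y ^ k) 2k≤) ⟩
  y * (2 * h ^ k) + y * y ^ k ∎))
  where
  open ≤-Reasoning
  y = suc h
  lem₁ : ∀ y p → y * p + y * p ≡ 2 * (y * p)
  lem₁ = solve-∀
  lem₂ : ∀ y p k q → 2 * (y * p + k * q) ≡ y * (2 * p) + 2 * k * q
  lem₂ = solve-∀
  convex : ∀ k → y * y ^ k ≤ y * h ^ k + k * y ^ k
  convex zero = m≤m+n _ _
  convex (suc k) = begin
    y * (y * y ^ k) ≤⟨ *-monoʳ-≤ y (convex k) ⟩
    y * (y * h ^ k + k * y ^ k) ≡⟨ lem₃ h (h ^ k) k (y ^ k) ⟩
    y * (h * h ^ k) + (y * h ^ k + k * (y * y ^ k)) ≤⟨ +-monoʳ-≤ (y * (h * h ^ k)) (+-monoˡ-≤ _ (*-monoʳ-≤ y (^-monoˡ-≤ k (n≤1+n h)))) ⟩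
    y * (h * h ^ k) + (y * y ^ k + k * (y * y ^ k)) ∎
    where
    lem₃ : ∀ h p k q → suc h * (suc h * p + k * q) ≡ suc h * (h * p) + (suc h * p + k * (suc h * q))
    lem₃ = solve-∀

-- A weak form of Stirling's formula. In the induction the exponent of (n+1)^n is split into two
-- halves, each costing a factor 2 by the previous lemma.
n^n≤4^n*n! : ∀ n → n ^ n ≤ 4 ^ n * n !
n^n≤4^n*n! zero = ≤-refl
n^n≤4^n*n! (suc n) = begin
  suc n * suc n ^ n ≡⟨ cong (λ z → suc n * suc n ^ z) (sym (⌊n/2⌋+⌈n/2⌉≡n n)) ⟩
  suc n * suc n ^ (k₁ + k₂) ≡⟨ cong (suc n *_) (^-distribˡ-+-* (suc n) k₁ k₂) ⟩
  suc n * (suc n ^ k₁ * suc n ^ k₂) ≤⟨ *-monoʳ-≤ (suc n) (*-mono-≤ ([1+h]^k≤2h^k n k₁ c₁) ([1+h]^k≤2h^k n k₂ c₂)) ⟩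
  suc n * (2 * n ^ k₁ * (2 * n ^ k₂)) ≡⟨ lem₁ (suc n) (n ^ k₁) (n ^ k₂) ⟩
  4 * suc n * (n ^ k₁ * n ^ k₂) ≡⟨ cong (4 * suc n *_) (sym (^-distribˡ-+-* n k₁ k₂)) ⟩
  4 * suc n * n ^ (k₁ + k₂) ≡⟨ cong (λ z → 4 * suc n * n ^ z) (⌊n/2⌋+⌈n/2⌉≡n n) ⟩
  4 * suc n * n ^ n ≤⟨ *-monoʳ-≤ (4 * suc n) (n^n≤4^n*n! n) ⟩
  4 * suc n * (4 ^ n * n !) ≡⟨ lem₂ (suc n) (4 ^ n) (n !) ⟩
  4 * 4 ^ n * (suc n * n !) ∎
  where
  open ≤-Reasoning
  k₁ = ⌊ n /2⌋
  k₂ = ⌈ n /2⌉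
  c₂ : 2 * k₂ ≤ suc n
  c₂ = begin
    k₂ + (k₂ + 0) ≡⟨ cong (k₂ +_) (+-identityʳ k₂) ⟩
    ⌈ n /2⌉ + ⌊ suc n /2⌋ ≤⟨ +-monoˡ-≤ _ (⌊n/2⌋-mono (n≤1+n (suc n))) ⟩
    ⌈ suc n /2⌉ + ⌊ suc n /2⌋ ≡⟨ +-comm ⌈ suc n /2⌉ _ ⟩
    ⌊ suc n /2⌋ + ⌈ suc n /2⌉ ≡⟨ ⌊n/2⌋+⌈n/2⌉≡n (suc n) ⟩
    suc n ∎
  c₁ : 2 * k₁ ≤ suc n
  c₁ = ≤-trans (*-monoʳ-≤ 2 (⌊n/2⌋≤⌈n/2⌉ n)) c₂
  lem₁ : ∀ s a b → s * (2 * a * (2 * b)) ≡ 4 * s * (a * b)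
  lem₁ = solve-∀
  lem₂ : ∀ s a b → 4 * s * (a * b) ≡ 4 * a * (s * b)
  lem₂ = solve-∀

-- Subsets of `Fin n`: cardinality, enumeration and the number of small subsets

opaque
  # : ∀ {n} → (Fin n → Bool) → ℕ
  # {n} S = ∑ (allFin n) (⟦_⟧ ∘ S)

  #≡∑ : ∀ {n} (S : Fin n → Bool) → # S ≡ ∑ (allFin n) (⟦_⟧ ∘ S)
  #≡∑ S = refl

∑-tabulate : ∀ {n} (g : Fin n → A) f → ∑ (tabulate g) f ≡ ∑ (allFin n) (f ∘ g)
∑-tabulate {n = zero} g f = refl
∑-tabulate {n = suc n} g f = cong (f (g zero) +_)
  (trans (∑-tabulate (g ∘ suc) f) (sym (∑-tabulate suc (f ∘ g))))

∑-allFin-suc : ∀ {n} (f : Fin (suc n) → ℕ) → ∑ (allFin (suc n)) f ≡ f zero + ∑ (allFin n) (f ∘ suc)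
∑-allFin-suc f = cong (f zero +_) (∑-tabulate suc f)

#-suc : ∀ {n} (S : Fin (suc n) → Bool) → # S ≡ ⟦ S zero ⟧ + # (S ∘ suc)
#-suc S = trans (#≡∑ S) (trans (∑-allFin-suc (⟦_⟧ ∘ S)) (cong (⟦ S zero ⟧ +_) (sym (#≡∑ (S ∘ suc)))))

extend : ∀ {n} → Bool → (Fin n → Bool) → Fin (suc n) → Bool
extend b S zero = b
extend b S (suc i) = S i

subsetsOf : ∀ n → List (Fin n → Bool)
subsetsOf zero = (λ ()) ∷ []
subsetsOf (suc n) = map (extend true) (subsetsOf n) ++ map (extend false) (subsetsOf n)

length-subsetsOf : ∀ n → length (subsetsOf n) ≡ 2 ^ n
length-subsetsOf zero = refl
length-subsetsOf (suc n) = begin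
  length (map (extend true) (subsetsOf n) ++ map (extend false) (subsetsOf n))
    ≡⟨ length-++ (map (extend true) (subsetsOf n)) ⟩
  length (map (extend true) (subsetsOf n)) + length (map (extend false) (subsetsOf n))
    ≡⟨ cong₂ _+_ (length-map _ (subsetsOf n)) (length-map _ (subsetsOf n)) ⟩
  length (subsetsOf n) + length (subsetsOf n)
    ≡⟨ cong (λ z → z + z) (length-subsetsOf n) ⟩
  2 ^ n + 2 ^ n
    ≡⟨ cong (2 ^ n +_) (sym (+-identityʳ (2 ^ n))) ⟩
  2 ^ suc n ∎
  where open ≡-Reasoning

-- A set is only pointwise equal to its listed copy; later arguments carry cardinalities and edge
-- counts from one to the other.
subsetsOf-complete : ∀ {n} (S : Fin n → Bool) → ∃ λ S′ → S′ ∈ subsetsOf n × (∀ i → S′ i ≡ S i)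
subsetsOf-complete {zero} S = (λ ()) , here refl , λ ()
subsetsOf-complete {suc n} S with S zero in eq | subsetsOf-complete (S ∘ suc)
... | true | S′ , m , e = extend true S′ , ∈-++⁺ˡ (∈-map⁺ (extend true) m) , λ { zero → sym eq ; (suc i) → e i }
... | false | S′ , m , e = extend false S′ , ∈-++⁺ʳ (map (extend true) (subsetsOf n)) (∈-map⁺ (extend false) m) , λ { zero → sym eq ; (suc i) → e i }

small : ∀ n i → ℕ
small n i = ∑ (subsetsOf n) (λ S → ⟦ # S ≤ᵇ i ⟧)

small-suc : ∀ n i → small (suc n) i ≡ ∑ (subsetsOf n) (λ S → ⟦ suc (# S) ≤ᵇ i ⟧) + small n i
small-suc n i = trans (∑-++ (map (extend true) (subsetsOf n)) _ _)
  (cong₂ _+_ (trans (∑-map (extend true) (subsetsOf n) _) (∑-cong (subsetsOf n) (λ S → cong (λ z → ⟦ z ≤ᵇ i ⟧) (#-suc (extend true S)))))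
             (trans (∑-map (extend false) (subsetsOf n) _) (∑-cong (subsetsOf n) (λ S → cong (λ z → ⟦ z ≤ᵇ i ⟧) (#-suc (extend false S))))))

<ᵇ-suc : ∀ m n → (m <ᵇ suc n) ≡ (m ≤ᵇ n)
<ᵇ-suc zero n = refl
<ᵇ-suc (suc m) n = refl

-- Here `small n i` is the sum of the binomial coefficients of n up to i. Pascal's rule gives the
-- recursion, and the two inductive bounds are the first two binomial terms of the claimed power.
small-bound : ∀ n i → i ! * small n i ≤ (n + i) ^ i
small-bound zero i = begin
  i ! * (⟦ # {0} (λ ()) ≤ᵇ i ⟧ + 0) ≡⟨ cong (λ z → i ! * (⟦ z ≤ᵇ i ⟧ + 0)) (#≡∑ {0} (λ ())) ⟩
  i ! * 1 ≡⟨ *-identityʳ (i !) ⟩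
  i ! ≤⟨ n!≤n^n i ⟩
  i ^ i ∎
  where open ≤-Reasoning
small-bound (suc n) zero = begin
  1 * small (suc n) 0 ≡⟨ cong (1 *_) (small-suc n 0) ⟩
  1 * (∑ (subsetsOf n) (λ _ → 0) + small n 0) ≡⟨ cong (λ z → 1 * (z + small n 0)) (trans (∑-const (subsetsOf n) 0) (*-zeroʳ (length (subsetsOf n)))) ⟩
  1 * small n 0 ≤⟨ small-bound n 0 ⟩
  1 ∎
  where open ≤-Reasoning
small-bound (suc n) (suc i) = begin
  suc i * i ! * small (suc n) (suc i)
    ≡⟨ cong (suc i * i ! *_) (trans (small-suc n (suc i)) (cong (_+ small n (suc i)) (∑-cong (subsetsOf n) (λ S → cong ⟦_⟧ (<ᵇ-suc (# S) i))))) ⟩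
  suc i * i ! * (small n i + small n (suc i))
    ≡⟨ lem (suc i) (i !) (small n i) (small n (suc i)) ⟩
  suc i * (i ! * small n i) + suc i * i ! * small n (suc i)
    ≤⟨ +-mono-≤ (*-monoʳ-≤ (suc i) (≤-trans (small-bound n i) (^-monoˡ-≤ i (+-monoʳ-≤ n (n≤1+n i))))) (small-bound n (suc i)) ⟩
  suc i * y ^ i + y ^ suc i
    ≡⟨ +-comm (suc i * y ^ i) _ ⟩
  y ^ suc i + suc i * y ^ i
    ≤⟨ binomial-head y i ⟩
  suc y ^ suc i ∎
  where
  open ≤-Reasoning
  y = n + suc i
  lem : ∀ s f a b → s * f * (a + b) ≡ s * (f * a) + s * f * b
  lem = solve-∀

-- Counting over sequences of random outcomes

module Sequences {O : Set} (Os : List O) (r : ℕ) where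

  -- Sum over the sequences of M rounds; r outcomes per round leave no record.
  Ex : ℕ → (List O → ℕ) → ℕ
  Ex zero φ = φ []
  Ex (suc M) φ = ∑ Os (λ o → Ex M (λ w → φ (o ∷ w))) + r * Ex M φ

  Ex-cong : ∀ M {φ ψ} → (∀ w → φ w ≡ ψ w) → Ex M φ ≡ Ex M ψ
  Ex-cong zero h = h []
  Ex-cong (suc M) h = cong₂ _+_ (∑-cong Os (λ o → Ex-cong M (λ w → h (o ∷ w)))) (cong (r *_) (Ex-cong M h))

  Ex-+ : ∀ M φ ψ → Ex M (λ w → φ w + ψ w) ≡ Ex M φ + Ex M ψ
  Ex-+ zero φ ψ = refl
  Ex-+ (suc M) φ ψ = begin
    ∑ Os (λ o → Ex M (λ w → φ (o ∷ w) + ψ (o ∷ w))) + r * Ex M (λ w → φ w + ψ w)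
      ≡⟨ cong₂ (λ a b → a + r * b) (trans (∑-cong Os (λ o → Ex-+ M _ _)) (∑-+ Os _ _)) (Ex-+ M φ ψ) ⟩
    ∑ Os f + ∑ Os g + r * (Ex M φ + Ex M ψ)
      ≡⟨ lem (∑ Os f) (∑ Os g) r (Ex M φ) (Ex M ψ) ⟩
    Ex (suc M) φ + Ex (suc M) ψ ∎
    where
    open ≡-Reasoning
    f g : O → ℕ
    f o = Ex M (λ w → φ (o ∷ w))
    g o = Ex M (λ w → ψ (o ∷ w))
    lem : ∀ a b r c d → a + b + r * (c + d) ≡ a + r * c + (b + r * d)
    lem = solve-∀

  Ex-const : ∀ M c → Ex M (λ _ → c) ≡ (length Os + r) ^ M * c
  Ex-const zero c = sym (+-identityʳ c)
  Ex-const (suc M) c = begin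
    ∑ Os (λ _ → Ex M (λ _ → c)) + r * Ex M (λ _ → c)
      ≡⟨ cong (_+ r * Ex M (λ _ → c)) (∑-const Os _) ⟩
    length Os * Ex M (λ _ → c) + r * Ex M (λ _ → c)
      ≡⟨ cong (λ z → length Os * z + r * z) (Ex-const M c) ⟩
    length Os * ((length Os + r) ^ M * c) + r * ((length Os + r) ^ M * c)
      ≡⟨ lem (length Os) r ((length Os + r) ^ M) c ⟩
    (length Os + r) * (length Os + r) ^ M * c ∎
    where
    open ≡-Reasoning
    lem : ∀ a r p c → a * (p * c) + r * (p * c) ≡ (a + r) * p * c
    lem = solve-∀

  Ex-∑ : ∀ M (vs : List A) (φ : A → List O → ℕ) → Ex M (λ w → ∑ vs (λ v → φ v w)) ≡ ∑ vs (λ v → Ex M (φ v))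
  Ex-∑ M [] φ = trans (Ex-const M 0) (*-zeroʳ ((length Os + r) ^ M))
  Ex-∑ M (v ∷ vs) φ = trans (Ex-+ M (φ v) _) (cong (Ex M (φ v) +_) (Ex-∑ M vs φ))

  Ex-*ˡ : ∀ M c φ → Ex M (λ w → c * φ w) ≡ c * Ex M φ
  Ex-*ˡ zero c φ = refl
  Ex-*ˡ (suc M) c φ = begin
    ∑ Os (λ o → Ex M (λ w → c * φ (o ∷ w))) + r * Ex M (λ w → c * φ w)
      ≡⟨ cong₂ (λ a b → a + r * b) (trans (∑-cong Os (λ o → Ex-*ˡ M c _)) (∑-*ˡ Os c _)) (Ex-*ˡ M c φ) ⟩
    c * ∑ Os (λ o → Ex M (λ w → φ (o ∷ w))) + r * (c * Ex M φ)
      ≡⟨ lem c (∑ Os (λ o → Ex M (λ w → φ (o ∷ w)))) r (Ex M φ) ⟩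
    c * Ex (suc M) φ ∎
    where
    open ≡-Reasoning
    lem : ∀ c a r b → c * a + r * (c * b) ≡ c * (a + r * b)
    lem = solve-∀

  count : (O → Bool) → List O → ℕ
  count P w = ∑ w (⟦_⟧ ∘ P)

  module _ (P : O → Bool) where
    hit miss : ℕ
    hit = ∑ Os (⟦_⟧ ∘ P)
    miss = ∑ Os (⟦_⟧ ∘ not ∘ P) + r

    hit+miss : hit + miss ≡ length Os + r
    hit+miss = begin
      hit + (∑ Os (⟦_⟧ ∘ not ∘ P) + r) ≡⟨ sym (+-assoc hit _ r) ⟩
      hit + ∑ Os (⟦_⟧ ∘ not ∘ P) + r ≡⟨ cong (_+ r) (sym (∑-+ Os _ _)) ⟩
      ∑ Os (λ o → ⟦ P o ⟧ + ⟦ not (P o) ⟧) + r ≡⟨ cong (_+ r) (trans (∑-cong Os one) (trans (∑-const Os 1) (*-identityʳ (length Os)))) ⟩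
      length Os + r ∎
      where
      open ≡-Reasoning
      one : ∀ o → ⟦ P o ⟧ + ⟦ not (P o) ⟧ ≡ 1
      one o with P o
      ... | true = refl
      ... | false = refl

    split : ∀ u v → ∑ Os (λ o → if P o then u else v) + r * v ≡ hit * u + miss * v
    split u v = begin
      ∑ Os (λ o → if P o then u else v) + r * v
        ≡⟨ cong (_+ r * v) (trans (∑-cong Os cases) (∑-+ Os _ _)) ⟩
      ∑ Os (λ o → ⟦ P o ⟧ * u) + ∑ Os (λ o → ⟦ not (P o) ⟧ * v) + r * v
        ≡⟨ cong₂ (λ x y → x + y + r * v) (∑-*ʳ Os u _) (∑-*ʳ Os v _) ⟩
      hit * u + ∑ Os (⟦_⟧ ∘ not ∘ P) * v + r * v
        ≡⟨ lem (hit * u) (∑ Os (⟦_⟧ ∘ not ∘ P)) r v ⟩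
      hit * u + miss * v ∎
      where
      open ≡-Reasoning
      lem : ∀ x y r v → x + y * v + r * v ≡ x + (y + r) * v
      lem = solve-∀
      cases : ∀ o → (if P o then u else v) ≡ ⟦ P o ⟧ * u + ⟦ not (P o) ⟧ * v
      cases o with P o
      ... | true = sym (trans (+-identityʳ (u + 0)) (+-identityʳ u))
      ... | false = sym (+-identityʳ v)

    -- Only the hits of P matter: splitting the first outcome by P turns the recursion of `Ex` into
    -- that of `U`. Outcomes that leave no record count as misses.
    Ex-upper : ∀ M h → Ex M (λ w → ⟦ h ≤ᵇ count P w ⟧) ≡ U hit miss M h
    Ex-upper M zero = trans (Ex-const M 1) (trans (*-identityʳ _) (cong (_^ M) (sym hit+miss)))
    Ex-upper zero (suc h) = refl
    Ex-upper (suc M) (suc h) = trans (cong₂ _+_ (∑-cong Os step) (cong (r *_) (Ex-upper M (suc h)))) (split (U hit miss M h) (U hit miss M (suc h)))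
      where
      step : ∀ o → Ex M (λ w → ⟦ suc h ≤ᵇ count P (o ∷ w) ⟧) ≡ (if P o then U hit miss M h else U hit miss M (suc h))
      step o with P o
      ... | true = trans (Ex-cong M (λ w → cong ⟦_⟧ (trans (lem h (count P w)) refl))) (Ex-upper M h)
        where lem : ∀ h x → (suc h ≤ᵇ suc x) ≡ (h ≤ᵇ x)
              lem zero x = refl
              lem (suc h) x = refl
      ... | false = Ex-upper M (suc h)

    Ex-lower : ∀ M h → Ex M (λ w → ⟦ count P w <ᵇ h ⟧) ≡ G hit miss M h
    Ex-lower M zero = trans (Ex-cong M (λ w → cong ⟦_⟧ (lem (count P w)))) (trans (Ex-const M 0) (*-zeroʳ ((length Os + r) ^ M)))
      where lem : ∀ x → (x <ᵇ 0) ≡ false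
            lem zero = refl
            lem (suc x) = refl
    Ex-lower zero (suc h) = refl
    Ex-lower (suc M) (suc h) = trans (cong₂ _+_ (∑-cong Os step) (cong (r *_) (Ex-lower M (suc h)))) (split (G hit miss M h) (G hit miss M (suc h)))
      where
      step : ∀ o → Ex M (λ w → ⟦ count P (o ∷ w) <ᵇ suc h ⟧) ≡ (if P o then G hit miss M h else G hit miss M (suc h))
      step o with P o
      ... | true = Ex-lower M h
      ... | false = Ex-lower M (suc h)

-- Boolean set algebra

opaque
  _==_ : ∀ {n} → Fin n → Fin n → Bool
  i == j = ⌊ i FinP.≟ j ⌋

  ==-refl : ∀ {n} (i : Fin n) → (i == i) ≡ true
  ==-refl i with i FinP.≟ i
  ... | yes _ = refl
  ... | no ¬p = ⊥-elim (¬p refl)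

  ==⇒≡ : ∀ {n} {i j : Fin n} → (i == j) ≡ true → i ≡ j
  ==⇒≡ {i = i} {j} e with i FinP.≟ j
  ... | yes p = p
  ==⇒≡ () | no _

  ≢⇒== : ∀ {n} {i j : Fin n} → i ≢ j → (i == j) ≡ false
  ≢⇒== {i = i} {j} ne with i FinP.≟ j
  ... | yes p = ⊥-elim (ne p)
  ... | no _ = refl

  suc==suc : ∀ {n} (i j : Fin n) → (suc i == suc j) ≡ (i == j)
  suc==suc i j with i FinP.≟ j
  ... | yes _ = refl
  ... | no _ = refl

∧-true : ∀ {a b} → a ∧ b ≡ true → a ≡ true × b ≡ true
∧-true {true} {true} _ = refl , refl

∨-true : ∀ {a b} → a ∨ b ≡ true → a ≡ true ⊎ b ≡ true
∨-true {true} _ = inj₁ refl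
∨-true {false} e = inj₂ e

∨-introˡ : ∀ {a b} → a ≡ true → a ∨ b ≡ true
∨-introˡ refl = refl

∨-introʳ : ∀ {a b} → b ≡ true → a ∨ b ≡ true
∨-introʳ {true} _ = refl
∨-introʳ {false} e = e

∧-intro : ∀ {a b} → a ≡ true → b ≡ true → a ∧ b ≡ true
∧-intro refl refl = refl

not-true : ∀ {a} → not a ≡ true → a ≡ false
not-true {false} _ = refl

true≢false : ∀ {b : Bool} → b ≡ true → b ≡ false → ∀ {X : Set} → X
true≢false refl ()

bool-cases : ∀ b → b ≡ true ⊎ b ≡ false
bool-cases true = inj₁ refl
bool-cases false = inj₂ refl

infix 4 _⊑_
_⊑_ : ∀ {n} → (Fin n → Bool) → (Fin n → Bool) → Set
S ⊑ T = ∀ x → S x ≡ true → T x ≡ true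

_∪ᵇ_ _∩ᵇ_ _∖ᵇ_ : ∀ {n} → (Fin n → Bool) → (Fin n → Bool) → Fin n → Bool
(S ∪ᵇ T) x = S x ∨ T x
(S ∩ᵇ T) x = S x ∧ T x
(S ∖ᵇ T) x = S x ∧ not (T x)

#-cong : ∀ {n} {S T : Fin n → Bool} → (∀ x → S x ≡ T x) → # S ≡ # T
#-cong {n} {S} {T} h = trans (#≡∑ S) (trans (∑-cong (allFin n) (cong ⟦_⟧ ∘ h)) (sym (#≡∑ T)))

#-mono : ∀ {n} {S T : Fin n → Bool} → S ⊑ T → # S ≤ # T
#-mono {n} {S} {T} h = subst₂ _≤_ (sym (#≡∑ S)) (sym (#≡∑ T)) (∑-mono (allFin n) (λ x → lem (S x) (T x) (h x)))
  where lem : ∀ a b → (a ≡ true → b ≡ true) → ⟦ a ⟧ ≤ ⟦ b ⟧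
        lem false b h = z≤n
        lem true b h = ≤-reflexive (sym (cong ⟦_⟧ (h refl)))

#-∪∩ : ∀ {n} (S T : Fin n → Bool) → # S + # T ≡ # (S ∪ᵇ T) + # (S ∩ᵇ T)
#-∪∩ {n} S T rewrite #≡∑ S | #≡∑ T | #≡∑ (S ∪ᵇ T) | #≡∑ (S ∩ᵇ T) =
  trans (sym (∑-+ (allFin n) _ _)) (trans (∑-cong (allFin n) (λ x → lem (S x) (T x))) (∑-+ (allFin n) _ _))
  where lem : ∀ a b → ⟦ a ⟧ + ⟦ b ⟧ ≡ ⟦ a ∨ b ⟧ + ⟦ a ∧ b ⟧
        lem true b = refl
        lem false b = sym (+-identityʳ _)

#-∖ : ∀ {n} (S T : Fin n → Bool) → # S ≡ # (S ∩ᵇ T) + # (S ∖ᵇ T)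
#-∖ {n} S T rewrite #≡∑ S | #≡∑ (S ∩ᵇ T) | #≡∑ (S ∖ᵇ T) = trans (∑-cong (allFin n) (λ x → lem (S x) (T x))) (∑-+ (allFin n) _ _)
  where lem : ∀ a b → ⟦ a ⟧ ≡ ⟦ a ∧ b ⟧ + ⟦ a ∧ not b ⟧
        lem true true = refl
        lem true false = refl
        lem false b = refl

#-false : ∀ {n} {S : Fin n → Bool} → (∀ x → S x ≡ false) → # S ≡ 0
#-false {n} {S} h = trans (#≡∑ S) (trans (∑-cong (allFin n) (cong ⟦_⟧ ∘ h)) (trans (∑-const (allFin n) 0) (*-zeroʳ (length (allFin n)))))

#-single : ∀ {n} (i : Fin n) → # (_== i) ≡ 1
#-single zero = trans (#-suc (_== zero)) (cong₂ _+_ (cong ⟦_⟧ (==-refl zero)) (#-false (λ x → ≢⇒== (λ ()))))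
#-single (suc i) = trans (#-suc (_== suc i)) (trans (cong₂ _+_ (cong ⟦_⟧ (≢⇒== (λ ()))) (#-cong {S = λ x → suc x == suc i} {λ x → x == i} (λ x → suc==suc x i))) (#-single i))

#-∈ : ∀ {n} {S : Fin n → Bool} → 1 ≤ # S → ∃ λ x → S x ≡ true
#-∈ {zero} {S} h = ⊥-elim (<-irrefl refl (subst (1 ≤_) (#-false {0} {S} (λ ())) h))
#-∈ {suc n} {S} h with bool-cases (S zero)
... | inj₁ e = zero , e
... | inj₂ e with #-∈ {n} {S ∘ suc} (subst (1 ≤_) (trans (#-suc S) (cong (λ z → ⟦ z ⟧ + # (S ∘ suc)) e)) h)
...   | x , p = suc x , p

#-insert : ∀ {n} (S : Fin n → Bool) x → S x ≡ false → # (S ∪ᵇ (_== x)) ≡ suc (# S)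
#-insert S x e = begin
  # (S ∪ᵇ (_== x)) ≡⟨ sym (+-identityʳ _) ⟩
  # (S ∪ᵇ (_== x)) + 0 ≡⟨ cong (# (S ∪ᵇ (_== x)) +_) (sym (#-false disj)) ⟩
  # (S ∪ᵇ (_== x)) + # (S ∩ᵇ (_== x)) ≡⟨ sym (#-∪∩ S (_== x)) ⟩
  # S + # (_== x) ≡⟨ cong (# S +_) (#-single x) ⟩
  # S + 1 ≡⟨ +-comm (# S) 1 ⟩
  suc (# S) ∎
  where
  open ≡-Reasoning
  disj : ∀ y → (S ∩ᵇ (_== x)) y ≡ false
  disj y with y FinP.≟ x
  ... | yes refl rewrite e = refl
  ... | no ne rewrite ≢⇒== ne = ∧-zeroʳ (S y)

opaque
  any-set : ∀ {n} → (Fin n → Bool) → Bool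
  any-set f = ⌊ FinP.any? (λ x → f x ≟ᵇ true) ⌋

  any-set⁺ : ∀ {n} {f : Fin n → Bool} x → f x ≡ true → any-set f ≡ true
  any-set⁺ {f = f} x e with FinP.any? (λ x → f x ≟ᵇ true)
  ... | yes _ = refl
  ... | no ¬p = ⊥-elim (¬p (x , e))

  any-set⁻ : ∀ {n} {f : Fin n → Bool} → any-set f ≡ true → ∃ λ x → f x ≡ true
  any-set⁻ {f = f} e with FinP.any? (λ x → f x ≟ᵇ true)
  ... | yes p = p
  any-set⁻ () | no _

-- Hall's theorem, by Rado's argument: as long as some vertex has two edges, one of them can be
-- deleted, since violations for both deletions contradict the submodularity of S ↦ # (Nb S).
module Hall {a b : ℕ} (P : Fin a → Bool) where

  Rel : Set
  Rel = Fin a → Fin b → Bool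

  Nb : Rel → (Fin a → Bool) → Fin b → Bool
  Nb E S y = any-set (λ x → S x ∧ E x y)

  Nb⁺ : ∀ {E S x y} → S x ≡ true → E x y ≡ true → Nb E S y ≡ true
  Nb⁺ {x = x} s e = any-set⁺ x (∧-intro s e)

  Nb⁻ : ∀ {E S y} → Nb E S y ≡ true → ∃ λ x → S x ≡ true × E x y ≡ true
  Nb⁻ h with any-set⁻ h
  ... | x , e = x , ∧-true e

  HallCond : Rel → Set
  HallCond E = ∀ S → S ⊑ P → # S ≤ # (Nb E S)

  Violator : Rel → Set
  Violator E = ∃ λ S → S ⊑ P × # (Nb E S) < # S

  -- The condition ranges over functions, so the search runs through the finite list of subsets; an
  -- arbitrary violator would yield a pointwise equal one in the list.
  hall? : ∀ E → HallCond E ⊎ Violator E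
  hall? E with Any.any? dec (subsetsOf a)
    where
    dec : ∀ S → Dec (S ⊑ P × # (Nb E S) < # S)
    dec S = FinP.all? (λ x → (S x ≟ᵇ true) →-dec (P x ≟ᵇ true))
            ×-dec (# (Nb E S) <? # S)
  ... | yes p = inj₂ (Any.satisfied p)
  ... | no ¬p = inj₁ λ S S⊑P → ≮⇒≥ λ lt → ¬p (viol S S⊑P lt)
    where
    viol : ∀ S → S ⊑ P → # (Nb E S) < # S → _
    viol S S⊑P lt with subsetsOf-complete S
    ... | S′ , m , e = Any.map
          (λ { refl → (λ x s → S⊑P x (trans (sym (e x)) s)) , subst₂ _<_ (sym (#-cong nb)) (sym (#-cong e)) lt }) m
      where
      nb : ∀ y → Nb E S′ y ≡ Nb E S y
      nb y = ⇔→≡ {z = true} (mk⇔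
        (λ h → let x , s , f = Nb⁻ {E} {S′} {y} h in Nb⁺ {E} {S} {x} {y} (trans (sym (e x)) s) f)
        (λ h → let x , s , f = Nb⁻ {E} {S} {y} h in Nb⁺ {E} {S′} {x} {y} (trans (e x) s) f))

  -- M is a relation that need not be functional. By `total` and `injective`, any choice of one
  -- partner for each vertex of P is an injection.
  record Matching (E : Rel) : Set where
    field
      M : Rel
      M⊆E : ∀ {x y} → M x y ≡ true → E x y ≡ true
      total : ∀ {x} → P x ≡ true → ∃ λ y → M x y ≡ true
      injective : ∀ {x x′ y} → P x ≡ true → P x′ ≡ true → M x y ≡ true → M x′ y ≡ true → x ≡ x′

  delete : Rel → Fin a → Fin b → Rel
  delete E x₀ y₀ x y = E x y ∧ not ((x == x₀) ∧ (y == y₀))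

  delete⁻ : ∀ {E x₀ y₀ x y} → delete E x₀ y₀ x y ≡ true → E x y ≡ true
  delete⁻ h = proj₁ (∧-true h)

  delete-x : ∀ {E x₀ y₀ x y} → x ≢ x₀ → E x y ≡ true → delete E x₀ y₀ x y ≡ true
  delete-x ne e rewrite e | ≢⇒== ne = refl

  delete-y : ∀ {E x₀ y₀ x y} → y ≢ y₀ → E x y ≡ true → delete E x₀ y₀ x y ≡ true
  delete-y {x₀ = x₀} {x = x} ne e rewrite e | ≢⇒== ne with x == x₀
  ... | true = refl
  ... | false = refl

  size : Rel → ℕ
  size E = ∑ (allFin a) (λ x → # (E x))

  delete-size : ∀ E x₀ y₀ → E x₀ y₀ ≡ true → size (delete E x₀ y₀) < size E
  delete-size E x₀ y₀ e = ∑-strict (allFin a) (λ x → #-mono (λ y → delete⁻ {E} {x₀} {y₀} {x} {y})) (∈-allFin x₀)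
      (subst (_≤ # (E x₀)) (#-insert _ y₀ gone) (#-mono sub))
    where
    gone : delete E x₀ y₀ x₀ y₀ ≡ false
    gone rewrite e | ==-refl x₀ | ==-refl y₀ = refl
    sub : (delete E x₀ y₀ x₀ ∪ᵇ (_== y₀)) ⊑ E x₀
    sub y h with ∨-true {delete E x₀ y₀ x₀ y} h
    ... | inj₁ p = delete⁻ {E} {x₀} {y₀} {x₀} p
    ... | inj₂ p = trans (cong (E x₀) (==⇒≡ p)) e
    ∑-strict : ∀ (xs : List (Fin a)) {f g} → (∀ x → f x ≤ g x) → ∀ {x} → x ∈ xs → f x < g x → ∑ xs f < ∑ xs g
    ∑-strict (x ∷ xs) h (here refl) lt = +-mono-<-≤ lt (∑-mono xs h)
    ∑-strict (x ∷ xs) h (there m) lt = +-mono-≤-< (h x) (∑-strict xs h m lt)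

  module _ (E : Rel) (hall : HallCond E) where

    two-neighbours : Set
    two-neighbours = ∃ λ x → ∃ λ y₁ → ∃ λ y₂ → E x y₁ ≡ true × E x y₂ ≡ true × y₁ ≢ y₂

    two? : Dec two-neighbours
    two? = FinP.any? λ x → FinP.any? λ y₁ → FinP.any? λ y₂ →
      (E x y₁ ≟ᵇ true) ×-dec ((E x y₂ ≟ᵇ true)
        ×-dec ¬? (y₁ FinP.≟ y₂))

    -- Hall's condition for singletons gives every vertex of P an edge. For a pair it rules out a
    -- common neighbour, which would be the only neighbour of both.
    no-two⇒matching : ¬ two-neighbours → Matching E
    no-two⇒matching no2 = record { M = E ; M⊆E = id ; total = tot ; injective = inj }
      where
      tot : ∀ {x} → P x ≡ true → ∃ λ y → E x y ≡ true
      tot {x} p with #-∈ (subst (_≤ # (Nb E (_== x))) (#-single x) (hall (_== x) (λ z q → trans (cong P (==⇒≡ q)) p)))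
      ... | y , h with Nb⁻ {E} {_== x} h
      ...   | z , q , e = y , subst (λ u → E u y ≡ true) (==⇒≡ q) e
      inj : ∀ {x x′ y} → P x ≡ true → P x′ ≡ true → E x y ≡ true → E x′ y ≡ true → x ≡ x′
      inj {x} {x′} {y} p p′ e e′ with x FinP.≟ x′
      ... | yes q = q
      ... | no ne = ⊥-elim (<-irrefl refl (begin
          2 ≡⟨ cong suc (sym (#-single x)) ⟩
          suc (# (_== x)) ≡⟨ sym (#-insert (_== x) x′ (≢⇒== (ne ∘ sym))) ⟩
          # ((_== x) ∪ᵇ (_== x′)) ≤⟨ hall ((_== x) ∪ᵇ (_== x′)) sub ⟩
          # (Nb E ((_== x) ∪ᵇ (_== x′))) ≤⟨ #-mono one ⟩
          # (_== y) ≡⟨ #-single y ⟩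
          1 ∎))
        where
        open ≤-Reasoning
        sub : ((_== x) ∪ᵇ (_== x′)) ⊑ P
        sub z h with ∨-true {z == x} h
        ... | inj₁ q = trans (cong P (==⇒≡ q)) p
        ... | inj₂ q = trans (cong P (==⇒≡ q)) p′
        only : ∀ {u v} → E u y ≡ true → E u v ≡ true → v ≡ y
        only {u} {v} s t with v FinP.≟ y
        ... | yes q = q
        ... | no q = ⊥-elim (no2 (u , v , y , t , s , q))
        one : Nb E ((_== x) ∪ᵇ (_== x′)) ⊑ (_== y)
        one v h with Nb⁻ {E} {(_== x) ∪ᵇ (_== x′)} h
        ... | z , s , f with ∨-true {z == x} s
        ...   | inj₁ q = subst (λ u → (u == y) ≡ true) (sym (only e (subst (λ u → E u v ≡ true) (==⇒≡ q) f))) (==-refl y)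
        ...   | inj₂ q = subst (λ u → (u == y) ≡ true) (sym (only e′ (subst (λ u → E u v ≡ true) (==⇒≡ q) f))) (==-refl y)

    module _ {x : Fin a} {y₁ y₂ : Fin b} (e₁ : E x y₁ ≡ true) (e₂ : E x y₂ ≡ true) (y₁≢y₂ : y₁ ≢ y₂) where

      -- A set avoiding x keeps all its neighbours when an edge at x is deleted, and so cannot
      -- become a violator.
      contains-x : ∀ {y₀ S} → S ⊑ P → # (Nb (delete E x y₀) S) < # S → S x ≡ true
      contains-x {y₀} {S} S⊑P lt with bool-cases (S x)
      ... | inj₁ s = s
      ... | inj₂ s = ⊥-elim (<-irrefl refl (≤-trans lt (≤-trans (hall S S⊑P) (#-mono sub))))
        where
        sub : Nb E S ⊑ Nb (delete E x y₀) S
        sub y h with Nb⁻ {E} {S} h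
        ... | z , p , f = Nb⁺ {delete E x y₀} {S} p (delete-x {E} (λ { refl → true≢false p s }) f)

      -- Both violators contain x. Since y₁ ≠ y₂, each edge at x survives one of the two deletions,
      -- so the neighbours of S₁ ∪ S₂ lie in N₁ ∪ N₂; those of S₁ ∩ S₂ without x lie in N₁ ∩ N₂.
      -- Hall's condition for these two sets gives |S₁| + |S₂| ≤ |N₁| + |N₂| + 1, where the 1 pays
      -- for removing x, while the two strict violations give a gap of at least 2.
      not-both : ∀ {S₁ S₂} → S₁ ⊑ P → # (Nb (delete E x y₁) S₁) < # S₁ → S₂ ⊑ P → ¬ (# (Nb (delete E x y₂) S₂) < # S₂)
      not-both {S₁} {S₂} s₁ lt₁ s₂ lt₂ = <-irrefl refl (begin-strict
        # S₁ + # S₂ <⟨ n<1+n _ ⟩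
        suc (# S₁ + # S₂) ≡⟨ cong suc (#-∪∩ S₁ S₂) ⟩
        suc (# (S₁ ∪ᵇ S₂) + # (S₁ ∩ᵇ S₂)) ≤⟨ s≤s (+-mono-≤ (hall (S₁ ∪ᵇ S₂) ∪⊑P) ∩-bound) ⟩
        suc (# (Nb E (S₁ ∪ᵇ S₂)) + suc (# D)) ≤⟨ s≤s (+-monoʳ-≤ _ (s≤s (hall D D⊑P))) ⟩
        suc (# (Nb E (S₁ ∪ᵇ S₂)) + suc (# (Nb E D))) ≤⟨ s≤s (+-mono-≤ (#-mono N∪) (s≤s (#-mono N∩))) ⟩
        suc (# (N₁ ∪ᵇ N₂) + suc (# (N₁ ∩ᵇ N₂))) ≡⟨ cong suc (+-suc _ _) ⟩
        suc (suc (# (N₁ ∪ᵇ N₂) + # (N₁ ∩ᵇ N₂))) ≡⟨ cong (2 +_) (sym (#-∪∩ N₁ N₂)) ⟩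
        suc (suc (# N₁ + # N₂)) ≡⟨ cong suc (sym (+-suc (# N₁) (# N₂))) ⟩
        suc (# N₁) + suc (# N₂) ≤⟨ +-mono-≤ lt₁ lt₂ ⟩
        # S₁ + # S₂ ∎)
        where
        open ≤-Reasoning
        N₁ N₂ : Fin b → Bool
        N₁ = Nb (delete E x y₁) S₁
        N₂ = Nb (delete E x y₂) S₂
        D : Fin a → Bool
        D z = (S₁ ∩ᵇ S₂) z ∧ not (z == x)
        x∈₁ = contains-x s₁ lt₁
        x∈₂ = contains-x s₂ lt₂
        ∪⊑P : (S₁ ∪ᵇ S₂) ⊑ P
        ∪⊑P z h with ∨-true {S₁ z} h
        ... | inj₁ p = s₁ z p
        ... | inj₂ p = s₂ z p
        D⊑P : D ⊑ P
        D⊑P z h = s₁ z (proj₁ (∧-true (proj₁ (∧-true {(S₁ ∩ᵇ S₂) z} h))))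
        ∩-bound : # (S₁ ∩ᵇ S₂) ≤ suc (# D)
        ∩-bound = begin
          # (S₁ ∩ᵇ S₂) ≡⟨ #-∖ (S₁ ∩ᵇ S₂) (_== x) ⟩
          # ((S₁ ∩ᵇ S₂) ∩ᵇ (_== x)) + # D ≤⟨ +-monoˡ-≤ (# D) (≤-trans (#-mono (λ z h → proj₂ (∧-true {(S₁ ∩ᵇ S₂) z} h))) (≤-reflexive (#-single x))) ⟩
          suc (# D) ∎
        N∪ : Nb E (S₁ ∪ᵇ S₂) ⊑ (N₁ ∪ᵇ N₂)
        N∪ y h with Nb⁻ {E} {S₁ ∪ᵇ S₂} h
        ... | z , p , f = cases (z FinP.≟ x) (y FinP.≟ y₁)
          where
          cases : Dec (z ≡ x) → Dec (y ≡ y₁) → (N₁ ∪ᵇ N₂) y ≡ true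
          cases (yes refl) (no ne) = ∨-introˡ (Nb⁺ {delete E x y₁} {S₁} {x} {y} x∈₁ (delete-y {E} ne f))
          cases (yes refl) (yes refl) = ∨-introʳ {N₁ y} (Nb⁺ {delete E x y₂} {S₂} {x} {y} x∈₂ (delete-y {E} y₁≢y₂ f))
          cases (no ne) _ with ∨-true {S₁ z} p
          ... | inj₁ q = ∨-introˡ (Nb⁺ {delete E x y₁} {S₁} {z} {y} q (delete-x {E} ne f))
          ... | inj₂ q = ∨-introʳ {N₁ y} (Nb⁺ {delete E x y₂} {S₂} {z} {y} q (delete-x {E} ne f))
        N∩ : Nb E D ⊑ (N₁ ∩ᵇ N₂)
        N∩ y h with Nb⁻ {E} {D} h
        ... | z , p , f with ∧-true {(S₁ ∩ᵇ S₂) z} p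
        ...   | q , r with ∧-true {S₁ z} q
        ...     | q₁ , q₂ = ∧-intro (Nb⁺ {delete E x y₁} {S₁} q₁ (delete-x {E} ne f)) (Nb⁺ {delete E x y₂} {S₂} q₂ (delete-x {E} ne f))
          where ne : z ≢ x
                ne refl = true≢false (==-refl x) (not-true r)

  -- The fuel bounds the number of edges. Of the two deletions at a vertex with two neighbours, one
  -- preserves Hall's condition, and its matching is also one for E.
  hall-fuel : ∀ n E → size E ≤ n → HallCond E → Matching E
  weaken : ∀ {E x₀ y₀} → Matching (delete E x₀ y₀) → Matching E
  weaken {E} {x₀} {y₀} m = record { M = Matching.M m ; total = Matching.total m ; injective = Matching.injective m ; M⊆E = λ {x} {y} h → delete⁻ {E} {x₀} {y₀} {x} {y} (Matching.M⊆E m h) }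
  hall-fuel n E sz hall with two? E hall
  ... | no no2 = no-two⇒matching E hall no2
  ... | yes (x , y₁ , y₂ , e₁ , e₂ , ne) with n | ≤-trans (delete-size E x y₁ e₁) sz | ≤-trans (delete-size E x y₂ e₂) sz
  ...   | suc n′ | s≤s sz₁ | s≤s sz₂ with hall? (delete E x y₁)
  ...     | inj₁ h = weaken {E} {x} {y₁} (hall-fuel n′ _ sz₁ h)
  ...     | inj₂ (S₁ , s₁ , lt₁) with hall? (delete E x y₂)
  ...       | inj₁ h = weaken {E} {x} {y₂} (hall-fuel n′ _ sz₂ h)
  ...       | inj₂ (S₂ , s₂ , lt₂) = ⊥-elim (not-both E hall e₁ e₂ ne s₁ lt₁ s₂ lt₂)

  opaque
    hall-matching : ∀ E → HallCond E → Matching E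
    hall-matching E = hall-fuel (size E) E ≤-refl

-- Labelled walks and 2-opt moves

-- Each entry holds the start vertex and the label of a link. For a closed walk the first components
-- therefore list every visited position once, without repeating the endpoint.
data Walk {V L : Set} (Ok : V → L → V → Set) : V → List (V × L) → V → Set where
  [] : ∀ {u} → Walk Ok u [] u
  _∷_ : ∀ {u l w z es} → Ok u l w → Walk Ok w es z → Walk Ok u ((u , l) ∷ es) z

walk-map : ∀ {V L} {Ok Ok′ : V → L → V → Set} → (∀ {u l w} → Ok u l w → Ok′ u l w) →
  ∀ {u es z} → Walk Ok u es z → Walk Ok′ u es z
walk-map f [] = []
walk-map f (o ∷ w) = f o ∷ walk-map f w

occurs-later : ∀ {c u : A} as {bs bs′} → c ∷ bs ≡ as ++ u ∷ c ∷ bs′ → c ∈ bs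
occurs-later [] refl = here refl
occurs-later (z ∷ as) refl = ∈-++⁺ʳ as (there (here refl))

-- In a list without repetitions c has only one predecessor. This excludes that both neighbours of a
-- centre precede it along the walk.
adjacent-unique : ∀ {c : A} as as′ {u u′ bs bs′} → Unique (as ++ u ∷ c ∷ bs) →
  as ++ u ∷ c ∷ bs ≡ as′ ++ u′ ∷ c ∷ bs′ → u ≡ u′
adjacent-unique [] [] uq e = ∷-injectiveˡ e
adjacent-unique [] (a′ ∷ as′) (_ ∷ c∉ ∷ _) e = ⊥-elim (All.lookup c∉ (occurs-later as′ (∷-injectiveʳ e)) refl)
adjacent-unique (a ∷ as) [] uq e with subst Unique e uq
... | _ ∷ c∉ ∷ _ = ⊥-elim (All.lookup c∉ (occurs-later as (∷-injectiveʳ (sym e))) refl)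
adjacent-unique (a ∷ as) (a′ ∷ as′) (_ ∷ uq) e = adjacent-unique as as′ uq (∷-injectiveʳ e)

module Walks {V L : Set} (Ok : V → L → V → Set) where

  vs : List (V × L) → List V
  vs = map proj₁

  ls : List (V × L) → List L
  ls = map proj₂

  walk-++ : ∀ {u es w fs z} → Walk Ok u es w → Walk Ok w fs z → Walk Ok u (es ++ fs) z
  walk-++ [] w′ = w′
  walk-++ (o ∷ w) w′ = o ∷ walk-++ w w′

  walk-split : ∀ as {u x l bs z} → Walk Ok u (as ++ (x , l) ∷ bs) z →
    Walk Ok u as x × ∃ λ y → Ok x l y × Walk Ok y bs z
  walk-split [] (o ∷ w) = [] , _ , o , w
  walk-split (a ∷ as) (o ∷ w) with walk-split as w
  ... | w₁ , y , o′ , w₂ = o ∷ w₁ , y , o′ , w₂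

  vertices-from : ∀ {u es z} → Walk Ok u es z → ∃ λ rest → vs es ++ z ∷ [] ≡ u ∷ rest
  vertices-from [] = [] , refl
  vertices-from {es = (u , l) ∷ es} {z} (o ∷ w) = vs es ++ z ∷ [] , refl

  -- A closed walk cut open at one link p q labelled l; what remains is the path P from q back to p,
  -- whose listed vertices omit its end p.
  record Opened (es : List (V × L)) (l : L) : Set where
    constructor opened
    field
      p q : V
      P : List (V × L)
      link : Ok p l q
      walk : Walk Ok q P p
      labels : ls es ↭ l ∷ ls P
      vertices : vs es ↭ p ∷ vs P

  open-at : ∀ {o es l} → Walk Ok o es o → l ∈ ls es → Opened es l
  open-at {o} {es} {l} w m with ∈-map⁻ proj₂ m
  ... | (p , .l) , m′ , refl with ∈-∃++ m′
  ...   | as , bs , refl with walk-split as w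
  ...     | w₁ , q , lk , w₂ = opened p q (bs ++ as) lk (walk-++ w₂ w₁)
    (map⁺ proj₂ (↭-trans (shift (p , l) as bs) (prep (p , l) (++-comm as bs))))
    (map⁺ proj₁ (↭-trans (shift (p , l) as bs) (prep (p , l) (++-comm as bs))))

  record Cut (q : V) (P : List (V × L)) (p c : V) (l : L) (y : V) : Set where
    constructor cut
    field
      {P₁ P₂} : List (V × L)
      split : P ≡ P₁ ++ (c , l) ∷ P₂
      walk₁ : Walk Ok q P₁ c
      link : Ok c l y
      walk₂ : Walk Ok y P₂ p

  module _ (Ok-sym : ∀ {u : V} {l : L} {w : V} → Ok u l w → Ok w l u) where

    walk-reverse : ∀ {u es w} → Walk Ok u es w →
      ∃ λ es′ → Walk Ok w es′ u × ls es′ ↭ ls es × u ∷ vs es′ ↭ w ∷ vs es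
    walk-reverse {u} [] = [] , [] , ↭-refl , ↭-refl
    walk-reverse {u} {(u , l) ∷ es} {w} (_∷_ {w = x} o wk) with walk-reverse wk
    ... | es′ , wk′ , ll , vv = es′ ++ (x , l) ∷ [] , walk-++ wk′ (Ok-sym o ∷ [])
      , ↭-trans (map⁺ proj₂ (++-comm es′ ((x , l) ∷ []))) (prep l ll)
      , ↭-trans (prep u (map⁺ proj₁ (++-comm es′ ((x , l) ∷ [])))) (↭-trans (prep u vv) (swap u w ↭-refl))

    -- A missing link p q may be traversed from q to p; reversing the rest of the cycle restores the
    -- orientation that a move expects.
    flip : ∀ {es l} → Opened es l → Opened es l
    flip (opened p q P lk w ll vv) with walk-reverse w
    ... | P′ , w′ , ll′ , vv′ = opened q p P′ (Ok-sym lk) w′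
      (↭-trans ll (prep _ (↭-sym ll′))) (↭-trans vv (↭-sym vv′))

    -- The two links of c cannot both enter c along the walk, so one of them leaves it.
    find-cut : ∀ {q P p a c b la lb} → Walk Ok q P p → Unique (p ∷ vs P) → a ≢ b →
      la ∈ ls P → lb ∈ ls P →
      (∀ {u w} → Ok u la w → (u ≡ c × w ≡ a) ⊎ (u ≡ a × w ≡ c)) →
      (∀ {u w} → Ok u lb w → (u ≡ c × w ≡ b) ⊎ (u ≡ b × w ≡ c)) →
      Cut q P p c la a ⊎ Cut q P p c lb b
    find-cut {q} {P} {p} {a} {c} {b} wk uq a≢b ma mb ea eb
      with ∈-map⁻ proj₂ ma | ∈-map⁻ proj₂ mb
    ... | (u , la) , ma′ , refl | (u′ , lb) , mb′ , refl with ∈-∃++ ma′ | ∈-∃++ mb′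
    ...   | A₁ , A₂ , refl | B₁ , B₂ , eB with walk-split A₁ wk | walk-split B₁ (subst (λ z → Walk Ok q z p) eB wk)
    ...     | w₁ , y , lk , w₂ | w₁′ , y′ , lk′ , w₂′ with ea lk | eb lk′
    ...       | inj₁ (refl , refl) | _ = inj₁ (cut refl w₁ lk w₂)
    ...       | inj₂ (refl , refl) | inj₁ (refl , refl) = inj₂ (cut eB w₁′ lk′ w₂′)
    ...       | inj₂ (refl , refl) | inj₂ (refl , refl)
                with vertices-from w₂ | vertices-from w₂′
    ...         | r , er | r′ , er′ = ⊥-elim (a≢b (adjacent-unique (vs A₁) (vs B₁)
                  (subst Unique eq₁ (Unique-resp-↭ (++-comm (p ∷ []) (vs P)) uq)) (trans (sym eq₁) eq₂)))
      where
      expand : ∀ As {x l Bs r} → vs Bs ++ p ∷ [] ≡ c ∷ r → vs (As ++ (x , l) ∷ Bs) ++ p ∷ [] ≡ vs As ++ x ∷ c ∷ r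
      expand [] e = cong (_ ∷_) e
      expand (x ∷ As) e = cong (proj₁ x ∷_) (expand As e)
      eq₁ : vs P ++ p ∷ [] ≡ vs A₁ ++ a ∷ c ∷ r
      eq₁ = expand A₁ er
      eq₂ : vs P ++ p ∷ [] ≡ vs B₁ ++ b ∷ c ∷ r′
      eq₂ = trans (cong (λ z → vs z ++ p ∷ []) eB) (expand B₁ er′)

    -- The path starts at q and meets y only after c, so equality would repeat a vertex. A move adds
    -- a hyperedge through y and q, which must therefore differ.
    cut-distinct : ∀ {q P p c l y} → Unique (p ∷ vs P) → Cut q P p c l y → y ≢ q
    cut-distinct {q} {P} {p} {c} {l} {y} uq (cut {P₁} {P₂} refl w₁ lk w₂) refl =
      Unique-disj (vs P₁ ++ c ∷ []) (subst Unique eq (Unique-resp-↭ (++-comm (p ∷ []) (vs P)) uq)) y∈₁ y∈₂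
      where
      eq : vs P ++ p ∷ [] ≡ (vs P₁ ++ c ∷ []) ++ vs P₂ ++ p ∷ []
      eq = trans (cong (_++ p ∷ []) (map-++ proj₁ P₁ ((c , l) ∷ P₂)))
        (trans (++-assoc (vs P₁) (c ∷ vs P₂) (p ∷ []))
               (sym (++-assoc (vs P₁) (c ∷ []) (vs P₂ ++ p ∷ []))))
      y∈₁ : y ∈ vs P₁ ++ c ∷ []
      y∈₁ with vertices-from w₁
      ... | r , e = subst (y ∈_) (sym e) (here refl)
      y∈₂ : y ∈ vs P₂ ++ p ∷ []
      y∈₂ with vertices-from w₂
      ... | r , e = subst (y ∈_) (sym e) (here refl)

    -- The new cycle goes from q to c along P₁, jumps to p, runs back through P₂ to y and closes at
    -- q. No vertex is gained or lost; relative to the open path, l gives way to l′ and l″.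
    two-opt : ∀ {q P p c l y l′ l″} → Cut q P p c l y → Ok c l′ p → Ok y l″ q →
      ∃ λ es → Walk Ok q es q × vs es ↭ p ∷ vs P × (∀ {rest} → ls P ↭ l ∷ rest → ls es ↭ l′ ∷ l″ ∷ rest)
    two-opt {q} {P} {p} {c} {l} {y} {l′} {l″} (cut {P₁} {P₂} refl w₁ lk w₂) lk′ lk″ with walk-reverse w₂
    ... | P₂′ , w₂′ , ll , vv = es , walk-++ w₁ (lk′ ∷ walk-++ w₂′ (lk″ ∷ [])) , vv′ , ll′
      where
      es : List (V × L)
      es = P₁ ++ (c , l′) ∷ P₂′ ++ (y , l″) ∷ []
      open PermutationReasoning
      vv′ : vs es ↭ p ∷ vs (P₁ ++ (c , l) ∷ P₂)
      vv′ = begin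
        vs (P₁ ++ (c , l′) ∷ P₂′ ++ (y , l″) ∷ []) ↭⟨ map⁺ proj₁ (++⁺ˡ P₁ (prep (c , l′) (++-comm P₂′ ((y , l″) ∷ [])))) ⟩
        vs (P₁ ++ (c , l′) ∷ (y , l″) ∷ P₂′) ≡⟨ map-++ proj₁ P₁ _ ⟩
        vs P₁ ++ c ∷ y ∷ vs P₂′ ↭⟨ ++⁺ˡ (vs P₁) (prep c vv) ⟩
        vs P₁ ++ c ∷ p ∷ vs P₂ ↭⟨ ++⁺ˡ (vs P₁) (swap c p ↭-refl) ⟩
        vs P₁ ++ p ∷ c ∷ vs P₂ ↭⟨ shift p (vs P₁) (c ∷ vs P₂) ⟩
        p ∷ vs P₁ ++ c ∷ vs P₂ ≡⟨ cong (p ∷_) (sym (map-++ proj₁ P₁ _)) ⟩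
        p ∷ vs (P₁ ++ (c , l) ∷ P₂) ∎
      ll′ : ∀ {rest} → ls (P₁ ++ (c , l) ∷ P₂) ↭ l ∷ rest → ls es ↭ l′ ∷ l″ ∷ rest
      ll′ {rest} h = begin
        ls (P₁ ++ (c , l′) ∷ P₂′ ++ (y , l″) ∷ []) ↭⟨ map⁺ proj₂ (++⁺ˡ P₁ (prep (c , l′) (++-comm P₂′ ((y , l″) ∷ [])))) ⟩
        ls (P₁ ++ (c , l′) ∷ (y , l″) ∷ P₂′) ↭⟨ map⁺ proj₂ (shift (c , l′) P₁ _) ⟩
        l′ ∷ ls (P₁ ++ (y , l″) ∷ P₂′) ↭⟨ prep l′ (map⁺ proj₂ (shift (y , l″) P₁ _)) ⟩
        l′ ∷ l″ ∷ ls (P₁ ++ P₂′) ≡⟨ cong (λ z → l′ ∷ l″ ∷ z) (map-++ proj₂ P₁ P₂′) ⟩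
        l′ ∷ l″ ∷ ls P₁ ++ ls P₂′ ↭⟨ prep l′ (prep l″ (++⁺ˡ (ls P₁) ll)) ⟩
        l′ ∷ l″ ∷ ls P₁ ++ ls P₂ ↭⟨ prep l′ (prep l″ (drop-∷ (↭-trans rearr h))) ⟩
        l′ ∷ l″ ∷ rest ∎
        where
        rearr : l ∷ ls P₁ ++ ls P₂ ↭ ls (P₁ ++ (c , l) ∷ P₂)
        rearr = ↭-trans (↭-sym (shift l (ls P₁) (ls P₂))) (↭-reflexive (sym (map-++ proj₂ P₁ ((c , l) ∷ P₂))))

-- The game on junctions and tokens

-- x_0 , … , x_ℓ′ are junctions, with slots x_j x_(j+1) for j < ℓ′; e of the ρ tokens will become junctions
-- as well, so that the cycle has suc ℓ′ + e links, each owning a block of s ∸ 3 further vertices.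
record Dims : Set where
  field
    ℓ′ ρ e : ℕ

  X J Block : Set
  X = Fin (suc ℓ′)
  J = X ⊎ Fin ρ
  Block = Fin ℓ′ ⊎ Fin (suc e)

record Board : Set₁ where
  field
    dims : Dims
  open Dims dims public
  field
    Edge : Set
    edge : J → Fin ρ → J → Block → Edge
    edge-sym : ∀ u t w β → edge u t w β ≡ edge w t u β
    -- The number of outcomes of a round that are not in X × R.
    r : ℕ

  N : ℕ
  N = suc ℓ′ * ρ + r

  Linked : List Edge → J → Fin ρ × Block → J → Set
  Linked E u (t , β) w = edge u t w β ∈ E

record HamCycle (B : Board) (E : List (Board.Edge B)) : Set where
  open Board B
  field
    {o} : J
    {es} : List (J × Fin ρ × Block)
    walk : Walk (Linked E) o es o
    size : length es ≡ suc ℓ′ + e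
    junctions-unique : Unique (map proj₁ es)
    tokens-unique : Unique (map (proj₁ ∘ proj₂) es)
    blocks-unique : Unique (map (proj₂ ∘ proj₂) es)
    disjoint : ∀ {t} → t ∈ map (proj₁ ∘ proj₂) es → inj₂ t ∉ map proj₁ es

-- The two inequalities keep the completing vertices apart from the offered ones, so that the
-- hyperedge has the full number of distinct vertices.
Reply : (B : Board) → (ℕ → List (Board.Edge B) → ℕ → Set) →
  ℕ → List (Board.Edge B) → Board.X B → Fin (Board.ρ B) → ℕ → Set
Reply B W T E x t F =
  Σ[ w ∈ J ] Σ[ β ∈ Block ] (w ≢ inj₁ x × w ≢ inj₂ t × W T (edge (inj₁ x) t w β ∷ E) F)
  where open Board B

-- An interface shared by both values of r. One `superstep` averages over all outcomes of a round,
-- in the form of a sum of failure counts; the outcomes outside X × R all lead to the same count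
-- `f₀`.
record Game : Set₁ where
  field
    board : Board
  open Board board public
  field
    -- W T E F: with T rounds left and edge set E, at most F continuations fail.
    W : ℕ → List Edge → ℕ → Set
    W-mono : ∀ {T E F F′} → F ≤ F′ → W T E F → W T E F′
    W-lose : ∀ {T E} → W T E (N ^ T)
    W-ham : ∀ {T E} → HamCycle board E → W T E 0
    superstep : ∀ {T E f₀} (f : X → Fin ρ → ℕ) →
      (∀ x t → Reply board W T E x t (f x t) ⊎ W T E (f x t)) → W T E f₀ →
      W (suc T) E (∑ (allFin (suc ℓ′)) (λ x → ∑ (allFin ρ) (f x)) + r * f₀)

module GameLemmas (Gm : Game) where
  open Game Gm

  -- When the useful offers form a product of junctions and tokens, only its size a enters the
  -- failure count. The result has the shape of the recursion of `G`.
  rectangle-step : ∀ {T E F⁻ F⁺} {xs : List X} {ts : List (Fin ρ)} → Unique xs → Unique ts →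
    (∀ {x t} → x ∈ xs → t ∈ ts → Reply board W T E x t F⁻) → W T E F⁺ →
    ∀ a c → length xs * length ts ≡ a → a + c ≡ N → W (suc T) E (a * F⁻ + c * F⁺)
  rectangle-step {T} {E} {F⁻} {F⁺} {xs} {ts} uxs uts reply stay a c refl a+c≡N =
    W-mono (≤-reflexive (+-cancelʳ-≡ (a * F⁺) _ _ total)) (superstep f respond stay)
    where
    open import Data.List.Membership.DecPropositional (FinP._≟_ {suc ℓ′}) using () renaming (_∈?_ to _∈X?_)
    open import Data.List.Membership.DecPropositional (FinP._≟_ {ρ}) using () renaming (_∈?_ to _∈R?_)
    f : X → Fin ρ → ℕ
    f x t with x ∈X? xs | t ∈R? ts
    ... | yes _ | yes _ = F⁻
    ... | yes _ | no _ = F⁺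
    ... | no _ | _ = F⁺
    respond : ∀ x t → Reply board W T E x t (f x t) ⊎ W T E (f x t)
    respond x t with x ∈X? xs | t ∈R? ts
    ... | yes p | yes q = inj₁ (reply p q)
    ... | yes _ | no _ = inj₂ stay
    ... | no _ | _ = inj₂ stay
    in-f : ∀ x t → x ∈ xs → t ∈ ts → f x t ≡ F⁻
    in-f x t p q with x ∈X? xs | t ∈R? ts
    ... | yes _ | yes _ = refl
    ... | yes _ | no n = ⊥-elim (n q)
    ... | no n | _ = ⊥-elim (n p)
    pX = unique-⊆⇒↭ {ys = allFin (suc ℓ′)} uxs (λ _ → ∈-allFin _)
    pR = unique-⊆⇒↭ {ys = allFin ρ} uts (λ _ → ∈-allFin _)
    xs′ = proj₁ pX
    ts′ = proj₁ pR
    uX : Unique (xs ++ xs′)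
    uX = Unique-resp-↭ (proj₂ pX) (UP.allFin⁺ (suc ℓ′))
    uR : Unique (ts ++ ts′)
    uR = Unique-resp-↭ (proj₂ pR) (UP.allFin⁺ ρ)
    out-f : ∀ x t → x ∈ xs′ ⊎ t ∈ ts′ → f x t ≡ F⁺
    out-f x t h with x ∈X? xs | t ∈R? ts
    out-f x t (inj₁ m) | yes p | yes q = ⊥-elim (Unique-disj xs uX p m)
    out-f x t (inj₂ m) | yes p | yes q = ⊥-elim (Unique-disj ts uR q m)
    ... | yes _ | no _ = refl
    ... | no _ | _ = refl
    open ≡-Reasoning
    total : ∑ (allFin (suc ℓ′)) (λ x → ∑ (allFin ρ) (f x)) + r * F⁺ + a * F⁺ ≡ a * F⁻ + c * F⁺ + a * F⁺
    total = begin
      ∑ (allFin (suc ℓ′)) (λ x → ∑ (allFin ρ) (f x)) + r * F⁺ + a * F⁺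
        ≡⟨ cong (λ z → z + r * F⁺ + a * F⁺) (trans (∑-↭ _ (proj₂ pX)) (∑-cong (xs ++ xs′) (λ x → ∑-↭ (f x) (proj₂ pR)))) ⟩
      ∑ (xs ++ xs′) (λ x → ∑ (ts ++ ts′) (f x)) + r * F⁺ + a * F⁺
        ≡⟨ lem₁ _ (r * F⁺) (a * F⁺) ⟩
      ∑ (xs ++ xs′) (λ x → ∑ (ts ++ ts′) (f x)) + a * F⁺ + r * F⁺
        ≡⟨ cong (_+ r * F⁺) (∑-rectangle {xs = xs} {xs′} {ts} {ts′} f F⁻ F⁺ in-f out-f) ⟩
      a * F⁻ + length (xs ++ xs′) * length (ts ++ ts′) * F⁺ + r * F⁺
        ≡⟨ cong₂ (λ y z → a * F⁻ + y * z * F⁺ + r * F⁺)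
             (trans (sym (↭-length (proj₂ pX))) (length-allFin (suc ℓ′))) (trans (sym (↭-length (proj₂ pR))) (length-allFin ρ)) ⟩
      a * F⁻ + suc ℓ′ * ρ * F⁺ + r * F⁺
        ≡⟨ trans (+-assoc (a * F⁻) _ _) (cong (a * F⁻ +_) (sym (*-distribʳ-+ F⁺ (suc ℓ′ * ρ) r))) ⟩
      a * F⁻ + N * F⁺
        ≡⟨ cong (λ z → a * F⁻ + z * F⁺) (sym a+c≡N) ⟩
      a * F⁻ + (a + c) * F⁺
        ≡⟨ lem₂ (a * F⁻) a c F⁺ ⟩
      a * F⁻ + c * F⁺ + a * F⁺ ∎
      where
      lem₁ : ∀ s x y → s + x + y ≡ s + y + x
      lem₁ = solve-∀
      lem₂ : ∀ z a c F → z + (a + c) * F ≡ z + c * F + a * F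
      lem₂ = solve-∀

  idle : ∀ T {T₂ E F} → W T₂ E F → W (T + T₂) E (N ^ T * F)
  idle zero w = W-mono (≤-reflexive (sym (+-identityʳ _))) w
  idle (suc T) {F = F} w = W-mono (≤-reflexive (sym (*-assoc N (N ^ T) F)))
    (rectangle-step {F⁻ = 0} {xs = []} {ts = []} [] [] (λ ()) (idle T w) 0 N refl refl)

  record Advance (a₁ a₂ : ℕ) (Q : List Edge → Set) (E : List Edge) : Set where
    field
      {xs} : List X
      {ts} : List (Fin ρ)
      xs-unique : Unique xs
      ts-unique : Unique ts
      xs-many : a₁ ≤ length xs
      ts-many : a₂ ≤ length ts
      reply : ∀ {x t} → x ∈ xs → t ∈ ts →
        Σ[ w ∈ J ] Σ[ β ∈ Block ] (w ≢ inj₁ x × w ≢ inj₂ t × Q (edge (inj₁ x) t w β ∷ E))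

  -- Every state has at least a₁ a₂ useful offers; exactly that many are used, so the number of
  -- advances is binomial however the states evolve. The first term of the bound counts failures
  -- after the loop, the second the sequences in which T rounds do not bring μ advances.
  loop : ∀ (St : ℕ → List Edge → Set) {T₂ f₂} a₁ a₂ c → a₁ * a₂ + c ≡ N →
    (∀ μ E → St (suc μ) E → Advance a₁ a₂ (St μ) E) → (∀ E → St 0 E → W T₂ E f₂) →
    ∀ T μ E → St μ E → W (T + T₂) E (N ^ T * f₂ + N ^ T₂ * G (a₁ * a₂) c T μ)
  loop St {T₂} {f₂} a₁ a₂ c a+c≡N adv cont T zero E st =
    W-mono (m≤m+n (N ^ T * f₂) _) (idle T (cont E st))
  loop St {T₂} {f₂} a₁ a₂ c a+c≡N adv cont zero (suc μ) E st =
    W-mono (≤-trans (≤-reflexive (sym (*-identityʳ (N ^ T₂)))) (m≤n+m _ (1 * f₂))) W-lose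
  loop St {T₂} {f₂} a₁ a₂ c a+c≡N adv cont (suc T) (suc μ) E st =
    W-mono (≤-reflexive arith)
      (rectangle-step {xs = take a₁ xs} {ts = take a₂ ts} (UP.take⁺ a₁ xs-unique) (UP.take⁺ a₂ ts-unique) rep
        (loop St a₁ a₂ c a+c≡N adv cont T (suc μ) E st)
        (a₁ * a₂) c (cong₂ _*_ (length-take-≤ a₁ xs xs-many) (length-take-≤ a₂ ts ts-many)) a+c≡N)
    where
    open Advance (adv μ E st)
    rep : ∀ {x t} → x ∈ take a₁ xs → t ∈ take a₂ ts → Reply board W (T + T₂) E x t (N ^ T * f₂ + N ^ T₂ * G (a₁ * a₂) c T μ)
    rep mx mt with reply (∈-take a₁ xs mx) (∈-take a₂ ts mt)
    ... | w , β , ne , ne′ , q = w , β , ne , ne′ , loop St a₁ a₂ c a+c≡N adv cont T μ _ q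
    a = a₁ * a₂
    g = G a c T μ
    g′ = G a c T (suc μ)
    open ≡-Reasoning
    arith : a * (N ^ T * f₂ + N ^ T₂ * g) + c * (N ^ T * f₂ + N ^ T₂ * g′) ≡ N * N ^ T * f₂ + N ^ T₂ * (a * g + c * g′)
    arith = begin
      a * (N ^ T * f₂ + N ^ T₂ * g) + c * (N ^ T * f₂ + N ^ T₂ * g′)
        ≡⟨ lem a c (N ^ T) f₂ (N ^ T₂) g g′ ⟩
      (a + c) * N ^ T * f₂ + N ^ T₂ * (a * g + c * g′)
        ≡⟨ cong (λ z → z * N ^ T * f₂ + N ^ T₂ * (a * g + c * g′)) a+c≡N ⟩
      N * N ^ T * f₂ + N ^ T₂ * (a * g + c * g′) ∎
      where
      lem : ∀ a c n f m g g′ → a * (n * f + m * g) + c * (n * f + m * g′) ≡ (a + c) * n * f + m * (a * g + c * g′)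
      lem = solve-∀

-- A unit is a pair of consecutive slots sa i = (a , c) and sb i = (c , b) that may be sacrificed for a 2-opt move.
record Plan (B : Board) : Set₁ where
  open Board B
  field
    u b₀ : ℕ
    sa sb : Fin u → Fin ℓ′
    joined : ∀ i → Fin.suc (sa i) ≡ inject₁ (sb i)
    -- Meant to say that x is one of the three junctions a, c, b of unit i. Functionality makes
    -- different units disjoint, so an offered junction determines the unit it serves.
    near : X → Fin u → Set
    near-functional : ∀ {x i i′} → near x i → near x i′ → i ≡ i′
    near-a : ∀ i → near (inject₁ (sa i)) i
    near-c : ∀ i → near (suc (sa i)) i
    near-b : ∀ i → near (suc (sb i)) i
    a≢b : ∀ i → inject₁ (sa i) ≢ suc (sb i)
    E₀ : List Edge
    ss₀ : List (Fin ℓ′)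
    vs₀ : List J
    vs₀-unique : Unique vs₀
    blocks₀ : List Block
    units : List (Fin u)
    units-unique : Unique units
    units-a : ∀ {i} → i ∈ units → sa i ∈ ss₀
    units-b : ∀ {i} → i ∈ units → sb i ∈ ss₀
    pool : List (Fin ρ)
    pool-unique : Unique pool
    pool-disjoint : ∀ {t} → t ∈ pool → inj₂ t ∉ vs₀

  centre : Fin u → X
  centre i = suc (sa i)

  cutSlot : Fin u × Bool → Fin ℓ′
  cutSlot (i , true) = sa i
  cutSlot (i , false) = sb i

  near-cut : ∀ i b → near (inject₁ (cutSlot (i , b))) i
  near-cut i true = near-a i
  near-cut i false = subst (λ x → near x i) (joined i) (near-c i)

  cutSlot-unit : ∀ {i i′} b b′ → cutSlot (i , b) ≡ cutSlot (i′ , b′) → i ≡ i′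
  cutSlot-unit {i} {i′} b b′ e = near-functional (near-cut i b) (subst (λ x → near (inject₁ x) i′) (sym e) (near-cut i′ b′))

  Bad : Set
  Bad = J × J × Block

  data Label : Set where
    slot : Fin ℓ′ → Label
    done : Fin ρ × Block → Label
    bad : Bad → Label

  block : Label → Block
  block (slot j) = inj₁ j
  block (done (t , β)) = β
  block (bad (p , q , β)) = β

  Ok : List Edge → J → Label → J → Set
  Ok E v (slot j) w = (v ≡ inj₁ (inject₁ j) × w ≡ inj₁ (suc j)) ⊎ (v ≡ inj₁ (suc j) × w ≡ inj₁ (inject₁ j))
  Ok E v (done (t , β)) w = edge v t w β ∈ E
  Ok E v (bad (p , q , β)) w = (v ≡ p × w ≡ q) ⊎ (v ≡ q × w ≡ p)

  Ok-sym : ∀ {E v l w} → Ok E v l w → Ok E w l v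
  Ok-sym {l = slot j} (inj₁ (a , b)) = inj₂ (b , a)
  Ok-sym {l = slot j} (inj₂ (a , b)) = inj₁ (b , a)
  Ok-sym {E} {v} {done (t , β)} {w} m = subst (_∈ E) (edge-sym v t w β) m
  Ok-sym {l = bad _} (inj₁ (a , b)) = inj₂ (b , a)
  Ok-sym {l = bad _} (inj₂ (a , b)) = inj₁ (b , a)

  Ok-weaken : ∀ {E ε v l w} → Ok E v l w → Ok (ε ∷ E) v l w
  Ok-weaken {l = slot j} h = h
  Ok-weaken {l = done _} h = there h
  Ok-weaken {l = bad _} h = h

  labelList : List (Fin ℓ′) → List (Fin ρ × Block) → List Bad → List Label
  labelList ss ds bs = map slot ss ++ map done ds ++ map bad bs

  -- A Hamilton cycle of junctions: the slots ss still lack a token, the links ds are hyperedges, the links bs are missing.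
  record Cycle (bs : List Bad) (E : List Edge) : Set where
    field
      {o} : J
      {es} : List (J × Label)
      walk : Walk (Ok E) o es o
      ss : List (Fin ℓ′)
      ds : List (Fin ρ × Block)
      cs : List (Fin u × Bool)
      labels : map proj₂ es ↭ labelList ss ds bs
      vertices : map proj₁ es ↭ vs₀
      blocks : map (block ∘ proj₂) es ↭ blocks₀
      slots : ss ++ map cutSlot cs ↭ ss₀
      ds-unique : Unique (map proj₁ ds)
      ds-pool : ∀ {t} → t ∈ map proj₁ ds → t ∈ pool
      -- A move cuts one unit slot, removes one missing link and creates two hyperedges. Hence the
      -- factor 2 here, and hence the sum in `budget` does not grow.
      ds-count : length ds ≡ 2 * length cs
      budget : length cs + length bs ≤ b₀
      base : ∀ {ε} → ε ∈ E₀ → ε ∈ E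

  weaken : ∀ {bs E ε} → Cycle bs E → Cycle bs (ε ∷ E)
  weaken Γ = record { Cycle Γ hiding (walk; base) ; base = λ m → there (Cycle.base Γ m) ; walk = walk-map (λ {_} {l} → Ok-weaken {l = l}) (Cycle.walk Γ) }

module Repair (Gm : Game) (P : Plan (Game.board Gm)) where
  open Game Gm
  open GameLemmas Gm
  open Plan P
  open Cycle

  bad∈ : ∀ {bs E} (Γ : Cycle bs E) {g} → g ∈ bs → bad g ∈ map proj₂ (es Γ)
  bad∈ Γ m = ∈-resp-↭ (↭-sym (labels Γ)) (∈-++⁺ʳ (map slot (ss Γ)) (∈-++⁺ʳ (map done (ds Γ)) (∈-map⁺ bad m)))

  slot∈ : ∀ {bs E} (Γ : Cycle bs E) {j} → j ∈ ss Γ → slot j ∈ map proj₂ (es Γ)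
  slot∈ Γ m = ∈-resp-↭ (↭-sym (labels Γ)) (∈-++⁺ˡ (∈-map⁺ slot m))

  module _ {E : List Edge} where
    open Walks (Ok E)

    opened-at : ∀ {bs} (Γ : Cycle bs E) {p q β} → (p , q , β) ∈ bs →
      Σ[ O ∈ Opened (es Γ) (bad (p , q , β)) ] Opened.p O ≡ p × Opened.q O ≡ q
    opened-at Γ {p} {q} {β} m with open-at (walk Γ) (bad∈ Γ m)
    ... | O@(opened _ _ _ (inj₁ (refl , refl)) _ _ _) = O , refl , refl
    ... | O@(opened _ _ _ (inj₂ (refl , refl)) _ _ _) = flip (λ {_} {l} → Ok-sym {E} {l = l}) O , refl , refl

    vertex-of-bad : ∀ {bs} (Γ : Cycle bs E) {p q β} → (p , q , β) ∈ bs → p ∈ vs₀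
    vertex-of-bad Γ m with opened-at Γ m
    ... | O , refl , _ = ∈-resp-↭ (↭-trans (↭-sym (Opened.vertices O)) (vertices Γ)) (here refl)

    vertex-of-bad′ : ∀ {bs} (Γ : Cycle bs E) {p q β} → (p , q , β) ∈ bs → q ∈ vs₀
    vertex-of-bad′ Γ {q = q} m with opened-at Γ m
    ... | O , refl , refl with vertices-from (Opened.walk O)
    ...   | r , e = ∈-resp-↭ (↭-trans (++-comm (vs (Opened.P O)) (Opened.p O ∷ [])) (↭-trans (↭-sym (Opened.vertices O)) (vertices Γ)))
                      (subst (q ∈_) (sym e) (here refl))

    -- With centre i hyperlinked to p by v, the link p q can be replaced as soon as the neighbour y of the centre is
    -- offered; which neighbour that is depends on the current orientation of the cycle.
    record Commit {bs : List Bad} (Γ : Cycle bs E) (bs′ : List Bad) (q : J) (v : Fin ρ) (i : Fin u) (y : X) : Set where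
      field
        y-near : near y i
        q≢y : q ≢ inj₁ y
        side : Bool
        result : ∀ v′ → v′ ∈ pool → v′ ∉ map proj₁ (ds Γ) → v ≢ v′ →
          Σ[ Γ′ ∈ Cycle bs′ (edge (inj₁ y) v′ q (inj₁ (cutSlot (i , side))) ∷ E) ]
            (map proj₁ (ds Γ′) ≡ v ∷ v′ ∷ map proj₁ (ds Γ)) ×
            (∀ {j} → j ∈ ss Γ → j ≢ cutSlot (i , side) → j ∈ ss Γ′)

    -- With the cycle opened at p q, both slots of unit i lie on the remaining path, so the centre
    -- is followed by one of its two neighbours there. That neighbour is the y to wait for, and the
    -- slot leading to it is the one to be cut.
    commit : ∀ {bs bs′} (Γ : Cycle bs E) {p q β i v} → bs ↭ (p , q , β) ∷ bs′ →
      sa i ∈ ss Γ → sb i ∈ ss Γ → edge (inj₁ (centre i)) v p β ∈ E → v ∈ pool → v ∉ map proj₁ (ds Γ) →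
      ∃ λ y → Commit Γ bs′ q v i y
    commit {bs} {bs′} Γ {p} {q} {β} {i} {v} bs↭ ma mb stored v∈ v∉
      with opened-at Γ {p} {q} {β} (∈-resp-↭ (↭-sym bs↭) (here refl))
    ... | opened _ _ Q lk wk ll vv , refl , refl = choose (find-cut (λ {_} {l} → Ok-sym {E} {l = l}) wk uq a≢b′ (inQ ma) (inQ mb) ends-a ends-b)
      where
      uq : Unique (p ∷ vs Q)
      uq = Unique-resp-↭ vv (Unique-resp-↭ (↭-sym (vertices Γ)) vs₀-unique)
      inQ : ∀ {j} → j ∈ ss Γ → slot j ∈ ls Q
      inQ m with ∈-resp-↭ ll (slot∈ Γ m)
      ... | there k = k
      a≢b′ : inj₁ {B = Fin ρ} (inject₁ (sa i)) ≢ inj₁ (suc (sb i))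
      a≢b′ e = a≢b i (inj₁-injective e)
      ends-a : ∀ {w z} → Ok E w (slot (sa i)) z →
        (w ≡ inj₁ (centre i) × z ≡ inj₁ (inject₁ (sa i))) ⊎ (w ≡ inj₁ (inject₁ (sa i)) × z ≡ inj₁ (centre i))
      ends-a (inj₁ h) = inj₂ h
      ends-a (inj₂ h) = inj₁ h
      ends-b : ∀ {w z} → Ok E w (slot (sb i)) z →
        (w ≡ inj₁ (centre i) × z ≡ inj₁ (suc (sb i))) ⊎ (w ≡ inj₁ (suc (sb i)) × z ≡ inj₁ (centre i))
      ends-b (inj₁ (h , h′)) = inj₁ (trans h (cong inj₁ (sym (joined i))) , h′)
      ends-b (inj₂ (h , h′)) = inj₂ (h , trans h′ (cong inj₁ (sym (joined i))))
      finish : ∀ b y → cutSlot (i , b) ∈ ss Γ → near y i → Cut q Q p (inj₁ (centre i)) (slot (cutSlot (i , b))) (inj₁ y) →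
        Commit Γ bs′ q v i y
      finish b y mj ny K = record
        { y-near = ny
        ; q≢y = λ e → cut-distinct (λ {_} {l} → Ok-sym {E} {l = l}) uq K (sym e)
        ; side = b
        ; result = res }
        where
        j : Fin ℓ′
        j = cutSlot (i , b)
        res : ∀ v′ → v′ ∈ pool → v′ ∉ map proj₁ (ds Γ) → v ≢ v′ →
          Σ[ Γ′ ∈ Cycle bs′ (edge (inj₁ y) v′ q (inj₁ j) ∷ E) ]
            (map proj₁ (ds Γ′) ≡ v ∷ v′ ∷ map proj₁ (ds Γ)) × (∀ {k} → k ∈ ss Γ → k ≢ j → k ∈ ss Γ′)
        res v′ v′∈ v′∉ v≢v′ with ∈-∃++ mj
        ... | s₁ , s₂ , es≡ = Γ′ , refl , keep
          where
          ss′ : List (Fin ℓ′)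
          ss′ = s₁ ++ s₂
          ss↭ : ss Γ ↭ j ∷ ss′
          ss↭ = ↭-trans (↭-reflexive es≡) (shift j s₁ s₂)
          E′ : List Edge
          E′ = edge (inj₁ y) v′ q (inj₁ j) ∷ E
          weakenCut : Cut q Q p (inj₁ (centre i)) (slot j) (inj₁ y) → Walks.Cut (Ok E′) q Q p (inj₁ (centre i)) (slot j) (inj₁ y)
          weakenCut (cut e w₁ lk′ w₂) = Walks.cut e (walk-map (λ {_} {l} → Ok-weaken {l = l}) w₁) lk′ (walk-map (λ {_} {l} → Ok-weaken {l = l}) w₂)
          -- The hyperedge at p takes over the block of the missing link and the hyperedge at q that
          -- of the cut slot, so no block is lost or used twice.
          moved = Walks.two-opt (Ok E′) (λ {_} {l} → Ok-sym {E′} {l = l}) {l′ = done (v , β)} {done (v′ , inj₁ j)} (weakenCut K) (there stored) (here refl)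
          es′ = proj₁ moved
          rest : List Label
          rest = labelList ss′ (ds Γ) bs′
          open PermutationReasoning
          old : map proj₂ (es Γ) ↭ bad (p , q , β) ∷ slot j ∷ rest
          old = begin
            map proj₂ (es Γ) ↭⟨ labels Γ ⟩
            map slot (ss Γ) ++ map done (ds Γ) ++ map bad bs ↭⟨ ++⁺ (map⁺ slot ss↭) (++⁺ˡ (map done (ds Γ)) (map⁺ bad bs↭)) ⟩
            slot j ∷ map slot ss′ ++ map done (ds Γ) ++ bad (p , q , β) ∷ map bad bs′
              ↭⟨ prep (slot j) (++⁺ˡ (map slot ss′) (shift (bad (p , q , β)) (map done (ds Γ)) (map bad bs′))) ⟩
            slot j ∷ map slot ss′ ++ bad (p , q , β) ∷ map done (ds Γ) ++ map bad bs′
              ↭⟨ prep (slot j) (shift (bad (p , q , β)) (map slot ss′) _) ⟩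
            slot j ∷ bad (p , q , β) ∷ rest ↭⟨ swap _ _ ↭-refl ⟩
            bad (p , q , β) ∷ slot j ∷ rest ∎
          ls′ : map proj₂ es′ ↭ done (v , β) ∷ done (v′ , inj₁ j) ∷ rest
          ls′ = proj₂ (proj₂ (proj₂ moved)) (drop-∷ (↭-trans (↭-sym ll) old))
          new : map proj₂ es′ ↭ labelList ss′ ((v , β) ∷ (v′ , inj₁ j) ∷ ds Γ) bs′
          new = begin
            map proj₂ es′ ↭⟨ ls′ ⟩
            done (v , β) ∷ done (v′ , inj₁ j) ∷ map slot ss′ ++ map done (ds Γ) ++ map bad bs′
              ↭⟨ prep _ (↭-sym (shift (done (v′ , inj₁ j)) (map slot ss′) _)) ⟩
            done (v , β) ∷ map slot ss′ ++ done (v′ , inj₁ j) ∷ map done (ds Γ) ++ map bad bs′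
              ↭⟨ ↭-sym (shift (done (v , β)) (map slot ss′) _) ⟩
            map slot ss′ ++ done (v , β) ∷ done (v′ , inj₁ j) ∷ map done (ds Γ) ++ map bad bs′ ∎
          map-block : ∀ fs → map (block ∘ proj₂) fs ≡ map block (map proj₂ fs)
          map-block fs = map-∘ fs
          blocks′ : map (block ∘ proj₂) es′ ↭ blocks₀
          blocks′ = begin
            map (block ∘ proj₂) es′ ≡⟨ map-block es′ ⟩
            map block (map proj₂ es′) ↭⟨ map⁺ block ls′ ⟩
            β ∷ inj₁ j ∷ map block rest ↭⟨ ↭-sym (map⁺ block old) ⟩
            map block (map proj₂ (es Γ)) ≡⟨ sym (map-block (es Γ)) ⟩
            map (block ∘ proj₂) (es Γ) ↭⟨ blocks Γ ⟩
            blocks₀ ∎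
          Γ′ : Cycle bs′ E′
          Γ′ = record
            { walk = proj₁ (proj₂ moved)
            ; ss = ss′
            ; ds = (v , β) ∷ (v′ , inj₁ j) ∷ ds Γ
            ; cs = (i , b) ∷ cs Γ
            ; labels = new
            ; vertices = ↭-trans (proj₁ (proj₂ (proj₂ moved))) (↭-trans (↭-sym vv) (vertices Γ))
            ; blocks = blocks′
            ; slots = ↭-trans (shift j ss′ (map cutSlot (cs Γ))) (↭-trans (++⁺ʳ (map cutSlot (cs Γ)) (↭-sym ss↭)) (slots Γ))
            ; ds-unique = (v≢v′ ∷ AllP.¬Any⇒All¬ _ v∉) ∷ AllP.¬Any⇒All¬ _ v′∉ ∷ ds-unique Γ
            ; ds-pool = λ { (here refl) → v∈ ; (there (here refl)) → v′∈ ; (there (there m)) → ds-pool Γ m }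
            ; ds-count = trans (cong (2 +_) (ds-count Γ)) (sym (*-distribˡ-+ 2 1 (length (cs Γ))))
            ; base = λ m → there (base Γ m)
            ; budget = ≤-trans (≤-reflexive (trans (sym (+-suc (length (cs Γ)) (length bs′))) (cong (length (cs Γ) +_) (sym (↭-length bs↭))))) (budget Γ)
            }
          keep : ∀ {k} → k ∈ ss Γ → k ≢ j → k ∈ ss′
          keep m ne with ∈-resp-↭ ss↭ m
          ... | here e = ⊥-elim (ne e)
          ... | there k = k
      choose : Cut q Q p (inj₁ (centre i)) (slot (sa i)) (inj₁ (inject₁ (sa i))) ⊎ Cut q Q p (inj₁ (centre i)) (slot (sb i)) (inj₁ (suc (sb i))) →
        ∃ λ y → Commit Γ bs′ q v i y
      choose (inj₁ K) = inject₁ (sa i) , finish true _ ma (near-a i) K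
      choose (inj₂ K) = suc (sb i) , finish false _ mb (near-b i) K

copies : ℕ → List A → List A
copies M = concatMap (replicate M)

copies-↭ : ∀ M {xs ys : List A} → xs ↭ ys → copies M xs ↭ copies M ys
copies-↭ M refl = ↭-refl
copies-↭ M (prep x h) = ++⁺ˡ (replicate M x) (copies-↭ M h)
copies-↭ M (swap x y h) = ↭-trans (shifts (replicate M x) (replicate M y)) (++⁺ˡ (replicate M y) (++⁺ˡ (replicate M x) (copies-↭ M h)))
copies-↭ M (ptrans h k) = ↭-trans (copies-↭ M h) (copies-↭ M k)

length-copies : ∀ M (xs : List A) → length (copies M xs) ≡ length xs * M
length-copies M [] = refl
length-copies M (x ∷ xs) = trans (length-++ (replicate M x)) (cong₂ _+_ (length-replicate M) (length-copies M xs))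

copies-∈ : ∀ M (xs : List A) {x} → x ∈ copies M xs → x ∈ xs
copies-∈ M (y ∷ xs) m with ∈-++⁻ (replicate M y) m
... | inj₁ k = here (same M k)
  where same : ∀ M {x y : A} → x ∈ replicate M y → x ≡ y
        same (suc M) (here e) = e
        same (suc M) (there k) = same M k
... | inj₂ k = there (copies-∈ M xs k)

-- Once g is repaired, its other copies are useless; `as` collects them so that exactly the copies
-- of the other links remain.
drop-copies : ∀ M {bs bs′ : List A} {g xs} → bs ↭ g ∷ bs′ → g ∷ xs ↭ copies M bs → ∃ λ as → xs ↭ as ++ copies M bs′
drop-copies zero {bs} _ h with ∈-resp-↭ h (here refl)
... | m = ⊥-elim (none bs m)
  where none : ∀ bs {x : A} → x ∉ copies zero bs
        none (b ∷ bs) m = none bs m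
drop-copies (suc M) {g = g} bs↭ h = replicate M g , drop-∷ (↭-trans h (copies-↭ (suc M) bs↭))

map-≡-++ : ∀ (f : A → B) ws ys {zs} → map f ws ≡ ys ++ zs → ∃ λ as → ∃ λ bs → ws ≡ as ++ bs × map f as ≡ ys × map f bs ≡ zs
map-≡-++ f ws [] e = [] , ws , refl , refl , e
map-≡-++ f (w ∷ ws) (y ∷ ys) e with map-≡-++ f ws ys (∷-injectiveʳ e)
... | as , bs , e₁ , e₂ , e₃ = w ∷ as , bs , cong (w ∷_) e₁ , cong₂ _∷_ (∷-injectiveˡ e) e₂ , e₃

-- Since y determines the key of x, elements with different keys receive different choices. It turns
-- stores at distinct units into equally many distinct junctions to wait for.
select : ∀ {K Y : Set} (key : A → K) (R : A → Y → Set) → (∀ {x x′ y} → R x y → R x′ y → key x ≡ key x′) →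
  ∀ xs → (∀ {x} → x ∈ xs → ∃ (R x)) → Unique (map key xs) →
  ∃ λ ys → Unique ys × length ys ≡ length xs × (∀ {y} → y ∈ ys → ∃ λ x → x ∈ xs × R x y)
select key R fn [] h u = [] , [] , refl , λ ()
select key R fn (x ∷ xs) h (x∉ ∷ u) with h (here refl) | select key R fn xs (h ∘ there) u
... | y , r | ys , uys , len , back = y ∷ ys , AllP.¬Any⇒All¬ _ new ∷ uys , cong suc len ,
      λ { (here refl) → x , here refl , r ; (there m) → let x′ , m′ , r′ = back m in x′ , there m′ , r′ }
  where
  new : y ∉ ys
  new m with back m
  ... | x′ , m′ , r′ = All.lookup x∉ (∈-map⁺ key m′) (fn r r′)

module Stages (Gm : Game) (P : Plan (Game.board Gm)) where
  open Game Gm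
  open GameLemmas Gm
  open Plan P
  open Cycle
  open Repair Gm P

  -- A missing link p q together with a centre and a token whose hyperedge with p already exists:
  -- the first half of a possible move.
  Store : Set
  Store = Bad × Fin u × Fin ρ

  unitOf : Store → Fin u
  unitOf = proj₁ ∘ proj₂

  tokenOf : Store → Fin ρ
  tokenOf = proj₂ ∘ proj₂

  used : ∀ {bs E} → Cycle bs E → List (Fin ρ)
  used Γ = map proj₁ (ds Γ)

  record Stored {bs E} (Γ : Cycle bs E) (sts : List Store) : Set where
    field
      edges : ∀ {p q β i v} → ((p , q , β) , i , v) ∈ sts → edge (inj₁ (centre i)) v p β ∈ E
      units-unique : Unique (map unitOf sts)
      -- Both slots have to survive, because the slot to be cut depends on the orientation of the
      -- cycle at the time of the second offer.
      live : ∀ {i} → i ∈ map unitOf sts → sa i ∈ ss Γ × sb i ∈ ss Γ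
      tokens-unique : Unique (map tokenOf sts ++ used Γ)
      tokens-pool : ∀ {t} → t ∈ map tokenOf sts → t ∈ pool

  open Stored

  record Storing (M : ℕ) (bs : List Bad) (μ : ℕ) (E : List Edge) : Set where
    constructor storing
    field
      Γ : Cycle bs E
      sts : List Store
      todo : List Bad
      stored : Stored Γ sts
      all-copies : map proj₁ sts ++ todo ↭ copies M bs
      left : length todo ≡ μ

  -- Every missing link still has M stores, and the stage ends when only `base` links are missing. S
  -- is a bound on the number of stores that stays valid as links disappear.
  record Committing (M base S μ : ℕ) (E : List Edge) : Set where
    constructor committing
    field
      {bs} : List Bad
      Γ : Cycle bs E
      sts : List Store
      stored : Stored Γ sts
      all-copies : map proj₁ sts ↭ copies M bs
      size : length bs ≡ base + μ
      bound : length bs * M ≤ S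

  module ExU = Exclude (FinP._≟_ {u})
  module ExR = Exclude (FinP._≟_ {ρ})

  centre-injective : ∀ {i i′} → centre i ≡ centre i′ → i ≡ i′
  centre-injective {i} {i′} e = near-functional (near-c i) (subst (λ x → near x i′) (sym e) (near-c i′))

  -- If p happens to be the centre of a unit, that unit cannot be linked to p. Disjointness leaves
  -- at most one such unit.
  avoid : ∀ p → Σ[ is ∈ List (Fin u) ] length is ≤ 1 × (∀ i → inj₁ (centre i) ≡ p → i ∈ is)
  avoid (inj₂ t) = [] , z≤n , λ i ()
  avoid (inj₁ x) with FinP.any? (λ i → centre i FinP.≟ x)
  ... | no none = [] , z≤n , λ { i refl → ⊥-elim (none (i , refl)) }
  ... | yes (i′ , refl) = i′ ∷ [] , ≤-refl , λ i e → here (centre-injective (inj e))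
    where inj : ∀ {x y : X} → inj₁ {B = Fin ρ} x ≡ inj₁ y → x ≡ y
          inj refl = refl

  fresh-tokens : ∀ {bs E} (Γ : Cycle bs E) (sts : List Store) {S d} → length sts ≤ S → d + 2 * b₀ + S ≤ length pool →
    d ≤ length (ExR.exclude pool (map tokenOf sts ++ used Γ))
  fresh-tokens Γ sts {S} {d} sts≤S enough = +-cancelʳ-≤ (2 * b₀ + S) d _ (begin
    d + (2 * b₀ + S) ≡⟨ sym (+-assoc d (2 * b₀) S) ⟩
    d + 2 * b₀ + S ≤⟨ enough ⟩
    length pool ≤⟨ ExR.exclude-length ex pool-unique ⟩
    length (ExR.exclude pool ex) + length ex ≤⟨ +-monoʳ-≤ _ ex-len ⟩
    length (ExR.exclude pool ex) + (2 * b₀ + S) ∎)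
    where
    open ≤-Reasoning
    ex : List (Fin ρ)
    ex = map tokenOf sts ++ used Γ
    ex-len : length ex ≤ 2 * b₀ + S
    ex-len = begin
      length ex ≡⟨ length-++ (map tokenOf sts) ⟩
      length (map tokenOf sts) + length (used Γ) ≡⟨ cong₂ _+_ (length-map tokenOf sts) (trans (length-map proj₁ (ds Γ)) (ds-count Γ)) ⟩
      length sts + 2 * length (cs Γ) ≤⟨ +-mono-≤ sts≤S (*-monoʳ-≤ 2 (≤-trans (m≤m+n (length (cs Γ)) _) (budget Γ))) ⟩
      S + 2 * b₀ ≡⟨ +-comm S _ ⟩
      2 * b₀ + S ∎

  store-advance : ∀ {M bs S d} → length bs * M ≤ S → d + b₀ + S + 1 ≤ length units → d + 2 * b₀ + S ≤ length pool →
    ∀ μ E → Storing M bs (suc μ) E → Advance d d (Storing M bs μ) E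
  store-advance {M} {bs} {S} {d} bound enough-u enough-t μ E (storing Γ sts (g@(p , q , β) ∷ todo) K ac left) = record
    { xs-unique = UP.map⁺ centre-injective (ExU.exclude-unique ex units-unique′)
    ; ts-unique = ExR.exclude-unique (map tokenOf sts ++ used Γ) pool-unique
    ; xs-many = subst (d ≤_) (sym (length-map centre fresh)) fresh-many
    ; ts-many = fresh-tokens Γ sts sts≤S enough-t
    ; reply = rep }
    where
    units-unique′ = Plan.units-unique P
    open ≤-Reasoning
    sts≤S : length sts ≤ S
    sts≤S = begin
      length sts ≡⟨ sym (length-map proj₁ sts) ⟩
      length (map proj₁ sts) ≤⟨ m≤m+n _ _ ⟩
      length (map proj₁ sts) + length (g ∷ todo) ≡⟨ sym (length-++ (map proj₁ sts)) ⟩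
      length (map proj₁ sts ++ g ∷ todo) ≡⟨ ↭-length ac ⟩
      length (copies M bs) ≡⟨ length-copies M bs ⟩
      length bs * M ≤⟨ bound ⟩
      S ∎
    g∈bs : g ∈ bs
    g∈bs = copies-∈ M bs (∈-resp-↭ ac (∈-++⁺ʳ (map proj₁ sts) (here refl)))
    ex fresh : List (Fin u)
    ex = map proj₁ (cs Γ) ++ map unitOf sts ++ proj₁ (avoid p)
    fresh = ExU.exclude units ex
    ex-len : length ex ≤ b₀ + S + 1
    ex-len = begin
      length ex ≡⟨ length-++ (map proj₁ (cs Γ)) ⟩
      length (map proj₁ (cs Γ)) + length (map unitOf sts ++ proj₁ (avoid p))
        ≡⟨ cong₂ _+_ (length-map proj₁ (cs Γ)) (trans (length-++ (map unitOf sts)) (cong (_+ length (proj₁ (avoid p))) (length-map unitOf sts))) ⟩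
      length (cs Γ) + (length sts + length (proj₁ (avoid p)))
        ≤⟨ +-mono-≤ (≤-trans (m≤m+n (length (cs Γ)) _) (budget Γ)) (+-mono-≤ sts≤S (proj₁ (proj₂ (avoid p)))) ⟩
      b₀ + (S + 1) ≡⟨ sym (+-assoc b₀ S 1) ⟩
      b₀ + S + 1 ∎
    fresh-many : d ≤ length fresh
    fresh-many = +-cancelʳ-≤ (b₀ + S + 1) d _ (begin
      d + (b₀ + S + 1) ≡⟨ lem d b₀ S ⟩
      d + b₀ + S + 1 ≤⟨ enough-u ⟩
      length units ≤⟨ ExU.exclude-length ex units-unique′ ⟩
      length fresh + length ex ≤⟨ +-monoʳ-≤ _ ex-len ⟩
      length fresh + (b₀ + S + 1) ∎)
      where lem : ∀ d b S → d + (b + S + 1) ≡ d + b + S + 1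
            lem = solve-∀
    rep : ∀ {x t} → x ∈ map centre fresh → t ∈ ExR.exclude pool (map tokenOf sts ++ used Γ) →
      Σ[ w ∈ J ] Σ[ γ ∈ Block ] (w ≢ inj₁ x × w ≢ inj₂ t × Storing M bs μ (edge (inj₁ x) t w γ ∷ E))
    rep {x} {t} mx mt with ∈-map⁻ centre mx | ExR.exclude-∈ pool (map tokenOf sts ++ used Γ) mt
    ... | i , mi , refl | t∈ , t∉ with ExU.exclude-∈ units ex mi
    ...   | i∈ , i∉ = p , β , p≢x , p≢t , storing (weaken Γ) ((g , i , t) ∷ sts) todo
            (record { edges = λ { (here refl) → here refl ; (there m) → there (edges K m) }
                    ; units-unique = AllP.¬Any⇒All¬ _ (λ m → i∉ (∈-++⁺ʳ (map proj₁ (cs Γ)) (∈-++⁺ˡ m))) ∷ units-unique K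
                    ; live = λ { (here refl) → live-slot true (units-a i∈) , live-slot false (units-b i∈) ; (there m) → live K m }
                    ; tokens-unique = AllP.¬Any⇒All¬ _ t∉ ∷ tokens-unique K
                    ; tokens-pool = λ { (here refl) → t∈ ; (there m) → tokens-pool K m } })
            (↭-trans (↭-sym (shift g (map proj₁ sts) todo)) ac) (suc-injective left)
      where
      p≢x : p ≢ inj₁ (centre i)
      p≢x e = i∉ (∈-++⁺ʳ (map proj₁ (cs Γ)) (∈-++⁺ʳ (map unitOf sts) (proj₂ (proj₂ (avoid p)) i (sym e))))
      p≢t : p ≢ inj₂ t
      p≢t e = pool-disjoint t∈ (subst (_∈ vs₀) e (vertex-of-bad Γ g∈bs))
      live-slot : ∀ b → cutSlot (i , b) ∈ ss₀ → cutSlot (i , b) ∈ ss Γ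
      live-slot b m with ∈-++⁻ (ss Γ) (∈-resp-↭ (↭-sym (slots Γ)) m)
      ... | inj₁ k = k
      ... | inj₂ k with ∈-map⁻ cutSlot k
      ...   | (i′ , b′) , k′ , e = ⊥-elim (i∉ (∈-++⁺ˡ (subst (_∈ map proj₁ (cs Γ)) (sym (cutSlot-unit b b′ e)) (∈-map⁺ proj₁ k′))))

  -- Before the stage ends at least base + 1 links are missing, each with M stores. The awaited
  -- junctions are computed afresh from the current cycle and are distinct because the units are.
  -- After a move the other stores of the repaired link are abandoned; those of other links keep
  -- both slots, as they sit at other units.
  commit-advance : ∀ {M base S d} → d + 2 * b₀ + S ≤ length pool →
    ∀ μ E → Committing M base S (suc μ) E → Advance ((base + 1) * M) d (Committing M base S μ) E
  commit-advance {M} {base} {S} {d} enough-t μ E (committing {bs} Γ sts K ac size bound) = record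
    { xs-unique = proj₁ (proj₂ targets)
    ; ts-unique = ExR.exclude-unique (map tokenOf sts ++ used Γ) pool-unique
    ; xs-many = begin
        (base + 1) * M ≤⟨ *-monoˡ-≤ M (≤-trans (+-monoʳ-≤ base (s≤s z≤n)) (≤-reflexive (sym size))) ⟩
        length bs * M ≡⟨ sym sts-length ⟩
        length sts ≡⟨ sym (proj₁ (proj₂ (proj₂ targets))) ⟩
        length (proj₁ targets) ∎
    ; ts-many = fresh-tokens Γ sts (≤-trans (≤-reflexive sts-length) bound) enough-t
    ; reply = rep }
    where
    open ≤-Reasoning
    sts-length : length sts ≡ length bs * M
    sts-length = trans (sym (length-map proj₁ sts)) (trans (↭-length ac) (length-copies M bs))
    R : Store → X → Set
    R ((p , q , β) , i , v) y = ∃ λ bs′ → bs ↭ (p , q , β) ∷ bs′ × Commit Γ bs′ q v i y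
    R-fun : ∀ {s s′ y} → R s y → R s′ y → unitOf s ≡ unitOf s′
    R-fun (_ , _ , k) (_ , _ , k′) = near-functional (Commit.y-near k) (Commit.y-near k′)
    R-total : ∀ {s} → s ∈ sts → ∃ (R s)
    R-total {(p , q , β) , i , v} m with ∈-∃++ (copies-∈ M bs (∈-resp-↭ ac (∈-map⁺ proj₁ m)))
    ... | b₁ , b₂ , refl with live K (∈-map⁺ unitOf m)
    ...   | la , lb with commit Γ (shift (p , q , β) b₁ b₂) la lb (edges K m) (tokens-pool K (∈-map⁺ tokenOf m))
                          (Unique-disj (map tokenOf sts) (tokens-unique K) (∈-map⁺ tokenOf m))
    ...     | y , k = y , b₁ ++ b₂ , shift (p , q , β) b₁ b₂ , k
    targets = select unitOf R R-fun sts R-total (units-unique K)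
    rep : ∀ {y t} → y ∈ proj₁ targets → t ∈ ExR.exclude pool (map tokenOf sts ++ used Γ) →
      Σ[ w ∈ J ] Σ[ γ ∈ Block ] (w ≢ inj₁ y × w ≢ inj₂ t × Committing M base S μ (edge (inj₁ y) t w γ ∷ E))
    rep {y} {t} my mt with proj₂ (proj₂ (proj₂ targets)) my | ExR.exclude-∈ pool (map tokenOf sts ++ used Γ) mt
    ... | ((p , q , β) , i , v) , ms , bs′ , bs↭ , k | t∈ , t∉
      with Commit.result k t t∈ (λ m → t∉ (∈-++⁺ʳ (map tokenOf sts) m)) (λ { refl → t∉ (∈-++⁺ˡ (∈-map⁺ tokenOf ms)) })
    ...   | Γ′ , toks , keep with ∈-∃++ ms
    ...     | t₁ , t₂ , refl with drop-copies M bs↭ (↭-trans (↭-sym (map⁺ proj₁ (shift ((p , q , β) , i , v) t₁ t₂))) ac)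
    ...       | gs , others₀ with ↭-map-inv proj₁ others₀
    ...         | others , eq , others↭ with map-≡-++ proj₁ others gs (sym eq)
    ...           | as , rest , refl , _ , rest-copies = q , inj₁ (cutSlot (i , Commit.side k)) , Commit.q≢y k , q≢t ,
            committing Γ′ rest K′ (↭-reflexive rest-copies)
              (suc-injective (trans (sym (↭-length bs↭)) (trans size (+-suc base μ))))
              (≤-trans (≤-trans (*-monoˡ-≤ M (n≤1+n (length bs′))) (≤-reflexive (cong (_* M) (sym (↭-length bs↭))))) bound)
      where
      s : Store
      s = (p , q , β) , i , v
      sts↭ : t₁ ++ s ∷ t₂ ↭ s ∷ as ++ rest
      sts↭ = ↭-trans (shift s t₁ t₂) (prep s others↭)
      rest⊆ : ∀ {z} → z ∈ rest → z ∈ t₁ ++ s ∷ t₂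
      rest⊆ m = ∈-resp-↭ (↭-sym sts↭) (there (∈-++⁺ʳ as m))
      q≢t : q ≢ inj₂ t
      q≢t e = pool-disjoint t∈ (subst (_∈ vs₀) e (vertex-of-bad′ Γ (∈-resp-↭ (↭-sym bs↭) (here refl))))
      units′ : Unique (i ∷ map unitOf rest)
      units′ with Unique-resp-↭ (map⁺ unitOf sts↭) (units-unique K)
      ... | i∉ ∷ uq = AllP.¬Any⇒All¬ _ (λ m → All.lookup i∉ (∈-resp-↭ (↭-reflexive (sym (map-++ unitOf as rest))) (∈-++⁺ʳ (map unitOf as) m)) refl)
                      ∷ Unique-++ʳ (map unitOf as) (subst Unique (map-++ unitOf as rest) uq)
      tokens′ : Unique (v ∷ map tokenOf rest ++ used Γ)
      tokens′ with Unique-resp-↭ (++⁺ʳ (used Γ) (map⁺ tokenOf sts↭)) (tokens-unique K)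
      ... | v∉ ∷ uq = AllP.¬Any⇒All¬ _ (λ m → All.lookup v∉ (subst (v ∈_) (sym assoc) (∈-++⁺ʳ (map tokenOf as) m)) refl)
                      ∷ Unique-++ʳ (map tokenOf as) (subst Unique assoc uq)
        where assoc : map tokenOf (as ++ rest) ++ used Γ ≡ map tokenOf as ++ map tokenOf rest ++ used Γ
              assoc = trans (cong (_++ used Γ) (map-++ tokenOf as rest)) (++-assoc (map tokenOf as) _ _)
      t-new : t ∉ v ∷ map tokenOf rest ++ used Γ
      t-new (here refl) = t∉ (∈-++⁺ˡ (∈-map⁺ tokenOf ms))
      t-new (there m) with ∈-++⁻ (map tokenOf rest) m
      ... | inj₂ m′ = t∉ (∈-++⁺ʳ (map tokenOf (t₁ ++ s ∷ t₂)) m′)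
      ... | inj₁ m′ with ∈-map⁻ tokenOf m′
      ...   | z , mz , refl = t∉ (∈-++⁺ˡ (∈-map⁺ tokenOf (rest⊆ mz)))
      K′ : Stored Γ′ rest
      K′ = record
        { edges = λ m → there (edges K (rest⊆ m))
        ; units-unique = Unique-++ʳ (i ∷ []) units′
        ; live = lv
        ; tokens-unique = subst (λ z → Unique (map tokenOf rest ++ z)) (sym toks)
            (Unique-resp-↭ (↭-sym (↭-trans (shift v (map tokenOf rest) (t ∷ used Γ)) (↭-trans (prep v (shift t (map tokenOf rest) (used Γ))) (swap v t ↭-refl))))
              (AllP.¬Any⇒All¬ _ t-new ∷ tokens′))
        ; tokens-pool = λ m → let z , mz , e = ∈-map⁻ tokenOf m in subst (_∈ pool) (sym e) (tokens-pool K (∈-map⁺ tokenOf (rest⊆ mz)))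
        }
        where
        lv : ∀ {i′} → i′ ∈ map unitOf rest → sa i′ ∈ ss Γ′ × sb i′ ∈ ss Γ′
        lv {i′} m with ∈-map⁻ unitOf m | units′
        ... | z , mz , refl | i∉ ∷ _ with live K (∈-map⁺ unitOf (rest⊆ mz))
        ...   | la , lb = keep la (ne true) , keep lb (ne false)
          where ne : ∀ b → cutSlot (i′ , b) ≢ cutSlot (i , Commit.side k)
                ne b e = All.lookup i∉ m (sym (cutSlot-unit b (Commit.side k) e))

  -- A stage starts without stores: those left over from earlier stages are forgotten, and their
  -- units and tokens become available again. The two `G` terms are the risks that Ta rounds do not
  -- suffice for storing and that Tb rounds do not suffice for committing.
  stage : ∀ {M base μ S d T₂ f₂ ca cb} Ta Tb → (base + μ) * M ≤ S →
    d + b₀ + S + 1 ≤ length units → d + 2 * b₀ + S ≤ length pool →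
    d * d + ca ≡ N → (base + 1) * M * d + cb ≡ N →
    (∀ {bs E} → Cycle bs E → length bs ≡ base → W T₂ E f₂) →
    ∀ {bs E} → Cycle bs E → length bs ≡ base + μ →
    W (Ta + (Tb + T₂)) E
      (N ^ Ta * (N ^ Tb * f₂ + N ^ T₂ * G ((base + 1) * M * d) cb Tb μ) + N ^ (Tb + T₂) * G (d * d) ca Ta ((base + μ) * M))
  stage {M} {base} {μ} {S} {d} {ca = ca} {cb} Ta Tb bound enough-u enough-t ea eb cont {bs} {E} Γ size =
    loop (Storing M bs) d d ca ea (store-advance bound′ enough-u enough-t) then Ta ((base + μ) * M) E
      (storing Γ [] (copies M bs) empty ↭-refl (trans (length-copies M bs) (cong (_* M) size)))
    where
    bound′ : length bs * M ≤ S
    bound′ = subst (λ z → z * M ≤ S) (sym size) bound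
    empty : Stored Γ []
    empty = record { edges = λ () ; units-unique = [] ; live = λ () ; tokens-unique = ds-unique Γ ; tokens-pool = λ () }
    then : ∀ E′ → Storing M bs 0 E′ → W _ E′ _
    then E′ (storing Γ′ sts [] K ac left) = loop (Committing M base S) ((base + 1) * M) d cb eb (commit-advance enough-t)
      (λ { E″ (committing Γ″ _ _ _ size″ _) → cont Γ″ (trans size″ (+-identityʳ base)) })
      Tb μ E′ (committing Γ′ sts K (↭-trans (↭-reflexive (sym (++-identityʳ (map proj₁ sts)))) ac) size bound′)

-- Edge counts in bipartite graphs, expansion and cores

∑-delta : ∀ {n} (f : Fin n → ℕ) x → ∑ (allFin n) (λ j → f j * ⟦ x == j ⟧) ≡ f x
∑-delta {suc n} f zero = trans (∑-allFin-suc (λ j → f j * ⟦ zero == j ⟧)) (trans (cong₂ _+_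
  (trans (cong (λ b → f zero * ⟦ b ⟧) (==-refl zero)) (*-identityʳ (f zero)))
  (trans (∑-cong (allFin n) (λ j → trans (cong (λ b → f (suc j) * ⟦ b ⟧) (≢⇒== (λ ()))) (*-zeroʳ (f (suc j)))))
    (trans (∑-const (allFin n) 0) (*-zeroʳ (length (allFin n)))))) (+-identityʳ (f zero)))
∑-delta {suc n} f (suc x) = trans (∑-allFin-suc (λ j → f j * ⟦ suc x == j ⟧)) (cong₂ _+_
  (trans (cong (λ b → f zero * ⟦ b ⟧) (≢⇒== (λ ()))) (*-zeroʳ (f zero)))
  (trans (∑-cong (allFin n) (λ j → cong (λ b → f (suc j) * ⟦ b ⟧) (suc==suc x j))) (∑-delta (f ∘ suc) x)))

module Elements {n : ℕ} where
  open import Data.List.Membership.DecPropositional (FinP._≟_ {n}) using (_∈?_)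

  elems : (Fin n → Bool) → List (Fin n)
  elems S = filter (λ x → S x ≟ᵇ true) (allFin n)

  elems-unique : ∀ S → Unique (elems S)
  elems-unique S = UP.filter⁺ (λ x → S x ≟ᵇ true) (UP.allFin⁺ n)

  ∈-elems⁺ : ∀ {S x} → S x ≡ true → x ∈ elems S
  ∈-elems⁺ {S} e = ∈-filter⁺ (λ x → S x ≟ᵇ true) (∈-allFin _) e

  ∈-elems⁻ : ∀ {S x} → x ∈ elems S → S x ≡ true
  ∈-elems⁻ {S} m = proj₂ (∈-filter⁻ (λ x → S x ≟ᵇ true) {xs = allFin n} m)

  length-elems : ∀ S → length (elems S) ≡ # S
  length-elems S = trans (go (allFin n)) (sym (#≡∑ S))
    where
    go : ∀ xs → length (filter (λ x → S x ≟ᵇ true) xs) ≡ ∑ xs (⟦_⟧ ∘ S)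
    go [] = refl
    go (x ∷ xs) with S x
    ... | true = cong suc (go xs)
    ... | false = go xs

  opaque
    memb : List (Fin n) → Fin n → Bool
    memb xs x = ⌊ x ∈? xs ⌋

    memb⁺ : ∀ {xs x} → x ∈ xs → memb xs x ≡ true
    memb⁺ {xs} {x} m with x ∈? xs
    ... | yes _ = refl
    ... | no k = ⊥-elim (k m)

    memb⁻ : ∀ {xs x} → memb xs x ≡ true → x ∈ xs
    memb⁻ {xs} {x} e with x ∈? xs
    ... | yes m = m
    memb⁻ () | no _

  #-memb : ∀ {xs} → Unique xs → # (memb xs) ≡ length xs
  #-memb {xs} u = trans (sym (length-elems (memb xs)))
    (≤-antisym (unique-length-≤ (elems-unique (memb xs)) (λ m → memb⁻ (∈-elems⁻ m)))
               (unique-length-≤ u (λ m → ∈-elems⁺ (memb⁺ m))))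

open Elements

enumerate : ∀ {n} (xs : List A) → length xs ≡ n → Σ[ f ∈ (Fin n → A) ] tabulate f ≡ xs
enumerate {n = zero} [] e = (λ ()) , refl
enumerate {n = suc n} (x ∷ xs) e with enumerate xs (suc-injective e)
... | f , h = (λ { zero → x ; (suc i) → f i }) , cong (x ∷_) h

-- Edges count with multiplicity, since the same pair may be offered several times.
hits : ∀ {a b} → List (Fin a × Fin b) → (Fin a → Bool) → (Fin b → Bool) → ℕ
hits w S T = ∑ w (λ o → ⟦ S (proj₁ o) ∧ T (proj₂ o) ⟧)

module Hits {a b : ℕ} (w : List (Fin a × Fin b)) where

  hits-mono-∈ : ∀ {S S′ T T′} → (∀ {j t} → (j , t) ∈ w → S j ≡ true → T t ≡ true → S′ j ≡ true × T′ t ≡ true) →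
    hits w S T ≤ hits w S′ T′
  hits-mono-∈ {S} {S′} {T} {T′} = go w
    where
    go : ∀ v → (∀ {j t} → (j , t) ∈ v → S j ≡ true → T t ≡ true → S′ j ≡ true × T′ t ≡ true) → hits v S T ≤ hits v S′ T′
    go [] h = z≤n
    go ((j , t) ∷ v) h = +-mono-≤ (lem (S j) (T t) (h (here refl))) (go v (h ∘ there))
      where
      lem : ∀ x y → (x ≡ true → y ≡ true → S′ j ≡ true × T′ t ≡ true) → ⟦ x ∧ y ⟧ ≤ ⟦ S′ j ∧ T′ t ⟧
      lem false y f = z≤n
      lem true false f = z≤n
      lem true true f with f refl refl
      ... | p , q rewrite p | q = ≤-refl

  hits-mono : ∀ {S S′ T T′} → S ⊑ S′ → T ⊑ T′ → hits w S T ≤ hits w S′ T′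
  hits-mono h k = hits-mono-∈ (λ _ p q → h _ p , k _ q)

  hits-none : ∀ {S T} → (∀ {j t} → (j , t) ∈ w → S j ≡ true → T t ≡ true → 1 ≡ 0) → hits w S T ≡ 0
  hits-none {S} {T} h = n≤0⇒n≡0 (≤-trans (hits-mono-∈ {S} {λ _ → false} {T} {λ _ → false} (λ m p q → ⊥-elim (absurd (h m p q))))
      (≤-reflexive (trans (∑-const w 0) (*-zeroʳ (length w)))))
    where absurd : ¬ (1 ≡ 0)
          absurd ()

  hits-∈ : ∀ {S T} → 1 ≤ hits w S T → ∃ λ j → ∃ λ t → (j , t) ∈ w × S j ≡ true × T t ≡ true
  hits-∈ {S} {T} = go w
    where
    go : ∀ v → 1 ≤ hits v S T → ∃ λ j → ∃ λ t → (j , t) ∈ v × S j ≡ true × T t ≡ true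
    go ((j , t) ∷ v) h with bool-cases (S j ∧ T t)
    ... | inj₁ e = j , t , here refl , ∧-true e
    ... | inj₂ e rewrite e with go v h
    ...   | j′ , t′ , m , p = j′ , t′ , there m , p

  ∈⇒hits : ∀ {S T j t} → (j , t) ∈ w → S j ≡ true → T t ≡ true → 1 ≤ hits w S T
  ∈⇒hits {S} {T} {j} {t} m p q = subst (_≤ hits w S T) (cong ⟦_⟧ (∧-intro p q)) (∈⇒≤∑ (λ o → ⟦ S (proj₁ o) ∧ T (proj₂ o) ⟧) m)

  hits-∪ˡ : ∀ S S′ T → hits w (S ∪ᵇ S′) T ≤ hits w S T + hits w S′ T
  hits-∪ˡ S S′ T = ≤-trans (∑-mono w (λ o → lem (S (proj₁ o)) (S′ (proj₁ o)) (T (proj₂ o)))) (≤-reflexive (∑-+ w _ _))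
    where lem : ∀ x y z → ⟦ (x ∨ y) ∧ z ⟧ ≤ ⟦ x ∧ z ⟧ + ⟦ y ∧ z ⟧
          lem true y z = m≤m+n ⟦ z ⟧ _
          lem false y z = ≤-refl

  hits-∪ʳ : ∀ S T T′ → hits w S (T ∪ᵇ T′) ≤ hits w S T + hits w S T′
  hits-∪ʳ S T T′ = ≤-trans (∑-mono w (λ o → lem (S (proj₁ o)) (T (proj₂ o)) (T′ (proj₂ o)))) (≤-reflexive (∑-+ w _ _))
    where lem : ∀ x y z → ⟦ x ∧ (y ∨ z) ⟧ ≤ ⟦ x ∧ y ⟧ + ⟦ x ∧ z ⟧
          lem false y z = z≤n
          lem true true z = m≤m+n 1 _
          lem true false z = ≤-refl

  -- Double counting of the edges between S and T by their endpoint in S.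
  degree-sumˡ : ∀ k {S T} → (∀ j → S j ≡ true → k ≤ hits w (_== j) T) → k * # S ≤ hits w S T
  degree-sumˡ k {S} {T} h = begin
    k * # S ≡⟨ cong (k *_) (#≡∑ S) ⟩
    k * ∑ (allFin a) (⟦_⟧ ∘ S) ≡⟨ sym (∑-*ˡ (allFin a) k _) ⟩
    ∑ (allFin a) (λ j → k * ⟦ S j ⟧) ≤⟨ ∑-mono (allFin a) (λ j → lem j (S j) (h j)) ⟩
    ∑ (allFin a) (λ j → ⟦ S j ⟧ * hits w (_== j) T) ≡⟨ ∑-cong (allFin a) (λ j → sym (∑-*ˡ w ⟦ S j ⟧ _)) ⟩
    ∑ (allFin a) (λ j → ∑ w (λ o → ⟦ S j ⟧ * ⟦ (proj₁ o == j) ∧ T (proj₂ o) ⟧)) ≡⟨ ∑-swap (allFin a) w (λ j o → ⟦ S j ⟧ * ⟦ (proj₁ o == j) ∧ T (proj₂ o) ⟧) ⟩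
    ∑ w (λ o → ∑ (allFin a) (λ j → ⟦ S j ⟧ * ⟦ (proj₁ o == j) ∧ T (proj₂ o) ⟧)) ≡⟨ ∑-cong w each ⟩
    hits w S T ∎
    where
    open ≤-Reasoning
    lem : ∀ j x → (x ≡ true → k ≤ hits w (_== j) T) → k * ⟦ x ⟧ ≤ ⟦ x ⟧ * hits w (_== j) T
    lem j false f = ≤-reflexive (*-zeroʳ k)
    lem j true f = subst₂ _≤_ (sym (*-identityʳ k)) (sym (+-identityʳ _)) (f refl)
    ∧-* : ∀ x y → ⟦ x ∧ y ⟧ ≡ ⟦ y ⟧ * ⟦ x ⟧
    ∧-* true true = refl
    ∧-* true false = refl
    ∧-* false true = refl
    ∧-* false false = refl
    each : ∀ o → ∑ (allFin a) (λ j → ⟦ S j ⟧ * ⟦ (proj₁ o == j) ∧ T (proj₂ o) ⟧) ≡ ⟦ S (proj₁ o) ∧ T (proj₂ o) ⟧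
    each (x , t) = trans (∑-cong (allFin a) (λ j → trans (cong (⟦ S j ⟧ *_) (∧-* (x == j) (T t))) (sym (*-assoc ⟦ S j ⟧ ⟦ T t ⟧ ⟦ x == j ⟧))))
      (trans (∑-delta (λ j → ⟦ S j ⟧ * ⟦ T t ⟧) x) (trans (*-comm ⟦ S x ⟧ ⟦ T t ⟧) (sym (∧-* (S x) (T t)))))

swap-pairs : ∀ {a b} → List (Fin a × Fin b) → List (Fin b × Fin a)
swap-pairs = map (λ o → proj₂ o , proj₁ o)

hits-swap : ∀ {a b} (w : List (Fin a × Fin b)) S T → hits (swap-pairs w) T S ≡ hits w S T
hits-swap w S T = trans (∑-map (λ o → proj₂ o , proj₁ o) w (λ o → ⟦ T (proj₁ o) ∧ S (proj₂ o) ⟧))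
  (∑-cong w (λ o → cong ⟦_⟧ (∧-comm (T (proj₂ o)) (S (proj₁ o)))))

degree-sumʳ : ∀ {a b} (w : List (Fin a × Fin b)) k {S T} → (∀ t → T t ≡ true → k ≤ hits w S (_== t)) → k * # T ≤ hits w S T
degree-sumʳ w k {S} {T} h = ≤-trans (Hits.degree-sumˡ (swap-pairs w) k {T} {S} (λ t e → ≤-trans (h t e) (≤-reflexive (sym (hits-swap w S (_== t))))))
  (≤-reflexive (hits-swap w S T))

-- Together with a minimum degree k, `sparse` forces small sets to expand; `meets` limits the set of
-- tokens missed by a large set of slots; the two density conditions limit the number of deletions
-- needed to reach degree k.
record Expanding {a b} (d k q : ℕ) (w : List (Fin a × Fin b)) : Set where
  field
    sparse : ∀ i → 1 ≤ i → i ≤ d → ∀ S T → # S ≤ i → # T ≤ i → hits w S T < k * i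
    meets : ∀ S T → d ≤ # S → d ≤ # T → 1 ≤ hits w S T
    denseˡ : ∀ S T → d ≤ # S → q ≤ # T → k * suc d < hits w S T
    denseʳ : ∀ S T → q ≤ # S → d ≤ # T → k * suc d < hits w S T

-- A variant of the k-core: the degrees of all good slots and tokens, not only the main ones, are
-- counted into the good main vertices of the other side.
record Core {a b} (w : List (Fin a × Fin b)) (d k : ℕ) (Lm : Fin a → Bool) (Rm : Fin b → Bool) : Set where
  field
    BL : Fin a → Bool
    BR : Fin b → Bool
    BL≤d : # BL ≤ d
    BR≤d : # BR ≤ d
    slots-stable : ∀ j → BL j ≡ false → k ≤ hits w (_== j) (Rm ∖ᵇ BR)
    tokens-stable : ∀ t → BR t ≡ false → k ≤ hits w (Lm ∖ᵇ BL) (_== t)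

-- Vertices of low degree are deleted one at a time; d + 1 deletions on one side would contradict density.
module _ {a b d k q : ℕ} {w : List (Fin a × Fin b)} (X : Expanding d k q w) (Lm : Fin a → Bool) (Rm : Fin b → Bool)
  (Lm-large : q + d ≤ # Lm) (Rm-large : q + d ≤ # Rm) where
  open Expanding X
  open Hits w

  remaining : ∀ {n} (M D : Fin n → Bool) → q + d ≤ # M → # D ≤ d → q ≤ # (M ∖ᵇ D)
  remaining M D large sm = +-cancelʳ-≤ d q _ (begin
    q + d ≤⟨ large ⟩
    # M ≡⟨ #-∖ M D ⟩
    # (M ∩ᵇ D) + # (M ∖ᵇ D) ≤⟨ +-monoˡ-≤ _ (≤-trans (#-mono (λ x h → proj₂ (∧-true {M x} h))) sm) ⟩
    d + # (M ∖ᵇ D) ≡⟨ +-comm d _ ⟩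
    # (M ∖ᵇ D) + d ∎)
    where open ≤-Reasoning

  ∖-anti : ∀ {n} (M : Fin n → Bool) {D D′} → D ⊑ D′ → (M ∖ᵇ D′) ⊑ (M ∖ᵇ D)
  ∖-anti M {D} {D′} h x e with ∧-true {M x} e
  ... | m , n with bool-cases (D x)
  ...   | inj₁ p = true≢false (h x p) (not-true n)
  ...   | inj₂ p = ∧-intro m (cong not p)

  -- The two last hypotheses are invariants: a deleted slot has fewer than k edges to the main
  -- tokens present at its deletion, and later deletions of tokens only lower the count; likewise
  -- for tokens. Density contradicts the invariant as soon as one side reaches d + 1.
  core-fuel : ∀ n (BL : Fin a → Bool) (BR : Fin b → Bool) → # BL ≤ d → # BR ≤ d → d + d ≤ n + (# BL + # BR) →
    hits w BL (Rm ∖ᵇ BR) ≤ k * # BL → hits w (Lm ∖ᵇ BL) BR ≤ k * # BR → Core w d k Lm Rm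
  core-fuel n BL BR BL≤ BR≤ fuel hL hR
    with FinP.any? (λ j → (BL j ≟ᵇ false) ×-dec (hits w (_== j) (Rm ∖ᵇ BR) <? k))
       | FinP.any? (λ t → (BR t ≟ᵇ false) ×-dec (hits w (Lm ∖ᵇ BL) (_== t) <? k))
  ... | no okL | no okR = record
    { BL = BL ; BR = BR ; BL≤d = BL≤ ; BR≤d = BR≤
    ; slots-stable = λ j e → ≮⇒≥ (λ lt → okL (j , e , lt))
    ; tokens-stable = λ t e → ≮⇒≥ (λ lt → okR (t , e , lt)) }
  ... | yes (j , e , lt) | _ = continue n fuel
    where
    BL′ : Fin a → Bool
    BL′ = BL ∪ᵇ (_== j)
    size′ : # BL′ ≡ suc (# BL)
    size′ = #-insert BL j e
    hL′ : hits w BL′ (Rm ∖ᵇ BR) ≤ k * # BL′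
    hL′ = ≤-trans (hits-∪ˡ BL (_== j) _) (≤-trans (+-mono-≤ hL (<⇒≤ lt)) (≤-reflexive (trans (+-comm (k * # BL) k) (trans (sym (*-suc k (# BL))) (cong (k *_) (sym size′))))))
    strict : # BL < d
    strict = ≤∧≢⇒< BL≤ λ full → <-irrefl refl (<-≤-trans (denseˡ BL′ (Rm ∖ᵇ BR)
      (≤-trans (n≤1+n d) (≤-reflexive (trans (cong suc (sym full)) (sym size′)))) (remaining Rm BR Rm-large BR≤))
      (≤-trans hL′ (≤-reflexive (cong (k *_) (trans size′ (cong suc full))))))
    continue : ∀ n → d + d ≤ n + (# BL + # BR) → Core w d k Lm Rm
    continue zero f = ⊥-elim (<-irrefl refl (<-≤-trans (+-mono-<-≤ strict BR≤) f))
    continue (suc n) f = core-fuel n BL′ BR (subst (_≤ d) (sym size′) strict) BR≤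
      (≤-trans f (≤-reflexive (trans (sym (+-suc n _)) (cong (λ z → n + (z + # BR)) (sym size′)))))
      hL′ (≤-trans (hits-mono (∖-anti Lm (λ x h → ∨-introˡ h)) (λ _ h → h)) hR)
  ... | no _ | yes (t , e , lt) = continue n fuel
    where
    BR′ : Fin b → Bool
    BR′ = BR ∪ᵇ (_== t)
    size′ : # BR′ ≡ suc (# BR)
    size′ = #-insert BR t e
    hR′ : hits w (Lm ∖ᵇ BL) BR′ ≤ k * # BR′
    hR′ = ≤-trans (hits-∪ʳ (Lm ∖ᵇ BL) BR (_== t)) (≤-trans (+-mono-≤ hR (<⇒≤ lt)) (≤-reflexive (trans (+-comm (k * # BR) k) (trans (sym (*-suc k (# BR))) (cong (k *_) (sym size′))))))
    strict : # BR < d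
    strict = ≤∧≢⇒< BR≤ λ full → <-irrefl refl (<-≤-trans (denseʳ (Lm ∖ᵇ BL) BR′ (remaining Lm BL Lm-large BL≤)
      (≤-trans (n≤1+n d) (≤-reflexive (trans (cong suc (sym full)) (sym size′)))))
      (≤-trans hR′ (≤-reflexive (cong (k *_) (trans size′ (cong suc full))))))
    continue : ∀ n → d + d ≤ n + (# BL + # BR) → Core w d k Lm Rm
    continue zero f = ⊥-elim (<-irrefl refl (<-≤-trans (+-mono-≤-< BL≤ strict) f))
    continue (suc n) f = core-fuel n BL BR′ BL≤ (subst (_≤ d) (sym size′) strict)
      (≤-trans f (≤-reflexive (trans (sym (+-suc n _)) (cong (n +_) (trans (sym (+-suc (# BL) (# BR))) (cong (# BL +_) (sym size′)))))))
      (≤-trans (hits-mono {S = BL} {BL} (λ _ h → h) (∖-anti Rm {BR} {BR′} (λ x h → ∨-introˡ h))) hL) hR′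

  core : Core w d k Lm Rm
  core = core-fuel (d + d) (λ _ → false) (λ _ → false) (≤-trans (≤-reflexive (#-false (λ _ → refl))) z≤n) (≤-trans (≤-reflexive (#-false (λ _ → refl))) z≤n)
    (m≤m+n (d + d) _)
    (≤-trans (≤-reflexive (hits-none {T = Rm ∖ᵇ (λ _ → false)} (λ _ ()))) z≤n)
    (≤-trans (≤-reflexive (hits-none {S = Lm ∖ᵇ (λ _ → false)} (λ _ _ ()))) z≤n)

-- The cycle after the random phase, and its completion by a perfect matching

-- Degrees are measured into the main slots Lm and main tokens Rm; 2-opt moves only consume units and tokens outside Rm,
-- so they leave these degrees intact.
record Layout (D : Dims) : Set₁ where
  open Dims D
  field
    u d k q : ℕ
    sa sb : Fin u → Fin ℓ′
    joined : ∀ i → Fin.suc (sa i) ≡ inject₁ (sb i)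
    near : X → Fin u → Set
    near-functional : ∀ {x i i′} → near x i → near x i′ → i ≡ i′
    near-a : ∀ i → near (inject₁ (sa i)) i
    near-c : ∀ i → near (suc (sa i)) i
    near-b : ∀ i → near (suc (sb i)) i
    a≢b : ∀ i → inject₁ (sa i) ≢ suc (sb i)
    Lm : Fin ℓ′ → Bool
    Rm : Fin ρ → Bool
    Lm-a : ∀ i → Lm (sa i) ≡ false
    Lm-b : ∀ i → Lm (sb i) ≡ false
    t₀ : Fin ρ
    e≡d : e ≡ d
    ρ≡ : ρ ≡ suc ℓ′ + e + e
    Lm-large : q + d ≤ # Lm
    Rm-large : q + d ≤ # Rm
    Rres-large : d + d ≤ # (not ∘ Rm)

module Opening {B : Board} (Lay : Layout (Board.dims B)) (w : List (Fin (Board.ℓ′ B) × Fin (Board.ρ B)))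
  (K : Core w (Layout.d Lay) (Layout.k Lay) (Layout.Lm Lay) (Layout.Rm Lay)) (E₀ : List (Board.Edge B)) where
  open Board B
  open Layout Lay
  open Core K

  -- The number e of tokens that become junctions fixes the number of blocks, so it must be known
  -- before the game. The bad tokens are therefore filled up to exactly d with good reserve tokens.
  padding : List (Fin ρ)
  padding = take (d ∸ # BR) (elems ((not ∘ Rm) ∖ᵇ BR))

  zs : List (Fin ρ)
  zs = elems BR ++ padding

  padding⁻ : ∀ {t} → t ∈ padding → Rm t ≡ false × BR t ≡ false
  padding⁻ {t} m with ∧-true {not (Rm t)} (∈-elems⁻ (∈-take (d ∸ # BR) _ m))
  ... | p , r = not-true p , not-true r

  zs-unique : Unique zs
  zs-unique = UP.++⁺ (elems-unique BR) (UP.take⁺ (d ∸ # BR) (elems-unique _))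
    (λ { (m , m′) → true≢false (∈-elems⁻ m) (proj₂ (padding⁻ m′)) })

  zs-length : length zs ≡ e
  zs-length = begin
    length zs ≡⟨ length-++ (elems BR) ⟩
    length (elems BR) + length padding ≡⟨ cong₂ _+_ (length-elems BR) (length-take-≤ (d ∸ # BR) _ enough) ⟩
    # BR + (d ∸ # BR) ≡⟨ m+[n∸m]≡n BR≤d ⟩
    d ≡⟨ sym e≡d ⟩
    e ∎
    where
    open ≡-Reasoning
    enough : d ∸ # BR ≤ length (elems ((not ∘ Rm) ∖ᵇ BR))
    enough = ≤-trans (m∸n≤m d (# BR)) (≤-trans (+-cancelʳ-≤ d d _ (≤-trans Rres-large (≤-trans (≤-reflexive (#-∖ (not ∘ Rm) BR))
      (≤-trans (+-monoˡ-≤ _ (≤-trans (#-mono (λ x h → proj₂ (∧-true {not (Rm x)} h))) BR≤d)) (≤-reflexive (+-comm d _)))))) (≤-reflexive (sym (length-elems _))))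

  zf : Fin e → Fin ρ
  zf = proj₁ (enumerate zs zs-length)

  zf≡ : tabulate zf ≡ zs
  zf≡ = proj₂ (enumerate zs zs-length)

  last : X
  last = fromℕ ℓ′

  vs₀ : List J
  vs₀ = tabulate (λ j → inj₁ (inject₁ j)) ++ inj₁ last ∷ map inj₂ zs

  vs₀-unique : Unique vs₀
  vs₀-unique = UP.++⁺ (UP.tabulate⁺ (λ e → FinP.inject₁-injective (inj₁-injective e)))
      (AllP.¬Any⇒All¬ _ (λ m → no₁₂ (proj₂ (proj₂ (∈-map⁻ inj₂ m)))) ∷ UP.map⁺ inj₂-injective zs-unique) disj
    where
    no₁₂ : ∀ {x : X} {t : Fin ρ} → inj₁ x ≢ inj₂ t
    no₁₂ ()
    disj : ∀ {v} → ¬ (v ∈ tabulate (λ j → inj₁ (inject₁ j)) × v ∈ inj₁ last ∷ map inj₂ zs)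
    disj (m , m′) with ∈-tabulate⁻ m
    disj (m , here e) | j , refl = FinP.fromℕ≢inject₁ (sym (inj₁-injective e))
    disj (m , there m′) | j , refl = no₁₂ (proj₂ (proj₂ (∈-map⁻ inj₂ m′)))

  blocks₀ : List Block
  blocks₀ = tabulate inj₁ ++ tabulate inj₂

  blocks₀-unique : Unique blocks₀
  blocks₀-unique = UP.++⁺ (UP.tabulate⁺ {f = inj₁} (λ { refl → refl })) (UP.tabulate⁺ {f = inj₂} (λ { refl → refl })) disj
    where
    disj : ∀ {v} → ¬ (v ∈ tabulate {n = ℓ′} inj₁ × v ∈ tabulate {n = suc e} inj₂)
    disj (m , m′) with ∈-tabulate⁻ {f = inj₁} m | ∈-tabulate⁻ {f = inj₂} m′
    ... | _ , refl | _ , ()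

  units : List (Fin u)
  units = elems (not ∘ ((BL ∘ sa) ∪ᵇ (BL ∘ sb)))

  unit-slots-good : ∀ {i} → i ∈ units → BL (sa i) ≡ false × BL (sb i) ≡ false
  unit-slots-good {i} m with BL (sa i) | BL (sb i) | ∈-elems⁻ m
  ... | false | false | _ = refl , refl

  slot-near : ∀ i → near (inject₁ (sb i)) i
  slot-near i = subst (λ x → near x i) (joined i) (near-c i)

  sa-injective : ∀ {i i′} → sa i ≡ sa i′ → i ≡ i′
  sa-injective {i} {i′} e = near-functional (near-a i) (subst (λ x → near (inject₁ x) i′) (sym e) (near-a i′))

  sb-injective : ∀ {i i′} → sb i ≡ sb i′ → i ≡ i′
  sb-injective {i} {i′} e = near-functional (slot-near i) (subst (λ x → near (inject₁ x) i′) (sym e) (slot-near i′))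

  pullback : ∀ (f : Fin u → Fin ℓ′) → (∀ {i i′} → f i ≡ f i′ → i ≡ i′) → # (BL ∘ f) ≤ d
  pullback f inj = begin
    # (BL ∘ f) ≡⟨ sym (length-elems (BL ∘ f)) ⟩
    length (elems (BL ∘ f)) ≡⟨ sym (length-map f (elems (BL ∘ f))) ⟩
    length (map f (elems (BL ∘ f))) ≤⟨ unique-length-≤ (UP.map⁺ inj (elems-unique (BL ∘ f))) (λ m → let i , mi , e = ∈-map⁻ f m in subst (_∈ elems BL) (sym e) (∈-elems⁺ {S = BL} (∈-elems⁻ mi))) ⟩
    length (elems BL) ≡⟨ length-elems BL ⟩
    # BL ≤⟨ BL≤d ⟩
    d ∎
    where open ≤-Reasoning

  -- At most d units have a bad slot in the role of `sa`, and at most d in the role of `sb`.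
  units-many : u ≤ length units + (d + d)
  units-many = begin
    u ≡⟨ sym (length-allFin u) ⟩
    length (allFin u) ≡⟨ sym (*-identityʳ _) ⟩
    length (allFin u) * 1 ≡⟨ sym (∑-const (allFin u) 1) ⟩
    ∑ (allFin u) (λ _ → 1) ≡⟨ sym (#≡∑ (λ _ → true)) ⟩
    # {u} (λ _ → true) ≡⟨ #-∖ (λ _ → true) bad-units ⟩
    # bad-units + # (not ∘ bad-units) ≤⟨ +-monoˡ-≤ _ (≤-trans (m≤m+n _ _) (≤-reflexive (sym (#-∪∩ (BL ∘ sa) (BL ∘ sb))))) ⟩
    # (BL ∘ sa) + # (BL ∘ sb) + # (not ∘ bad-units) ≤⟨ +-monoˡ-≤ _ (+-mono-≤ (pullback sa sa-injective) (pullback sb sb-injective)) ⟩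
    d + d + # (not ∘ bad-units) ≡⟨ +-comm (d + d) _ ⟩
    # (not ∘ bad-units) + (d + d) ≡⟨ cong (_+ (d + d)) (sym (length-elems (not ∘ bad-units))) ⟩
    length units + (d + d) ∎
    where
    open ≤-Reasoning
    bad-units : Fin u → Bool
    bad-units = (BL ∘ sa) ∪ᵇ (BL ∘ sb)

  module ExR = Exclude (FinP._≟_ {ρ})

  pool : List (Fin ρ)
  pool = ExR.exclude (elems (not ∘ Rm)) zs

  pool⁻ : ∀ {t} → t ∈ pool → Rm t ≡ false × t ∉ zs
  pool⁻ m with ExR.exclude-∈ (elems (not ∘ Rm)) zs m
  ... | p , n = not-true (∈-elems⁻ p) , n

  pool-many : # (not ∘ Rm) ≤ length pool + d
  pool-many = subst₂ (λ x y → x ≤ length pool + y) (length-elems (not ∘ Rm)) (trans zs-length e≡d) (ExR.exclude-length zs (elems-unique (not ∘ Rm)))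

  ∈vs₀⁻ : ∀ {t} → inj₂ t ∈ vs₀ → t ∈ zs
  ∈vs₀⁻ m with ∈-++⁻ (tabulate {n = ℓ′} (λ j → inj₁ (inject₁ j))) m
  ... | inj₁ m′ with ∈-tabulate⁻ m′
  ...   | _ , ()
  ∈vs₀⁻ m | inj₂ (there m′) with ∈-map⁻ inj₂ m′
  ... | _ , mt , refl = mt

  bad-slot : Fin ℓ′ → J × J × Block
  bad-slot j = inj₁ (inject₁ j) , inj₁ (suc j) , inj₁ j

  -- The sequence a, f 0, ..., f (n - 1), b as one function, describing the path through the tokens
  -- that closes the row of slots to a cycle.
  around : ∀ n → J → (Fin n → J) → J → Fin (suc (suc n)) → J
  around n a f b zero = a
  around zero a f b (suc i) = b
  around (suc n) a f b (suc i) = around n (f zero) (f ∘ suc) b i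

  link-z : Fin (suc e) → J × J × Block
  link-z i = z (inject₁ i) , z (suc i) , inj₂ i
    where z = around e (inj₁ last) (inj₂ ∘ zf) (inj₁ zero)

  bs₀ : List (J × J × Block)
  bs₀ = map bad-slot (elems BL) ++ tabulate link-z

  bs₀-length : length bs₀ ≤ d + suc d
  bs₀-length = begin
    length bs₀ ≡⟨ length-++ (map bad-slot (elems BL)) ⟩
    length (map bad-slot (elems BL)) + length (tabulate link-z) ≡⟨ cong₂ _+_ (trans (length-map bad-slot (elems BL)) (length-elems BL)) (trans (length-tabulate link-z) (cong suc e≡d)) ⟩
    # BL + suc d ≤⟨ +-monoˡ-≤ (suc d) BL≤d ⟩
    d + suc d ∎
    where open ≤-Reasoning

  plan : Plan B
  plan = record
    { u = u ; b₀ = d + suc d ; sa = sa ; sb = sb ; joined = joined ; near = near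
    ; near-functional = near-functional ; near-a = near-a ; near-c = near-c ; near-b = near-b ; a≢b = a≢b
    ; E₀ = E₀ ; ss₀ = elems (not ∘ BL) ; vs₀ = vs₀ ; vs₀-unique = vs₀-unique ; blocks₀ = blocks₀
    ; units = units ; units-unique = elems-unique _
    ; units-a = λ m → ∈-elems⁺ {S = not ∘ BL} (cong not (proj₁ (unit-slots-good m)))
    ; units-b = λ m → ∈-elems⁺ {S = not ∘ BL} (cong not (proj₂ (unit-slots-good m)))
    ; pool = pool ; pool-unique = ExR.exclude-unique zs (elems-unique _)
    ; pool-disjoint = λ m m′ → proj₂ (pool⁻ m) (∈vs₀⁻ m′) }

  open Plan plan using (Label; slot; done; bad; block; Ok; Cycle; labelList)

  label₀ : Fin ℓ′ → Label
  label₀ j = if BL j then bad (bad-slot j) else slot j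

  open Walks (Ok E₀)

  chain : ∀ n (f : Fin (suc n) → J) (l : Fin n → Label) → (∀ i → Ok E₀ (f (inject₁ i)) (l i) (f (suc i))) →
    Walk (Ok E₀) (f zero) (tabulate (λ i → f (inject₁ i) , l i)) (f (fromℕ n))
  chain zero f l ok = []
  chain (suc n) f l ok = ok zero ∷ chain n (f ∘ suc) (l ∘ suc) (ok ∘ suc)

  start : Cycle bs₀ E₀
  start = record
    { walk = walk-++ walk₁ walk₂
    ; ss = elems (not ∘ BL) ; ds = [] ; cs = []
    ; labels = labels₀
    ; vertices = ↭-reflexive vertices₀
    ; blocks = ↭-reflexive blocks≡
    ; slots = ↭-reflexive (++-identityʳ _)
    ; ds-unique = [] ; ds-pool = λ () ; ds-count = refl ; budget = bs₀-length ; base = id }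
    where
    z = around e (inj₁ last) (inj₂ ∘ zf) (inj₁ zero)
    es₁ es₂ : List (J × Label)
    g₁ : Fin ℓ′ → J × Label
    g₁ j = inj₁ (inject₁ j) , label₀ j
    g₂ : Fin (suc e) → J × Label
    g₂ i = z (inject₁ i) , bad (link-z i)
    es₁ = tabulate g₁
    es₂ = tabulate g₂
    ok₁ : ∀ j → Ok E₀ (inj₁ (inject₁ j)) (label₀ j) (inj₁ (suc j))
    ok₁ j with BL j
    ... | true = inj₁ (refl , refl)
    ... | false = inj₁ (refl , refl)
    walk₁ : Walk (Ok E₀) (inj₁ zero) es₁ (inj₁ last)
    walk₁ = chain ℓ′ inj₁ label₀ ok₁
    around-last : ∀ n a f b → around n a f b (fromℕ (suc n)) ≡ b
    around-last zero a f b = refl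
    around-last (suc n) a f b = around-last n (f zero) (f ∘ suc) b
    walk₂ : Walk (Ok E₀) (inj₁ last) es₂ (inj₁ zero)
    walk₂ = subst (Walk (Ok E₀) (inj₁ last) es₂) (around-last e (inj₁ last) (inj₂ ∘ zf) (inj₁ zero)) (chain (suc e) z (bad ∘ link-z) (λ i → inj₁ (refl , refl)))
    around-vs : ∀ n a f b → tabulate (λ i → around n a f b (inject₁ i)) ≡ a ∷ tabulate f
    around-vs zero a f b = refl
    around-vs (suc n) a f b = cong (a ∷_) (around-vs n (f zero) (f ∘ suc) b)
    open ≡-Reasoning
    vertices₀ : map proj₁ (es₁ ++ es₂) ≡ vs₀
    vertices₀ = begin
      map proj₁ (es₁ ++ es₂) ≡⟨ map-++ proj₁ es₁ es₂ ⟩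
      map proj₁ es₁ ++ map proj₁ es₂ ≡⟨ cong₂ _++_ (map-tabulate g₁ proj₁) (trans (map-tabulate g₂ proj₁) (around-vs e (inj₁ last) (inj₂ ∘ zf) (inj₁ zero))) ⟩
      tabulate (λ j → inj₁ (inject₁ j)) ++ inj₁ last ∷ tabulate (inj₂ ∘ zf)
        ≡⟨ cong (λ ys → tabulate (λ j → inj₁ (inject₁ j)) ++ inj₁ last ∷ ys) (trans (sym (map-tabulate zf inj₂)) (cong (map inj₂) zf≡)) ⟩
      vs₀ ∎
    block-label : ∀ j → block (label₀ j) ≡ inj₁ j
    block-label j with BL j
    ... | true = refl
    ... | false = refl
    blocks≡ : map (block ∘ proj₂) (es₁ ++ es₂) ≡ blocks₀
    blocks≡ = trans (map-++ _ es₁ es₂) (cong₂ _++_ (trans (map-tabulate g₁ (block ∘ proj₂)) (tabulate-cong block-label)) (map-tabulate g₂ (block ∘ proj₂)))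
    partition : ∀ js → map label₀ js ↭ map slot (filter (λ x → not (BL x) ≟ᵇ true) js) ++ map (bad ∘ bad-slot) (filter (λ x → BL x ≟ᵇ true) js)
    partition [] = ↭-refl
    partition (j ∷ js) with BL j
    ... | true = ↭-trans (prep _ (partition js)) (↭-sym (shift _ (map slot (filter (λ x → not (BL x) ≟ᵇ true) js)) _))
    ... | false = prep _ (partition js)
    labels₀ : map proj₂ (es₁ ++ es₂) ↭ labelList (elems (not ∘ BL)) [] bs₀
    labels₀ = ↭-trans (↭-reflexive (begin
        map proj₂ (es₁ ++ es₂) ≡⟨ map-++ proj₂ es₁ es₂ ⟩
        map proj₂ es₁ ++ map proj₂ es₂ ≡⟨ cong₂ _++_ (trans (map-tabulate g₁ proj₂) (sym (map-tabulate id label₀))) (trans (map-tabulate g₂ proj₂) (sym (map-tabulate link-z bad))) ⟩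
        map label₀ (allFin ℓ′) ++ map bad (tabulate link-z) ∎))
      (↭-trans (++⁺ʳ _ (partition (allFin ℓ′))) (↭-reflexive (begin
        (map slot (elems (not ∘ BL)) ++ map (bad ∘ bad-slot) (elems BL)) ++ map bad (tabulate link-z)
          ≡⟨ ++-assoc (map slot (elems (not ∘ BL))) _ _ ⟩
        map slot (elems (not ∘ BL)) ++ map (bad ∘ bad-slot) (elems BL) ++ map bad (tabulate link-z)
          ≡⟨ cong (λ ys → map slot (elems (not ∘ BL)) ++ ys ++ map bad (tabulate link-z)) (map-∘ (elems BL)) ⟩
        map slot (elems (not ∘ BL)) ++ map bad (map bad-slot (elems BL)) ++ map bad (tabulate link-z)
          ≡⟨ cong (map slot (elems (not ∘ BL)) ++_) (sym (map-++ bad (map bad-slot (elems BL)) _)) ⟩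
        labelList (elems (not ∘ BL)) [] bs₀ ∎)))

module Closing {B : Board} (Lay : Layout (Board.dims B)) (w : List (Fin (Board.ℓ′ B) × Fin (Board.ρ B)))
  (K : Core w (Layout.d Lay) (Layout.k Lay) (Layout.Lm Lay) (Layout.Rm Lay))
  (expanding : Expanding (Layout.d Lay) (Layout.k Lay) (Layout.q Lay) w) (E₀ : List (Board.Edge B))
  (recorded : ∀ {j : Fin (Board.ℓ′ B)} {t : Fin (Board.ρ B)} → (j , t) ∈ w → Board.edge B (inj₁ (suc j)) t (inj₁ (inject₁ j)) (inj₁ j) ∈ E₀) where
  open Board B
  open Layout Lay
  open Opening {B} Lay w K E₀
  open Core K
  open Hits w
  open Expanding expanding
  open Plan plan using (Label; slot; done; bad; block; Ok; Cycle; labelList; cutSlot)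

  module _ {E : List Edge} (Γ : Cycle [] E) where
    open Cycle Γ

    ss-good : ∀ {j} → j ∈ ss → BL j ≡ false
    ss-good m = not-true (∈-elems⁻ (∈-resp-↭ slots (∈-++⁺ˡ m)))

    ss-unique : Unique ss
    ss-unique = Unique-++ˡ ss (Unique-resp-↭ (↭-sym slots) (elems-unique _))

    -- Moves cut only unit slots, and no unit slot is main; so every good main slot is still waiting
    -- for a token.
    main-slot : ∀ {j} → Lm j ≡ true → BL j ≡ false → j ∈ ss
    main-slot {j} lm good with ∈-++⁻ ss (∈-resp-↭ (↭-sym slots) (∈-elems⁺ {S = not ∘ BL} (cong not good)))
    ... | inj₁ m = m
    ... | inj₂ m with ∈-map⁻ cutSlot m
    ...   | (i , true) , _ , refl = true≢false lm (Lm-a i)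
    ...   | (i , false) , _ , refl = true≢false lm (Lm-b i)

    dt : List (Fin ρ)
    dt = map proj₁ ds

    used-unique : Unique (zs ++ dt)
    used-unique = UP.++⁺ zs-unique ds-unique (λ { (m , m′) → proj₂ (pool⁻ (ds-pool m′)) m })

    free : List (Fin ρ)
    free = proj₁ (unique-⊆⇒↭ {ys = allFin ρ} used-unique (λ _ → ∈-allFin _))

    all-tokens : allFin ρ ↭ (zs ++ dt) ++ free
    all-tokens = proj₂ (unique-⊆⇒↭ {ys = allFin ρ} used-unique (λ _ → ∈-allFin _))

    all-unique : Unique ((zs ++ dt) ++ free)
    all-unique = Unique-resp-↭ all-tokens (UP.allFin⁺ ρ)

    free-unique : Unique free
    free-unique = Unique-++ʳ (zs ++ dt) all-unique

    free⁻ : ∀ {t} → t ∈ free → t ∉ zs × t ∉ dt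
    free⁻ m = (λ k → Unique-disj (zs ++ dt) all-unique (∈-++⁺ˡ k) m) , (λ k → Unique-disj (zs ++ dt) all-unique (∈-++⁺ʳ zs k) m)

    free⁺ : ∀ {t} → t ∉ zs → t ∉ dt → t ∈ free
    free⁺ n n′ with ∈-++⁻ (zs ++ dt) (∈-resp-↭ all-tokens (∈-allFin _))
    ... | inj₂ m = m
    ... | inj₁ m with ∈-++⁻ zs m
    ...   | inj₁ k = ⊥-elim (n k)
    ...   | inj₂ k = ⊥-elim (n′ k)

    es-length : length es ≡ suc ℓ′ + e
    es-length = begin
      length es ≡⟨ sym (length-map proj₁ es) ⟩
      length (map proj₁ es) ≡⟨ ↭-length vertices ⟩
      length vs₀ ≡⟨ length-++ (tabulate {n = ℓ′} (λ j → inj₁ (inject₁ j))) ⟩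
      length (tabulate {n = ℓ′} (λ j → inj₁ {B = Fin ρ} (inject₁ j))) + suc (length (map inj₂ zs))
        ≡⟨ cong₂ (λ x y → x + suc y) (length-tabulate _) (trans (length-map inj₂ zs) zs-length) ⟩
      ℓ′ + suc e ≡⟨ +-suc ℓ′ e ⟩
      suc ℓ′ + e ∎
      where open ≡-Reasoning

    es-length′ : length es ≡ length ss + length dt
    es-length′ = begin
      length es ≡⟨ sym (length-map proj₂ es) ⟩
      length (map proj₂ es) ≡⟨ ↭-length labels ⟩
      length (labelList ss ds []) ≡⟨ length-++ (map slot ss) ⟩
      length (map slot ss) + length (map done ds ++ [])
        ≡⟨ cong₂ _+_ (length-map slot ss) (trans (cong length (++-identityʳ (map done ds))) (trans (length-map done ds) (sym (length-map proj₁ ds)))) ⟩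
      length ss + length dt ∎
      where open ≡-Reasoning

    -- The cycle has suc ℓ′ + e links, each needing one token, and e further tokens serve as
    -- junctions; ρ is exactly this total. Hence as many tokens are free as slots lack one.
    free-length : length free ≡ length ss
    free-length = +-cancelˡ-≡ (e + length dt) _ _ (begin
      e + length dt + length free ≡⟨ cong (λ z → z + length dt + length free) (sym zs-length) ⟩
      length zs + length dt + length free ≡⟨ cong (_+ length free) (sym (length-++ zs)) ⟩
      length (zs ++ dt) + length free ≡⟨ sym (length-++ (zs ++ dt)) ⟩
      length ((zs ++ dt) ++ free) ≡⟨ sym (↭-length all-tokens) ⟩
      length (allFin ρ) ≡⟨ length-allFin ρ ⟩
      ρ ≡⟨ ρ≡ ⟩
      suc ℓ′ + e + e ≡⟨ cong (_+ e) (trans (sym es-length) es-length′) ⟩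
      length ss + length dt + e ≡⟨ lem (length ss) (length dt) e ⟩
      e + length dt + length ss ∎)
      where open ≡-Reasoning
            lem : ∀ a b c → a + b + c ≡ c + b + a
            lem = solve-∀

    P : Fin ℓ′ → Bool
    P = memb ss

    open Hall {ℓ′} {ρ} P

    Ed : Rel
    Ed j t = memb free t ∧ (1 ≤ᵇ hits w (_== j) (_== t))

    Ed⁺ : ∀ {j t} → (j , t) ∈ w → t ∈ free → Ed j t ≡ true
    Ed⁺ {j} {t} m f = ∧-intro (memb⁺ f) (T-≡ .Equivalence.to
      (≤⇒≤ᵇ (∈⇒hits {_== j} {_== t} m (==-refl j) (==-refl t))))

    Ed⁻ : ∀ {j t} → Ed j t ≡ true → (j , t) ∈ w × t ∈ free
    Ed⁻ {j} {t} h with ∧-true {memb free t} h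
    ... | f , p with hits-∈ {_== j} {_== t} (≤ᵇ⇒≤ 1 _ (T-≡ .Equivalence.from p))
    ...   | j′ , t′ , m , ej , et = subst₂ (λ x y → (x , y) ∈ w) (==⇒≡ ej) (==⇒≡ et) m , memb⁻ f

    BR⊆zs : ∀ {t} → BR t ≡ true → t ∈ zs
    BR⊆zs p = ∈-++⁺ˡ (∈-elems⁺ {S = BR} p)

    main-token : ∀ {t} → Rm t ≡ true → BR t ≡ false → t ∈ free
    main-token {t} r good = free⁺ not-z (λ m → true≢false r (proj₁ (pool⁻ (ds-pool m))))
      where
      not-z : t ∉ zs
      not-z m with ∈-++⁻ (elems BR) m
      ... | inj₁ k = true≢false (∈-elems⁻ k) good
      ... | inj₂ k = true≢false r (proj₁ (padding⁻ k))

    -- A small violating S is too dense; for a large one the few tokens that S misses are too dense together with P ∖ S.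
    hall : HallCond Ed
    hall S S⊑P = ≮⇒≥ λ lt → violation lt (# S ≤? d)
      where
      open ≤-Reasoning
      free-good : ∀ {t} → t ∈ free → BR t ≡ false
      free-good {t} m with bool-cases (BR t)
      ... | inj₁ p = ⊥-elim (proj₁ (free⁻ m) (BR⊆zs p))
      ... | inj₂ p = p
      violation : # (Nb Ed S) < # S → Dec (# S ≤ d) → ⊥
      violation lt (yes S≤d) = <-irrefl refl (begin-strict
        hits w S (Nb Ed S) <⟨ sparse (# S) (≤-trans (s≤s z≤n) lt) S≤d S (Nb Ed S) ≤-refl (<⇒≤ lt) ⟩
        k * # S ≤⟨ degree-sumˡ k {S} {Rm ∖ᵇ BR} (λ j s → slots-stable j (ss-good (memb⁻ (S⊑P j s)))) ⟩
        hits w S (Rm ∖ᵇ BR) ≤⟨ hits-mono-∈ {S} {S} {Rm ∖ᵇ BR} {Nb Ed S} (λ {j} {t} m s r → s , Nb⁺ {Ed} {S} s (Ed⁺ m (let r₁ , r₂ = ∧-true {Rm t} r in main-token r₁ (not-true r₂)))) ⟩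
        hits w S (Nb Ed S) ∎)
      violation lt (no S≰d) = <-irrefl refl (begin-strict
        hits w (P ∖ᵇ S) T′ <⟨ sparse (# T′) (≤-trans (s≤s z≤n) T′-large) T′-small (P ∖ᵇ S) T′ (<⇒≤ T′-large) ≤-refl ⟩
        k * # T′ ≤⟨ degree-sumʳ w k {Lm ∖ᵇ BL} {T′} (λ t h → tokens-stable t (free-good (memb⁻ (proj₁ (∧-true {memb free t} h))))) ⟩
        hits w (Lm ∖ᵇ BL) T′ ≤⟨ hits-mono-∈ {Lm ∖ᵇ BL} {P ∖ᵇ S} {T′} {T′} back ⟩
        hits w (P ∖ᵇ S) T′ ∎)
        where
        T′ : Fin ρ → Bool
        T′ = memb free ∖ᵇ Nb Ed S
        no-edge : ∀ {j t} → (j , t) ∈ w → S j ≡ true → T′ t ≡ true → ∀ {Y : Set} → Y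
        no-edge {j} {t} m s h with ∧-true {memb free t} h
        ... | f , n = true≢false (Nb⁺ {Ed} {S} s (Ed⁺ m (memb⁻ f))) (not-true n)
        -- Otherwise S and T′, both larger than d, would be joined by an edge, while T′ consists of
        -- tokens that S misses.
        T′-small : # T′ ≤ d
        T′-small = ≮⇒≥ λ large → <-irrefl refl (≤-trans (meets S T′ (<⇒≤ (≰⇒> S≰d)) (<⇒≤ large)) (≤-reflexive (hits-none {S} {T′} (λ m s h → no-edge m s h))))
        T′-large : # (P ∖ᵇ S) < # T′
        T′-large = +-cancelˡ-< (# S) _ _ (begin-strict
          # S + # (P ∖ᵇ S) ≤⟨ +-monoˡ-≤ _ (#-mono (λ j s → ∧-intro (S⊑P j s) s)) ⟩
          # (P ∩ᵇ S) + # (P ∖ᵇ S) ≡⟨ sym (#-∖ P S) ⟩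
          # P ≡⟨ trans (#-memb ss-unique) (trans (sym free-length) (sym (#-memb free-unique))) ⟩
          # (memb free) ≡⟨ #-∖ (memb free) (Nb Ed S) ⟩
          # (memb free ∩ᵇ Nb Ed S) + # T′ ≤⟨ +-monoˡ-≤ _ (#-mono (λ t h → proj₂ (∧-true {memb free t} h))) ⟩
          # (Nb Ed S) + # T′ <⟨ +-monoˡ-< _ lt ⟩
          # S + # T′ ∎)
        back : ∀ {j t} → (j , t) ∈ w → (Lm ∖ᵇ BL) j ≡ true → T′ t ≡ true → (P ∖ᵇ S) j ≡ true × T′ t ≡ true
        back {j} {t} m l h = decide (∧-true {Lm j} l) (bool-cases (S j))
          where
          decide : Lm j ≡ true × not (BL j) ≡ true → S j ≡ true ⊎ S j ≡ false → (P ∖ᵇ S) j ≡ true × T′ t ≡ true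
          decide _ (inj₁ s) = no-edge m s h
          decide (l₁ , l₂) (inj₂ s) = ∧-intro (memb⁺ (main-slot l₁ (not-true l₂))) (cong not s) , h

    open Matching (hall-matching Ed hall)

    partner : Fin ℓ′ → Fin ρ
    partner j with FinP.any? (λ t → M j t ≟ᵇ true)
    ... | yes (t , _) = t
    ... | no _ = t₀

    partner-M : ∀ {j} → j ∈ ss → M j (partner j) ≡ true
    partner-M {j} m with FinP.any? (λ t → M j t ≟ᵇ true)
    ... | yes (t , h) = h
    ... | no none = ⊥-elim (none (total (memb⁺ m)))

    relabel : Label → Fin ρ × Block
    relabel (slot j) = partner j , inj₁ j
    relabel (done x) = x
    -- A default value: no missing link is left on this cycle.
    relabel (bad (p , q , β)) = t₀ , β

    relabel-block : ∀ {l} → l ∈ labelList ss ds [] → proj₂ (relabel l) ≡ block l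
    relabel-block {slot j} m = refl
    relabel-block {done x} m = refl
    relabel-block {bad b} m = refl

    slot-edge : ∀ {j} → j ∈ ss → edge (inj₁ (suc j)) (partner j) (inj₁ (inject₁ j)) (inj₁ j) ∈ E
    slot-edge mj = base (recorded (proj₁ (Ed⁻ (M⊆E (partner-M mj)))))

    slot-link : ∀ {v j z t} → edge (inj₁ (suc j)) t (inj₁ (inject₁ j)) (inj₁ j) ∈ E → Ok E v (slot j) z → Linked E v (t , inj₁ j) z
    slot-link ε∈ (inj₁ (refl , refl)) = subst (_∈ E) (edge-sym _ _ _ _) ε∈
    slot-link ε∈ (inj₂ (refl , refl)) = ε∈

    link : ∀ {v l z} → l ∈ labelList ss ds [] → Ok E v l z → Linked E v (relabel l) z
    link {l = slot j} m ok with ∈-++⁻ (map slot ss) m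
    link {v} {slot j} {z} m ok | inj₁ k with ∈-map⁻ slot k
    ... | .j , mj , refl = slot-link (slot-edge mj) ok
    link {l = slot j} m ok | inj₂ k with ∈-++⁻ (map done ds) k
    ... | inj₁ k′ with ∈-map⁻ done k′
    ...   | _ , _ , ()
    link {l = done x} m ok = ok
    link {l = bad b} m ok with ∈-++⁻ (map slot ss) m
    ... | inj₁ k with ∈-map⁻ slot k
    ...   | _ , _ , ()
    link {l = bad b} m ok | inj₂ k with ∈-++⁻ (map done ds) k
    ... | inj₁ k′ with ∈-map⁻ done k′
    ...   | _ , _ , ()

    relabelled : List (J × Fin ρ × Block)
    relabelled = map (λ o → proj₁ o , relabel (proj₂ o)) es

    walk-relabel : ∀ {u fs z} → Walk (Ok E) u fs z → (∀ {l} → l ∈ map proj₂ fs → l ∈ labelList ss ds []) →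
      Walk (Linked E) u (map (λ o → proj₁ o , relabel (proj₂ o)) fs) z
    walk-relabel [] h = []
    walk-relabel (ok ∷ wk) h = link (h (here refl)) ok ∷ walk-relabel wk (h ∘ there)

    tokens : map (proj₁ ∘ proj₂) relabelled ↭ map partner ss ++ dt
    tokens = begin
      map (proj₁ ∘ proj₂) relabelled ≡⟨ sym (map-∘ es) ⟩
      map (proj₁ ∘ relabel ∘ proj₂) es ≡⟨ map-∘ es ⟩
      map (proj₁ ∘ relabel) (map proj₂ es) ↭⟨ map⁺ (proj₁ ∘ relabel) labels ⟩
      map (proj₁ ∘ relabel) (map slot ss ++ map done ds ++ []) ≡⟨ cong (λ ys → map (proj₁ ∘ relabel) (map slot ss ++ ys)) (++-identityʳ (map done ds)) ⟩
      map (proj₁ ∘ relabel) (map slot ss ++ map done ds) ≡⟨ map-++ (proj₁ ∘ relabel) (map slot ss) (map done ds) ⟩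
      map (proj₁ ∘ relabel) (map slot ss) ++ map (proj₁ ∘ relabel) (map done ds)
        ≡⟨ cong₂ _++_ (sym (map-∘ ss)) (sym (map-∘ ds)) ⟩
      map partner ss ++ dt ∎
      where open PermutationReasoning

    partner-free : ∀ {t} → t ∈ map partner ss → t ∈ free
    partner-free m = unpack (∈-map⁻ partner m)
      where
      unpack : ∀ {t} → (∃ λ j → j ∈ ss × t ≡ partner j) → t ∈ free
      unpack (j , mj , refl) = proj₂ (Ed⁻ (M⊆E (partner-M mj)))

    partners-unique : ∀ {js} → Unique js → (∀ {j} → j ∈ js → j ∈ ss) → Unique (map partner js)
    partners-unique [] h = []
    partners-unique {j ∷ js} (j∉ ∷ u) h = AllP.¬Any⇒All¬ _ new ∷ partners-unique u (h ∘ there)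
      where
      new : partner j ∉ map partner js
      new m = clash (∈-map⁻ partner m)
        where
        clash : ¬ (∃ λ j′ → j′ ∈ js × partner j ≡ partner j′)
        clash (j′ , m′ , eq) = All.lookup j∉ m′ (injective (memb⁺ (h (here refl))) (memb⁺ (h (there m′)))
          (partner-M (h (here refl))) (subst (λ t → M j′ t ≡ true) (sym eq) (partner-M (h (there m′)))))

    ham : HamCycle B E
    ham = record
      { walk = walk-relabel walk (∈-resp-↭ labels)
      ; size = trans (length-map _ es) es-length
      ; junctions-unique = subst Unique (map-∘ es) (Unique-resp-↭ (↭-sym vertices) vs₀-unique)
      ; tokens-unique = Unique-resp-↭ (↭-sym tokens) (UP.++⁺ (partners-unique ss-unique id) ds-unique (λ { (m , m′) → proj₂ (free⁻ (partner-free m)) m′ }))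
      ; blocks-unique = subst Unique (trans same-blocks (map-∘ es)) (Unique-resp-↭ (↭-sym blocks) blocks₀-unique)
      ; disjoint = λ m m′ → disj (∈-resp-↭ tokens m) (∈vs₀⁻ (∈-resp-↭ vertices (subst (_ ∈_) (sym (map-∘ es)) m′))) }
      where
      disj : ∀ {t} → t ∈ map partner ss ++ dt → t ∉ zs
      disj m k with ∈-++⁻ (map partner ss) m
      ... | inj₁ m₁ = proj₁ (free⁻ (partner-free m₁)) k
      ... | inj₂ m₂ = proj₂ (pool⁻ (ds-pool m₂)) k
      same-blocks : map (block ∘ proj₂) es ≡ map (proj₂ ∘ relabel ∘ proj₂) es
      same-blocks = go es (∈-resp-↭ labels)
        where
        go : ∀ fs → (∀ {l} → l ∈ map proj₂ fs → l ∈ labelList ss ds []) → map (block ∘ proj₂) fs ≡ map (proj₂ ∘ relabel ∘ proj₂) fs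
        go [] h = refl
        go (o ∷ fs) h = cong₂ _∷_ (sym (relabel-block (h (here refl)))) (go fs (h ∘ there))

-- First-moment bounds for the random phase

pairs : ∀ a b → List (Fin a × Fin b)
pairs a b = concatMap (λ j → map (j ,_) (allFin b)) (allFin a)

∑-pairs : ∀ a b (f : Fin a × Fin b → ℕ) → ∑ (pairs a b) f ≡ ∑ (allFin a) (λ j → ∑ (allFin b) (λ t → f (j , t)))
∑-pairs a b f = trans (∑-concatMap _ (allFin a) f) (∑-cong (allFin a) (λ j → ∑-map (j ,_) (allFin b) f))

length-pairs : ∀ a b → length (pairs a b) ≡ a * b
length-pairs a b = begin
  length (pairs a b) ≡⟨ sym (*-identityʳ _) ⟩
  length (pairs a b) * 1 ≡⟨ sym (∑-const (pairs a b) 1) ⟩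
  ∑ (pairs a b) (λ _ → 1) ≡⟨ ∑-pairs a b _ ⟩
  ∑ (allFin a) (λ j → ∑ (allFin b) (λ t → 1)) ≡⟨ ∑-cong (allFin a) (λ j → trans (∑-const (allFin b) 1) (trans (*-identityʳ _) (length-allFin b))) ⟩
  ∑ (allFin a) (λ j → b) ≡⟨ trans (∑-const (allFin a) b) (cong (_* b) (length-allFin a)) ⟩
  a * b ∎
  where open ≡-Reasoning

rect : ∀ {a b} → (Fin a → Bool) → (Fin b → Bool) → Fin a × Fin b → Bool
rect S T o = S (proj₁ o) ∧ T (proj₂ o)

∧-⟦⟧ : ∀ x y → ⟦ x ∧ y ⟧ ≡ ⟦ x ⟧ * ⟦ y ⟧
∧-⟦⟧ true y = sym (+-identityʳ ⟦ y ⟧)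
∧-⟦⟧ false y = refl

∑-rect : ∀ {a b} (S : Fin a → Bool) (T : Fin b → Bool) → ∑ (pairs a b) (⟦_⟧ ∘ rect S T) ≡ # S * # T
∑-rect {a} {b} S T = begin
  ∑ (pairs a b) (⟦_⟧ ∘ rect S T) ≡⟨ ∑-pairs a b _ ⟩
  ∑ (allFin a) (λ j → ∑ (allFin b) (λ t → ⟦ S j ∧ T t ⟧))
    ≡⟨ ∑-cong (allFin a) (λ j → trans (∑-cong (allFin b) (λ t → ∧-⟦⟧ (S j) (T t))) (trans (∑-*ˡ (allFin b) ⟦ S j ⟧ _) (cong (⟦ S j ⟧ *_) (sym (#≡∑ T))))) ⟩
  ∑ (allFin a) (λ j → ⟦ S j ⟧ * # T) ≡⟨ trans (∑-*ʳ (allFin a) (# T) _) (cong (_* # T) (sym (#≡∑ S))) ⟩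
  # S * # T ∎
  where open ≡-Reasoning

⟦⟧*-mono : ∀ b {x y} → (b ≡ true → x ≤ y) → ⟦ b ⟧ * x ≤ ⟦ b ⟧ * y
⟦⟧*-mono true h = *-monoʳ-≤ 1 (h refl)
⟦⟧*-mono false h = z≤n

≤ᵇ-true : ∀ {m n} → (m ≤ᵇ n) ≡ true → m ≤ n
≤ᵇ-true e = ≤ᵇ⇒≤ _ _ (T-≡ .Equivalence.from e)

true-≤ᵇ : ∀ {m n} → m ≤ n → (m ≤ᵇ n) ≡ true
true-≤ᵇ h = T-≡ .Equivalence.to (≤⇒≤ᵇ h)

true-<ᵇ : ∀ {m n} → m < n → (m <ᵇ n) ≡ true
true-<ᵇ h = T-≡ .Equivalence.to (<⇒<ᵇ h)

module RandomPhase (a b r : ℕ) where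
  open Sequences (pairs a b) r

  N : ℕ
  N = length (pairs a b) + r

  -- Counting violating pairs of sets, instead of deciding whether one exists, makes the union bound
  -- an instance of the linearity of `Ex`. The value 0 means that no violation occurs.
  overfull : ℕ → ℕ → List (Fin a × Fin b) → ℕ
  overfull h i w = ∑ (subsetsOf a) (λ S → ∑ (subsetsOf b) (λ T → ⟦ # S ≤ᵇ i ⟧ * (⟦ # T ≤ᵇ i ⟧ * ⟦ h ≤ᵇ hits w S T ⟧)))

  underfull : ℕ → ℕ → List (Fin a × Fin b) → ℕ
  underfull α h w = ∑ (subsetsOf a) (λ S → ∑ (subsetsOf b) (λ T → ⟦ α ≤ᵇ # S * # T ⟧ * ⟦ hits w S T <ᵇ h ⟧))

  cover-hits : ∀ (w : List (Fin a × Fin b)) S S′ T T′ → (∀ j → S′ j ≡ S j) → (∀ t → T′ t ≡ T t) → hits w S′ T′ ≡ hits w S T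
  cover-hits w S S′ T T′ h k = ∑-cong w (λ o → cong₂ (λ x y → ⟦ x ∧ y ⟧) (h (proj₁ o)) (k (proj₂ o)))

  1≢0 : ¬ (1 ≡ 0)
  1≢0 ()

  overfull-zero : ∀ {h i w} → overfull h i w ≡ 0 → ∀ S T → # S ≤ i → # T ≤ i → hits w S T < h
  overfull-zero {h} {i} {w} z S T S≤ T≤ with subsetsOf-complete S | subsetsOf-complete T
  ... | S′ , mS , eS | T′ , mT , eT = ≰⇒> λ le → 1≢0 (trans (sym (one le)) (∑-zero _ (∑-zero _ z mS) mT))
    where
    one : h ≤ hits w S T → ⟦ # S′ ≤ᵇ i ⟧ * (⟦ # T′ ≤ᵇ i ⟧ * ⟦ h ≤ᵇ hits w S′ T′ ⟧) ≡ 1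
    one le = cong₂ _*_ (cong ⟦_⟧ (true-≤ᵇ (subst (_≤ i) (sym (#-cong eS)) S≤)))
      (cong₂ _*_ (cong ⟦_⟧ (true-≤ᵇ (subst (_≤ i) (sym (#-cong eT)) T≤)))
                 (cong ⟦_⟧ (true-≤ᵇ (subst (h ≤_) (sym (cover-hits w S S′ T T′ eS eT)) le))))

  underfull-zero : ∀ {α h w} → underfull α h w ≡ 0 → ∀ S T → α ≤ # S * # T → h ≤ hits w S T
  underfull-zero {α} {h} {w} z S T large with subsetsOf-complete S | subsetsOf-complete T
  ... | S′ , mS , eS | T′ , mT , eT = ≮⇒≥ λ lt → 1≢0 (trans (sym (one lt)) (∑-zero _ (∑-zero _ z mS) mT))
    where
    one : hits w S T < h → ⟦ α ≤ᵇ # S′ * # T′ ⟧ * ⟦ hits w S′ T′ <ᵇ h ⟧ ≡ 1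
    one lt = cong₂ _*_ (cong ⟦_⟧ (true-≤ᵇ (subst (α ≤_) (sym (cong₂ _*_ (#-cong eS) (#-cong eT))) large)))
      (cong ⟦_⟧ (true-<ᵇ (subst (_< h) (sym (cover-hits w S S′ T T′ eS eT)) lt)))

  Ex-∑∑ : ∀ M (φ : (Fin a → Bool) → (Fin b → Bool) → List (Fin a × Fin b) → ℕ) →
    Ex M (λ w → ∑ (subsetsOf a) (λ S → ∑ (subsetsOf b) (λ T → φ S T w))) ≡ ∑ (subsetsOf a) (λ S → ∑ (subsetsOf b) (λ T → Ex M (φ S T)))
  Ex-∑∑ M φ = trans (Ex-∑ M (subsetsOf a) _) (∑-cong (subsetsOf a) (λ S → Ex-∑ M (subsetsOf b) (φ S)))

  scale : ∀ c (φ : (Fin a → Bool) → (Fin b → Bool) → ℕ) →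
    c * ∑ (subsetsOf a) (λ S → ∑ (subsetsOf b) (φ S)) ≡ ∑ (subsetsOf a) (λ S → ∑ (subsetsOf b) (λ T → c * φ S T))
  scale c φ = trans (sym (∑-*ˡ (subsetsOf a) c (λ S → ∑ (subsetsOf b) (φ S)))) (∑-cong (subsetsOf a) (λ S → sym (∑-*ˡ (subsetsOf b) c (φ S))))

  -- For fixed S and T the number of hits is binomial with at most i * i favourable outcomes out of
  -- N; `U-bound` is summed over the pairs of small sets.
  overfull-bound : ∀ M h i → h ! * N ^ h * Ex M (overfull h i) ≤ small a i * small b i * ((M * (i * i)) ^ h * N ^ M)
  overfull-bound M h i = begin
    h ! * N ^ h * Ex M (overfull h i) ≡⟨ cong (h ! * N ^ h *_) (Ex-∑∑ M _) ⟩
    h ! * N ^ h * ∑ (subsetsOf a) (λ S → ∑ (subsetsOf b) (λ T → Ex M (λ w → ⟦ # S ≤ᵇ i ⟧ * (⟦ # T ≤ᵇ i ⟧ * ⟦ h ≤ᵇ hits w S T ⟧))))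
      ≡⟨ scale (h ! * N ^ h) (λ S T → Ex M (λ w → ⟦ # S ≤ᵇ i ⟧ * (⟦ # T ≤ᵇ i ⟧ * ⟦ h ≤ᵇ hits w S T ⟧))) ⟩
    ∑ (subsetsOf a) (λ S → ∑ (subsetsOf b) (λ T → h ! * N ^ h * Ex M (λ w → ⟦ # S ≤ᵇ i ⟧ * (⟦ # T ≤ᵇ i ⟧ * ⟦ h ≤ᵇ hits w S T ⟧))))
      ≤⟨ ∑-mono (subsetsOf a) (λ S → ∑-mono (subsetsOf b) (λ T → each S T)) ⟩
    ∑ (subsetsOf a) (λ S → ∑ (subsetsOf b) (λ T → ⟦ # S ≤ᵇ i ⟧ * (⟦ # T ≤ᵇ i ⟧ * Y)))
      ≡⟨ ∑-cong (subsetsOf a) (λ S → trans (∑-*ˡ (subsetsOf b) ⟦ # S ≤ᵇ i ⟧ _) (cong (⟦ # S ≤ᵇ i ⟧ *_) (∑-*ʳ (subsetsOf b) Y _))) ⟩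
    ∑ (subsetsOf a) (λ S → ⟦ # S ≤ᵇ i ⟧ * (small b i * Y)) ≡⟨ ∑-*ʳ (subsetsOf a) (small b i * Y) _ ⟩
    small a i * (small b i * Y) ≡⟨ sym (*-assoc (small a i) (small b i) Y) ⟩
    small a i * small b i * Y ∎
    where
    open ≤-Reasoning
    Y : ℕ
    Y = (M * (i * i)) ^ h * N ^ M
    each : ∀ S T → h ! * N ^ h * Ex M (λ w → ⟦ # S ≤ᵇ i ⟧ * (⟦ # T ≤ᵇ i ⟧ * ⟦ h ≤ᵇ hits w S T ⟧)) ≤ ⟦ # S ≤ᵇ i ⟧ * (⟦ # T ≤ᵇ i ⟧ * Y)
    each S T = begin
      h ! * N ^ h * Ex M (λ w → ⟦ # S ≤ᵇ i ⟧ * (⟦ # T ≤ᵇ i ⟧ * ⟦ h ≤ᵇ hits w S T ⟧))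
        ≡⟨ cong (h ! * N ^ h *_) (trans (Ex-*ˡ M ⟦ # S ≤ᵇ i ⟧ _) (cong (⟦ # S ≤ᵇ i ⟧ *_) (Ex-*ˡ M ⟦ # T ≤ᵇ i ⟧ _))) ⟩
      h ! * N ^ h * (⟦ # S ≤ᵇ i ⟧ * (⟦ # T ≤ᵇ i ⟧ * Ex M (λ w → ⟦ h ≤ᵇ hits w S T ⟧)))
        ≡⟨ lem (h ! * N ^ h) ⟦ # S ≤ᵇ i ⟧ ⟦ # T ≤ᵇ i ⟧ _ ⟩
      ⟦ # S ≤ᵇ i ⟧ * (⟦ # T ≤ᵇ i ⟧ * (h ! * N ^ h * Ex M (λ w → ⟦ h ≤ᵇ hits w S T ⟧)))
        ≤⟨ ⟦⟧*-mono (# S ≤ᵇ i) (λ p → ⟦⟧*-mono (# T ≤ᵇ i) (λ q → core-bound (≤ᵇ-true p) (≤ᵇ-true q))) ⟩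
      ⟦ # S ≤ᵇ i ⟧ * (⟦ # T ≤ᵇ i ⟧ * Y) ∎
      where
      lem : ∀ h s t x → h * (s * (t * x)) ≡ s * (t * (h * x))
      lem = solve-∀
      core-bound : # S ≤ i → # T ≤ i → h ! * N ^ h * Ex M (λ w → ⟦ h ≤ᵇ hits w S T ⟧) ≤ Y
      core-bound S≤ T≤ = begin
        h ! * N ^ h * Ex M (λ w → ⟦ h ≤ᵇ hits w S T ⟧) ≡⟨ cong₂ (λ x y → h ! * x ^ h * y) (sym (hit+miss (rect S T))) (Ex-upper (rect S T) M h) ⟩
        h ! * (α + γ) ^ h * U α γ M h ≤⟨ U-bound α γ M h ⟩
        (M * α) ^ h * (α + γ) ^ M ≡⟨ cong₂ (λ x y → (M * x) ^ h * y ^ M) (∑-rect S T) (hit+miss (rect S T)) ⟩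
        (M * (# S * # T)) ^ h * N ^ M ≤⟨ *-monoˡ-≤ (N ^ M) (^-monoˡ-≤ h (*-monoʳ-≤ M (*-mono-≤ S≤ T≤))) ⟩
        Y ∎
        where
        α = hit (rect S T)
        γ = miss (rect S T)

  -- There are 2^(a+b) pairs of sets, so each single tail must beat this factor too: `G-tail` is
  -- used with exponent a + b + κ.
  underfull-bound : ∀ M α h q κ → 1 ≤ α → 2 * N ≤ q * α → q * (h + (a + b + κ)) ≤ M → 2 ^ κ * Ex M (underfull α h) ≤ N ^ M
  underfull-bound M α h q κ α>0 2N≤ M-large = *-cancelˡ-≤ (2 ^ (a + b)) {{m^n≢0 2 (a + b)}} (begin
    2 ^ (a + b) * (2 ^ κ * Ex M (underfull α h)) ≡⟨ trans (sym (*-assoc (2 ^ (a + b)) _ _)) (cong (_* Ex M (underfull α h)) (sym (^-distribˡ-+-* 2 (a + b) κ))) ⟩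
    c₀ * Ex M (underfull α h) ≡⟨ cong (c₀ *_) (Ex-∑∑ M _) ⟩
    c₀ * ∑ (subsetsOf a) (λ S → ∑ (subsetsOf b) (λ T → Ex M (λ w → ⟦ α ≤ᵇ # S * # T ⟧ * ⟦ hits w S T <ᵇ h ⟧)))
      ≡⟨ scale c₀ (λ S T → Ex M (λ w → ⟦ α ≤ᵇ # S * # T ⟧ * ⟦ hits w S T <ᵇ h ⟧)) ⟩
    ∑ (subsetsOf a) (λ S → ∑ (subsetsOf b) (λ T → c₀ * Ex M (λ w → ⟦ α ≤ᵇ # S * # T ⟧ * ⟦ hits w S T <ᵇ h ⟧)))
      ≤⟨ ∑-mono (subsetsOf a) (λ S → ∑-mono (subsetsOf b) (λ T → each S T)) ⟩
    ∑ (subsetsOf a) (λ S → ∑ (subsetsOf b) (λ T → N ^ M)) ≡⟨ ∑-cong (subsetsOf a) (λ S → trans (∑-const (subsetsOf b) _) (cong (_* N ^ M) (length-subsetsOf b))) ⟩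
    ∑ (subsetsOf a) (λ S → 2 ^ b * N ^ M) ≡⟨ trans (∑-const (subsetsOf a) _) (cong (_* (2 ^ b * N ^ M)) (length-subsetsOf a)) ⟩
    2 ^ a * (2 ^ b * N ^ M) ≡⟨ trans (sym (*-assoc (2 ^ a) _ _)) (cong (_* N ^ M) (sym (^-distribˡ-+-* 2 a b))) ⟩
    2 ^ (a + b) * N ^ M ∎)
    where
    open ≤-Reasoning
    c₀ : ℕ
    c₀ = 2 ^ (a + b + κ)
    each : ∀ S T → c₀ * Ex M (λ w → ⟦ α ≤ᵇ # S * # T ⟧ * ⟦ hits w S T <ᵇ h ⟧) ≤ N ^ M
    each S T with bool-cases (α ≤ᵇ # S * # T)
    ... | inj₂ no-α = ≤-trans (≤-reflexive (trans (cong (c₀ *_) (trans (Ex-cong M (λ w → cong (λ z → ⟦ z ⟧ * ⟦ hits w S T <ᵇ h ⟧) no-α)) (trans (Ex-const M 0) (*-zeroʳ (N ^ M))))) (*-zeroʳ c₀))) z≤n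
    ... | inj₁ yes-α = begin
      c₀ * Ex M (λ w → ⟦ α ≤ᵇ # S * # T ⟧ * ⟦ hits w S T <ᵇ h ⟧)
        ≡⟨ cong (c₀ *_) (trans (Ex-cong M (λ w → trans (cong (λ z → ⟦ z ⟧ * ⟦ hits w S T <ᵇ h ⟧) yes-α) (+-identityʳ _))) (Ex-lower (rect S T) M h)) ⟩
      c₀ * G α′ γ M h
        ≤⟨ G-tail {α′} {γ} M h q (a + b + κ) (≤-trans α>0 α≤) (≤-trans (≤-reflexive (cong (2 *_) (hit+miss (rect S T)))) (≤-trans 2N≤ (*-monoʳ-≤ q α≤))) M-large ⟩
      (α′ + γ) ^ M ≡⟨ cong (_^ M) (hit+miss (rect S T)) ⟩
      N ^ M ∎
      where
      α′ = hit (rect S T)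
      γ = miss (rect S T)
      α≤ : α ≤ α′
      α≤ = ≤-trans (≤ᵇ-true yes-α) (≤-reflexive (sym (∑-rect S T)))

  defects : (d k q : ℕ) → List (Fin a × Fin b) → ℕ
  defects d k q w = ∑ (allFin d) (λ i → overfull (k * suc (toℕ i)) (suc (toℕ i)) w)
    + (underfull (d * d) 1 w + underfull (d * q) (suc (k * suc d)) w)

  defects-zero : ∀ {d k q w} → defects d k q w ≡ 0 → Expanding d k q w
  defects-zero {d} {k} {q} {w} z = record
    { sparse = λ i 1≤i i≤d S T → sp i 1≤i i≤d S T
    ; meets = λ S T s t → underfull-zero {d * d} {1} {w} z₂ S T (*-mono-≤ s t)
    ; denseˡ = λ S T s t → underfull-zero {d * q} {suc (k * suc d)} {w} z₃ S T (*-mono-≤ s t)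
    ; denseʳ = λ S T s t → underfull-zero {d * q} {suc (k * suc d)} {w} z₃ S T (≤-trans (≤-reflexive (*-comm d q)) (*-mono-≤ s t)) }
    where
    o : ℕ
    o = ∑ (allFin d) (λ i → overfull (k * suc (toℕ i)) (suc (toℕ i)) w)
    z₁ : o ≡ 0
    z₁ = m+n≡0⇒m≡0 o z
    z₂ : underfull (d * d) 1 w ≡ 0
    z₂ = m+n≡0⇒m≡0 _ (m+n≡0⇒n≡0 o z)
    z₃ : underfull (d * q) (suc (k * suc d)) w ≡ 0
    z₃ = m+n≡0⇒n≡0 (underfull (d * d) 1 w) (m+n≡0⇒n≡0 o z)
    sp : ∀ i → 1 ≤ i → i ≤ d → ∀ S T → # S ≤ i → # T ≤ i → hits w S T < k * i
    sp (suc i) _ i<d S T s t = overfull-zero {k * suc i} {suc i} {w}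
      (subst (λ z → overfull (k * suc z) (suc z) w ≡ 0) (FinP.toℕ-fromℕ< i<d) (∑-zero _ z₁ (∈-allFin (fromℕ< i<d)))) S T s t

geometric-∑ : ∀ {n} (f : Fin n → ℕ) Z → (∀ i → 2 ^ suc (toℕ i) * f i ≤ Z) → ∑ (allFin n) f ≤ Z
geometric-∑ {zero} f Z h = z≤n
geometric-∑ {suc n} f Z h = *-cancelˡ-≤ 2 (begin
  2 * ∑ (allFin (suc n)) f ≡⟨ cong (2 *_) (∑-allFin-suc f) ⟩
  2 * (f zero + ∑ (allFin n) (f ∘ suc)) ≡⟨ *-distribˡ-+ 2 (f zero) _ ⟩
  2 * f zero + 2 * ∑ (allFin n) (f ∘ suc) ≡⟨ cong (2 * f zero +_) (sym (∑-*ˡ (allFin n) 2 (f ∘ suc))) ⟩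
  2 * f zero + ∑ (allFin n) (λ i → 2 * f (suc i))
    ≤⟨ +-mono-≤ (h zero) (geometric-∑ (λ i → 2 * f (suc i)) Z (λ i → ≤-trans (≤-reflexive (lem (2 ^ suc (toℕ i)) (f (suc i)))) (h (suc i)))) ⟩
  Z + Z ≡⟨ cong (Z +_) (sym (+-identityʳ Z)) ⟩
  2 * Z ∎)
  where
  open ≤-Reasoning
  lem : ∀ p f → p * (2 * f) ≡ 2 * p * f
  lem = solve-∀

i≤4^i : ∀ i → i ≤ 4 ^ i
i≤4^i zero = z≤n
i≤4^i (suc i) = ≤-trans (+-mono-≤ (m^n>0 4 i) (i≤4^i i)) (≤-trans (≤-reflexive (cong (4 ^ i +_) (sym (+-identityʳ _)))) (*-monoˡ-≤ (4 ^ i) {2} {4} (s≤s (s≤s z≤n))))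

n≤2^n : ∀ n → n ≤ 2 ^ n
n≤2^n zero = z≤n
n≤2^n (suc n) = +-mono-≤ (m^n>0 2 n) (≤-trans (n≤2^n n) (≤-reflexive (sym (+-identityʳ _))))

-- From 4dx ≤ iy one gets x ^ i ≤ (i / 4d) ^ i y ^ i, and (i / 4d) ^ i ≤ 1 / d for 1 ≤ i ≤ d.
power-gain : ∀ d x y i → 1 ≤ d → 1 ≤ i → i ≤ d → 4 * d * x ≤ i * y → d * x ^ i ≤ y ^ i
power-gain d x y i@(suc j) d>0 i>0 i≤d h = *-cancelˡ-≤ ((4 * d) ^ i) {{m^n≢0 (4 * d) i {{>-nonZero (≤-trans d>0 (m≤m+n d _))}}}} (begin
  (4 * d) ^ i * (d * x ^ i) ≡⟨ lem₁ ((4 * d) ^ i) d (x ^ i) ⟩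
  d * ((4 * d) ^ i * x ^ i) ≡⟨ cong (d *_) (sym (^-distribʳ-* (4 * d) x i)) ⟩
  d * (4 * d * x) ^ i ≤⟨ *-monoʳ-≤ d (^-monoˡ-≤ i h) ⟩
  d * (i * y) ^ i ≡⟨ cong (d *_) (^-distribʳ-* i y i) ⟩
  d * (i ^ i * y ^ i) ≡⟨ sym (*-assoc d (i ^ i) (y ^ i)) ⟩
  d * i ^ i * y ^ i ≤⟨ *-monoˡ-≤ (y ^ i) small-power ⟩
  (4 * d) ^ i * y ^ i ∎)
  where
  open ≤-Reasoning
  lem₁ : ∀ a b c → a * (b * c) ≡ b * (a * c)
  lem₁ = solve-∀
  lem₂ : ∀ d i p → d * (i * p) ≡ i * (d * p)
  lem₂ = solve-∀
  small-power : d * i ^ i ≤ (4 * d) ^ i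
  small-power = begin
    d * (i * i ^ j) ≡⟨ lem₂ d i (i ^ j) ⟩
    i * (d * i ^ j) ≤⟨ *-mono-≤ (i≤4^i i) (*-monoʳ-≤ d (^-monoˡ-≤ j i≤d)) ⟩
    4 ^ i * d ^ i ≡⟨ sym (^-distribʳ-* 4 d i) ⟩
    (4 * d) ^ i ∎

module RandomBound (a b r d k′ n₀ A′ L B q q₂ : ℕ)
  (d>0 : 1 ≤ d) (n₀>0 : 1 ≤ n₀) (q>0 : 1 ≤ q)
  (N-lower : n₀ * (d * d) ≤ RandomPhase.N a b r) (N-upper : RandomPhase.N a b r ≤ A′ * (d * d))
  (dims : a + b + d ≤ L * d) (B-small : 8 * B ≤ (3 + k′) * n₀) (k-large : 16 * (L * L) ≤ 2 ^ k′)
  (B-large : 2 * A′ * (1 + (a + b + d)) ≤ B * d)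
  (q₂-large : 2 * RandomPhase.N a b r ≤ q₂ * (d * q))
  (B-large₂ : q₂ * (suc ((3 + k′) * suc d) + (a + b + d)) ≤ B * d) where
  open RandomPhase a b r
  open Sequences (pairs a b) r

  k M : ℕ
  k = 3 + k′
  M = B * d

  module _ (i : ℕ) (i>0 : 1 ≤ i) (i≤d : i ≤ d) where
    open ≤-Reasoning

    -- With factorials m! replaced by (m/4)^m, `overfull-bound` for h = k i reads Ex ≤ (X/Y)^i N^M.
    -- The k-th powers stem from the k i edges, the factors 16 (L d)² and i² from the choice of the
    -- two sets.
    Y X : ℕ
    Y = (k * i * (n₀ * (d * d))) ^ k * (i * i)
    X = (4 * (M * (i * i))) ^ k * (16 * (L * d * (L * d)))

    -- In effect X/Y ≤ i/(8d). By `B-small` each of the k = 3 + k′ factors is at most i/(2d); k′ of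
    -- them absorb 16 L², two cancel (d/i)², and the last one provides the gain.
    X-vs-Y : 4 * d * (2 * X) ≤ i * Y
    X-vs-Y = *-cancelˡ-≤ ((2 * d) ^ k) {{m^n≢0 (2 * d) k {{>-nonZero (≤-trans d>0 (m≤m+n d _))}}}} (begin
      (2 * d) ^ k * (4 * d * (2 * X)) ≡⟨ lem₁ ((2 * d) ^ k) d ((4 * (M * (i * i))) ^ k) (L * d * (L * d)) ⟩
      (2 * d) ^ k * (4 * (M * (i * i))) ^ k * (128 * d * (L * d * (L * d)))
        ≡⟨ cong (_* (128 * d * (L * d * (L * d)))) (sym (^-distribʳ-* (2 * d) (4 * (M * (i * i))) k)) ⟩
      (2 * d * (4 * (M * (i * i)))) ^ k * (128 * d * (L * d * (L * d)))
        ≤⟨ *-monoˡ-≤ _ (^-monoˡ-≤ k base) ⟩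
      (k * i * (n₀ * (d * d)) * i) ^ k * (128 * d * (L * d * (L * d)))
        ≡⟨ cong (_* (128 * d * (L * d * (L * d)))) (^-distribʳ-* (k * i * (n₀ * (d * d))) i k) ⟩
      y * i ^ k * (128 * d * (L * d * (L * d)))
        ≡⟨ *-assoc y (i ^ k) _ ⟩
      y * (i ^ k * (128 * d * (L * d * (L * d))))
        ≤⟨ *-monoʳ-≤ y tail ⟩
      y * ((2 * d) ^ k * (i * (i * i)))
        ≡⟨ lem₂ y ((2 * d) ^ k) i ⟩
      (2 * d) ^ k * (i * Y) ∎)
      where
      y : ℕ
      y = (k * i * (n₀ * (d * d))) ^ k
      lem₁ : ∀ p d x l → p * (4 * d * (2 * (x * (16 * l)))) ≡ p * x * (128 * d * l)
      lem₁ = solve-∀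
      lem₂ : ∀ y p i → y * (p * (i * (i * i))) ≡ p * (i * (y * (i * i)))
      lem₂ = solve-∀
      base : 2 * d * (4 * (M * (i * i))) ≤ k * i * (n₀ * (d * d)) * i
      base = begin
        2 * d * (4 * (B * d * (i * i))) ≡⟨ lem₃ d B i ⟩
        8 * B * (d * d * (i * i)) ≤⟨ *-monoˡ-≤ _ B-small ⟩
        k * n₀ * (d * d * (i * i)) ≡⟨ lem₄ k n₀ d i ⟩
        k * i * (n₀ * (d * d)) * i ∎
        where
        lem₃ : ∀ d B i → 2 * d * (4 * (B * d * (i * i))) ≡ 8 * B * (d * d * (i * i))
        lem₃ = solve-∀
        lem₄ : ∀ k n d i → k * n * (d * d * (i * i)) ≡ k * i * (n * (d * d)) * i
        lem₄ = solve-∀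
      tail : i ^ k * (128 * d * (L * d * (L * d))) ≤ (2 * d) ^ k * (i * (i * i))
      tail = begin
        i * (i * (i * i ^ k′)) * (128 * d * (L * d * (L * d))) ≡⟨ lem₅ i (i ^ k′) d L ⟩
        8 * (16 * (L * L)) * i ^ k′ * (d * (d * d) * (i * (i * i)))
          ≤⟨ *-monoˡ-≤ _ (*-mono-≤ (*-monoʳ-≤ 8 k-large) (^-monoˡ-≤ k′ i≤d)) ⟩
        8 * 2 ^ k′ * d ^ k′ * (d * (d * d) * (i * (i * i))) ≡⟨ lem₆ (2 ^ k′) (d ^ k′) d (i * (i * i)) ⟩
        2 * d * (2 * d * (2 * d * (2 ^ k′ * d ^ k′))) * (i * (i * i))
          ≡⟨ cong (λ z → 2 * d * (2 * d * (2 * d * z)) * (i * (i * i))) (sym (^-distribʳ-* 2 d k′)) ⟩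
        (2 * d) ^ k * (i * (i * i)) ∎
        where
        lem₅ : ∀ i p d L → i * (i * (i * p)) * (128 * d * (L * d * (L * d))) ≡ 8 * (16 * (L * L)) * p * (d * (d * d) * (i * (i * i)))
        lem₅ = solve-∀
        lem₆ : ∀ p q d z → 8 * p * q * (d * (d * d) * z) ≡ 2 * d * (2 * d * (2 * d * (p * q))) * z
        lem₆ = solve-∀

    -- The factor 2^i makes the bounds summable over i, and d is the final gain; both are taken from
    -- `power-gain` with 2X in place of X.
    overfull-small : 2 ^ i * (d * Ex M (overfull (k * i) i)) ≤ N ^ M
    overfull-small = *-cancelˡ-≤ (Y ^ i) {{m^n≢0 Y i {{nz}}}} (begin
      Y ^ i * (2 ^ i * (d * ex)) ≡⟨ lem₁ (Y ^ i) (2 ^ i) d ex ⟩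
      d * 2 ^ i * (Y ^ i * ex) ≤⟨ *-monoʳ-≤ (d * 2 ^ i) main ⟩
      d * 2 ^ i * (X ^ i * N ^ M) ≡⟨ lem₂ d (2 ^ i) (X ^ i) (N ^ M) ⟩
      d * (2 ^ i * X ^ i) * N ^ M ≡⟨ cong (λ z → d * z * N ^ M) (sym (^-distribʳ-* 2 X i)) ⟩
      d * (2 * X) ^ i * N ^ M ≤⟨ *-monoˡ-≤ (N ^ M) (power-gain d (2 * X) Y i d>0 i>0 i≤d X-vs-Y) ⟩
      Y ^ i * N ^ M ∎)
      where
      lem₁ : ∀ y p d e → y * (p * (d * e)) ≡ d * p * (y * e)
      lem₁ = solve-∀
      lem₂ : ∀ d p x n → d * p * (x * n) ≡ d * (p * x) * n
      lem₂ = solve-∀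
      ex h : ℕ
      h = k * i
      ex = Ex M (overfull h i)
      instance
        i-nz : NonZero i
        i-nz = >-nonZero i>0
        n₀-nz : NonZero n₀
        n₀-nz = >-nonZero n₀>0
        d-nz : NonZero d
        d-nz = >-nonZero d>0
      nz : NonZero Y
      nz = m*n≢0 _ _ {{m^n≢0 (k * i * (n₀ * (d * d))) k {{m*n≢0 _ _ {{m*n≢0 k i}} {{m*n≢0 n₀ _ {{n₀-nz}} {{m*n≢0 d d}}}}}}}} {{m*n≢0 i i}}
      unpack : ∀ x → x ^ h ≡ (x ^ k) ^ i
      unpack x = sym (^-*-assoc x k i)
      ≤L : ∀ z → z ≤ a + b → z + i ≤ L * d
      ≤L z z≤ = ≤-trans (+-mono-≤ z≤ i≤d) dims
      main : Y ^ i * ex ≤ X ^ i * N ^ M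
      main = begin
        Y ^ i * ex ≡⟨ cong (_* ex) Y-split ⟩
        h ^ h * (i ^ i * i ^ i) * (n₀ * (d * d)) ^ h * ex
          ≤⟨ *-monoˡ-≤ ex (*-mono-≤ (*-mono-≤ (n^n≤4^n*n! h) (*-mono-≤ (n^n≤4^n*n! i) (n^n≤4^n*n! i))) (^-monoˡ-≤ h N-lower)) ⟩
        4 ^ h * h ! * (4 ^ i * i ! * (4 ^ i * i !)) * N ^ h * ex
          ≡⟨ lem₃ (4 ^ h) (h !) (4 ^ i) (i !) (N ^ h) ex ⟩
        4 ^ h * (4 ^ i * 4 ^ i) * (i ! * i !) * (h ! * N ^ h * ex)
          ≤⟨ *-monoʳ-≤ (4 ^ h * (4 ^ i * 4 ^ i) * (i ! * i !)) (overfull-bound M h i) ⟩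
        4 ^ h * (4 ^ i * 4 ^ i) * (i ! * i !) * (small a i * small b i * ((M * (i * i)) ^ h * N ^ M))
          ≡⟨ lem₄ (4 ^ h) (4 ^ i) (i !) (small a i) (small b i) ((M * (i * i)) ^ h) (N ^ M) ⟩
        4 ^ h * (M * (i * i)) ^ h * (4 ^ i * 4 ^ i) * (i ! * small a i * (i ! * small b i)) * N ^ M
          ≤⟨ *-monoˡ-≤ (N ^ M) (*-monoʳ-≤ (4 ^ h * (M * (i * i)) ^ h * (4 ^ i * 4 ^ i))
               (*-mono-≤ (≤-trans (small-bound a i) (^-monoˡ-≤ i (≤L a (m≤m+n a b)))) (≤-trans (small-bound b i) (^-monoˡ-≤ i (≤L b (m≤n+m b a)))))) ⟩
        4 ^ h * (M * (i * i)) ^ h * (4 ^ i * 4 ^ i) * ((L * d) ^ i * (L * d) ^ i) * N ^ M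
          ≡⟨ cong (_* N ^ M) (sym X-split) ⟩
        X ^ i * N ^ M ∎
        where
        lem₃ : ∀ p f q g n e → p * f * (q * g * (q * g)) * n * e ≡ p * (q * q) * (g * g) * (f * n * e)
        lem₃ = solve-∀
        lem₄ : ∀ p q g s t m n → p * (q * q) * (g * g) * (s * t * (m * n)) ≡ p * m * (q * q) * (g * s * (g * t)) * n
        lem₄ = solve-∀
        Y-split : Y ^ i ≡ h ^ h * (i ^ i * i ^ i) * (n₀ * (d * d)) ^ h
        Y-split = begin-equality
          Y ^ i ≡⟨ ^-distribʳ-* _ (i * i) i ⟩
          ((h * (n₀ * (d * d))) ^ k) ^ i * (i * i) ^ i ≡⟨ cong₂ _*_ (sym (unpack (h * (n₀ * (d * d))))) (^-distribʳ-* i i i) ⟩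
          (h * (n₀ * (d * d))) ^ h * (i ^ i * i ^ i) ≡⟨ cong (_* (i ^ i * i ^ i)) (^-distribʳ-* h _ h) ⟩
          h ^ h * (n₀ * (d * d)) ^ h * (i ^ i * i ^ i) ≡⟨ lem₅ (h ^ h) ((n₀ * (d * d)) ^ h) (i ^ i * i ^ i) ⟩
          h ^ h * (i ^ i * i ^ i) * (n₀ * (d * d)) ^ h ∎
          where lem₅ : ∀ x y z → x * y * z ≡ x * z * y
                lem₅ = solve-∀
        X-split : X ^ i ≡ 4 ^ h * (M * (i * i)) ^ h * (4 ^ i * 4 ^ i) * ((L * d) ^ i * (L * d) ^ i)
        X-split = begin-equality
          X ^ i ≡⟨ ^-distribʳ-* _ (16 * (L * d * (L * d))) i ⟩
          ((4 * (M * (i * i))) ^ k) ^ i * (16 * (L * d * (L * d))) ^ i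
            ≡⟨ cong₂ _*_ (sym (unpack (4 * (M * (i * i))))) (trans (^-distribʳ-* 16 _ i) (cong₂ _*_ (^-distribʳ-* 4 4 i) (^-distribʳ-* (L * d) (L * d) i))) ⟩
          (4 * (M * (i * i))) ^ h * (4 ^ i * 4 ^ i * ((L * d) ^ i * (L * d) ^ i))
            ≡⟨ cong (_* (4 ^ i * 4 ^ i * ((L * d) ^ i * (L * d) ^ i))) (^-distribʳ-* 4 (M * (i * i)) h) ⟩
          4 ^ h * (M * (i * i)) ^ h * (4 ^ i * 4 ^ i * ((L * d) ^ i * (L * d) ^ i))
            ≡⟨ sym (*-assoc (4 ^ h * (M * (i * i)) ^ h) _ _) ⟩
          4 ^ h * (M * (i * i)) ^ h * (4 ^ i * 4 ^ i) * ((L * d) ^ i * (L * d) ^ i) ∎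

  -- Each of the three kinds of defects contributes at most N^M / d: a geometric series for the
  -- overfull pairs, and d ≤ 2^d for the two underfull ones.
  defects-small : d * Ex M (defects d k q) ≤ 3 * N ^ M
  defects-small = begin
    d * Ex M (defects d k q)
      ≡⟨ cong (d *_) (trans (Ex-+ M _ _) (cong₂ _+_ (Ex-∑ M (allFin d) _) (Ex-+ M _ _))) ⟩
    d * (∑ (allFin d) (λ i → Ex M (overfull (k * suc (toℕ i)) (suc (toℕ i)))) + (Ex M (underfull (d * d) 1) + Ex M (underfull (d * q) (suc (k * suc d)))))
      ≡⟨ lem d _ _ _ ⟩
    d * ∑ (allFin d) (λ i → Ex M (overfull (k * suc (toℕ i)) (suc (toℕ i)))) + (d * Ex M (underfull (d * d) 1) + d * Ex M (underfull (d * q) (suc (k * suc d))))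
      ≤⟨ +-mono-≤ (≤-trans (≤-reflexive (sym (∑-*ˡ (allFin d) d _)))
                    (geometric-∑ (λ i → d * Ex M (overfull (k * suc (toℕ i)) (suc (toℕ i)))) (N ^ M) (λ i → overfull-small (suc (toℕ i)) (s≤s z≤n) (FinP.toℕ<n i))))
          (+-mono-≤ (under (d * d) 1 (2 * A′) (*-mono-≤ d>0 d>0) (≤-trans (*-monoʳ-≤ 2 N-upper) (≤-reflexive (sym (*-assoc 2 A′ (d * d))))) B-large)
                    (under (d * q) (suc (k * suc d)) q₂ (*-mono-≤ d>0 q>0) q₂-large B-large₂)) ⟩
    N ^ M + (N ^ M + N ^ M) ≡⟨ lem′ (N ^ M) ⟩
    3 * N ^ M ∎
    where
    open ≤-Reasoning
    lem : ∀ d x y z → d * (x + (y + z)) ≡ d * x + (d * y + d * z)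
    lem = solve-∀
    lem′ : ∀ x → x + (x + x) ≡ 3 * x
    lem′ = solve-∀
    under : ∀ α h q′ → 1 ≤ α → 2 * N ≤ q′ * α → q′ * (h + (a + b + d)) ≤ M → d * Ex M (underfull α h) ≤ N ^ M
    under α h q′ α>0 e₁ e₂ = ≤-trans (*-monoˡ-≤ _ (n≤2^n d)) (underfull-bound M α h q′ d α>0 e₁ e₂)

-- The random phase and the schedule of repair stages in the game

G-mono : ∀ a c T μ → G a c T μ ≤ G a c T (suc μ)
G-mono a c T zero = z≤n
G-mono a c zero (suc μ) = ≤-refl
G-mono a c (suc T) (suc μ) = +-mono-≤ (*-monoʳ-≤ a (G-mono a c T μ)) (*-monoʳ-≤ c (G-mono a c T (suc μ)))

G-mono-≤ : ∀ a c T {μ ν} → μ ≤ ν → G a c T μ ≤ G a c T ν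
G-mono-≤ a c T h = go (≤⇒≤′ h)
  where
  go : ∀ {μ ν} → μ ≤′ ν → G a c T μ ≤ G a c T ν
  go ≤′-refl = ≤-refl
  go (≤′-step p) = ≤-trans (go p) (G-mono a c T _)

module PhaseB (Gm : Game) where
  open Game Gm
  open GameLemmas Gm
  open Sequences (pairs ℓ′ ρ) (ρ + r) public

  Recorded : List (Fin ℓ′ × Fin ρ) → List Edge → Set
  Recorded w E = ∀ {j t} → (j , t) ∈ w → edge (inj₁ (suc j)) t (inj₁ (inject₁ j)) (inj₁ j) ∈ E

  -- The junction x_0 has no slot before it, so offers containing it are ignored; their ρ outcomes
  -- join the r that leave no record. The list is accumulated most recent first, whence the
  -- reversal.
  reveal : ∀ M {T₂} (φ : List (Fin ℓ′ × Fin ρ) → ℕ) w₀ E₀ → Recorded w₀ E₀ →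
    (∀ w E → Recorded w E → W T₂ E (φ w)) → W (M + T₂) E₀ (Ex M (λ w → φ (reverse w ++ w₀)))
  reveal zero φ w₀ E₀ rec cont = cont w₀ E₀ rec
  reveal (suc M) φ w₀ E₀ rec cont = W-mono (≤-reflexive total) (superstep f respond stay)
    where
    Φ : List (Fin ℓ′ × Fin ρ) → ℕ
    Φ w′ = Ex M (λ w → φ (reverse w ++ w′))
    stay : W _ E₀ (Φ w₀)
    stay = reveal M φ w₀ E₀ rec cont
    f : X → Fin ρ → ℕ
    f zero t = Φ w₀
    f (suc j) t = Φ ((j , t) ∷ w₀)
    respond : ∀ x t → Reply board W (M + _) E₀ x t (f x t) ⊎ W (M + _) E₀ (f x t)
    respond zero t = inj₂ stay
    respond (suc j) t = inj₁ (inj₁ (inject₁ j) , inj₁ j , (λ e → distinct e) , (λ ()) ,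
      reveal M φ ((j , t) ∷ w₀) _ (λ { (here refl) → here refl ; (there m) → there (rec m) }) cont)
      where
      distinct : inj₁ {B = Fin ρ} (inject₁ j) ≢ inj₁ (suc j)
      distinct e = <-irrefl (trans (sym (FinP.toℕ-inject₁ j)) (cong toℕ (inj₁-injective e))) (n<1+n (toℕ j))
    open ≡-Reasoning
    shuffle : ∀ o w → reverse (o ∷ w) ++ w₀ ≡ reverse w ++ o ∷ w₀
    shuffle o w = trans (cong (_++ w₀) (unfold-reverse o w)) (++-assoc (reverse w) (o ∷ []) w₀)
    total : ∑ (allFin (suc ℓ′)) (λ x → ∑ (allFin ρ) (f x)) + r * Φ w₀ ≡ Ex (suc M) (λ w → φ (reverse w ++ w₀))
    total = begin
      ∑ (allFin (suc ℓ′)) (λ x → ∑ (allFin ρ) (f x)) + r * Φ w₀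
        ≡⟨ cong (_+ r * Φ w₀) (∑-allFin-suc (λ x → ∑ (allFin ρ) (f x))) ⟩
      ∑ (allFin ρ) (λ _ → Φ w₀) + ∑ (allFin ℓ′) (λ j → ∑ (allFin ρ) (f (suc j))) + r * Φ w₀
        ≡⟨ cong₂ (λ y z → y + z + r * Φ w₀) (trans (∑-const (allFin ρ) _) (cong (_* Φ w₀) (length-allFin ρ))) (sym (∑-pairs ℓ′ ρ (λ o → Φ (o ∷ w₀)))) ⟩
      ρ * Φ w₀ + ∑ (pairs ℓ′ ρ) (λ o → Φ (o ∷ w₀)) + r * Φ w₀
        ≡⟨ lem ρ r (Φ w₀) _ ⟩
      ∑ (pairs ℓ′ ρ) (λ o → Φ (o ∷ w₀)) + (ρ + r) * Φ w₀
        ≡⟨ cong (_+ (ρ + r) * Φ w₀) (∑-cong (pairs ℓ′ ρ) (λ o → Ex-cong M (λ w → cong φ (sym (shuffle o w))))) ⟩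
      Ex (suc M) (λ w → φ (reverse w ++ w₀)) ∎
      where
      lem : ∀ p r x s → p * x + s + r * x ≡ s + (p + r) * x
      lem = solve-∀

  N≡ : length (pairs ℓ′ ρ) + (ρ + r) ≡ N
  N≡ = trans (cong (_+ (ρ + r)) (length-pairs ℓ′ ρ)) (lem ℓ′ ρ r)
    where lem : ∀ a b r → a * b + (b + r) ≡ suc a * b + r
          lem = solve-∀

-- At level j at most target j links are missing. With i = I - j, each of them is given 4 ^ i centres, so about
-- 4 ^ i * 16 ^ j of the n vertices complete a move, and the time to go down one level is of order n / 2 ^ i.
module Schedule (Gm : Game) (P : Plan (Game.board Gm)) (I A′ : ℕ)
  (N-upper : Game.N Gm ≤ A′ * (16 ^ I * 16 ^ I)) (N-lower : 4 * (16 ^ I * 16 ^ I) ≤ Game.N Gm)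
  (b₀≡ : Plan.b₀ P ≡ 16 ^ I + suc (16 ^ I))
  (units-enough : 8 * 16 ^ I ≤ length (Plan.units P)) (pool-enough : 10 * 16 ^ I ≤ length (Plan.pool P))
  (finish : ∀ {E : List (Game.Edge Gm)} → Plan.Cycle P [] E → HamCycle (Game.board Gm) E) where
  open Game Gm
  open GameLemmas Gm
  open Stages Gm P
  open Plan P using (Cycle; b₀; units; pool)

  -- Each half of a stage will fail with probability at most 1/K₀. As K₀ is doubly exponential in I,
  -- the number of stages is negligible beside it.
  d K₀ Cc : ℕ
  d = 16 ^ I
  K₀ = 2 ^ (2 ^ I)
  Cc = 128 * A′

  d>0 : 1 ≤ d
  d>0 = m^n>0 16 I

  -- At the start at most 2d + 1 ≤ 3 * 16^I links are missing; the last stage has to remove the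
  -- remaining 3 or fewer.
  target : ℕ → ℕ
  target zero = 0
  target (suc j) = 3 * 16 ^ j

  duration : ℕ → ℕ → ℕ
  duration i j = Cc * (8 ^ i * 16 ^ j)

  time : ℕ → ℕ → ℕ
  time i zero = 0
  time i (suc j) = duration i j + (duration i j + time (suc i) j)

  ca : ℕ
  ca = N ∸ d * d

  rate : ℕ → ℕ → ℕ
  rate i j = (target j + 1) * 4 ^ i * d

  -- The exact number of missing links at the beginning of a stage is unknown; it is replaced by the
  -- previous target 3 * 16^j, which can only increase `G`.
  storeFail commitFail : ℕ → ℕ → ℕ
  storeFail i j = G (d * d) ca (duration i j) (3 * 16 ^ j * 4 ^ i)
  commitFail i j = G (rate i j) (N ∸ rate i j) (duration i j) (3 * 16 ^ j)

  fails : ℕ → ℕ → ℕ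
  fails i zero = 0
  fails i (suc j) =
    N ^ duration i j * (N ^ duration i j * fails (suc i) j + N ^ time (suc i) j * commitFail i j)
    + N ^ (duration i j + time (suc i) j) * storeFail i j

  4^i*16^j≤d : ∀ i j → i + j ≡ I → 4 ^ i * 16 ^ j ≤ d
  4^i*16^j≤d i j refl = ≤-trans (*-monoˡ-≤ (16 ^ j) (^-monoˡ-≤ i {4} {16} (≤ᵇ⇒≤ 4 16 _))) (≤-reflexive (sym (^-distribˡ-+-* 16 i j)))

  target+1≤ : ∀ j → target j + 1 ≤ 4 * 16 ^ j
  target+1≤ zero = s≤s z≤n
  target+1≤ (suc j) = begin
    3 * 16 ^ j + 1 ≤⟨ +-monoʳ-≤ (3 * 16 ^ j) (m^n>0 16 j) ⟩
    3 * 16 ^ j + 16 ^ j ≡⟨ +-comm (3 * 16 ^ j) _ ⟩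
    4 * 16 ^ j ≤⟨ *-monoʳ-≤ 4 (m≤n*m (16 ^ j) 16) ⟩
    4 * (16 * 16 ^ j) ∎
    where open ≤-Reasoning

  16^j≤ : ∀ j → 16 ^ j ≤ 16 * (target j + 1)
  16^j≤ zero = s≤s z≤n
  16^j≤ (suc j) = *-monoʳ-≤ 16 (≤-trans (m≤n*m (16 ^ j) 3) (m≤m+n _ 1))

  rate≤N : ∀ i j → i + j ≡ I → rate i j ≤ N
  rate≤N i j e = begin
    (target j + 1) * 4 ^ i * d ≤⟨ *-monoˡ-≤ d (*-monoˡ-≤ (4 ^ i) (target+1≤ j)) ⟩
    4 * 16 ^ j * 4 ^ i * d ≡⟨ lem (16 ^ j) (4 ^ i) d ⟩
    4 * (4 ^ i * 16 ^ j * d) ≤⟨ *-monoʳ-≤ 4 (*-monoˡ-≤ d (4^i*16^j≤d i j e)) ⟩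
    4 * (d * d) ≤⟨ N-lower ⟩
    N ∎
    where open ≤-Reasoning
          lem : ∀ a b d → 4 * a * b * d ≡ 4 * (b * a * d)
          lem = solve-∀

  d*d≤N : d * d ≤ N
  d*d≤N = ≤-trans (m≤n*m (d * d) 4) N-lower

  -- If the target of a level is met already, both halves of its stage are spent idle, so that the
  -- timetable does not depend on the course of the game. With i + j = I there are at most 3 * 16^j
  -- * 4^i ≤ 3d stores in all.
  run : ∀ j i → i + j ≡ suc I → ∀ {bs E} → Cycle bs E → length bs ≤ target j → W (time i j) E (fails i j)
  run zero i _ {[]} Γ le = W-ham (finish Γ)
  run (suc j) i e {bs} {E} Γ le with length bs ≤? target j
  ... | yes small = W-mono (≤-trans (*-monoʳ-≤ (N ^ duration i j) (m≤m+n _ _)) (m≤m+n _ _))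
        (idle (duration i j) (idle (duration i j) (run j (suc i) (trans (sym (+-suc i j)) e) Γ small)))
  ... | no large = W-mono fewer
        (stage {M = 4 ^ i} {target j} {μ} {3 * d} {d} {time (suc i) j} {fails (suc i) j} {ca} {N ∸ rate i j} (duration i j) (duration i j)
          stores-bounded units-fit pool-fit (m+[n∸m]≡n d*d≤N) (m+[n∸m]≡n (rate≤N i j i+j≡I))
          (λ {bs′} {E′} Γ′ size → run j (suc i) (trans (sym (+-suc i j)) e) Γ′ (≤-reflexive size)) Γ size≡)
    where
    i+j≡I : i + j ≡ I
    i+j≡I = suc-injective (trans (sym (+-suc i j)) e)
    μ : ℕ
    μ = length bs ∸ target j
    size≡ : length bs ≡ target j + μ
    size≡ = sym (m+[n∸m]≡n (<⇒≤ (≰⇒> large)))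
    open ≤-Reasoning
    stores-bounded : (target j + μ) * 4 ^ i ≤ 3 * d
    stores-bounded = begin
      (target j + μ) * 4 ^ i ≡⟨ cong (_* 4 ^ i) (sym size≡) ⟩
      length bs * 4 ^ i ≤⟨ *-monoˡ-≤ (4 ^ i) le ⟩
      3 * 16 ^ j * 4 ^ i ≡⟨ trans (*-assoc 3 (16 ^ j) (4 ^ i)) (cong (3 *_) (*-comm (16 ^ j) (4 ^ i))) ⟩
      3 * (4 ^ i * 16 ^ j) ≤⟨ *-monoʳ-≤ 3 (4^i*16^j≤d i j i+j≡I) ⟩
      3 * d ∎
    units-fit : d + b₀ + 3 * d + 1 ≤ length units
    units-fit = begin
      d + b₀ + 3 * d + 1 ≡⟨ cong (λ z → d + z + 3 * d + 1) b₀≡ ⟩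
      d + (d + suc d) + 3 * d + 1 ≡⟨ lem d ⟩
      6 * d + 2 ≤⟨ +-monoʳ-≤ (6 * d) (*-monoʳ-≤ 2 d>0) ⟩
      6 * d + 2 * d ≡⟨ sym (*-distribʳ-+ d 6 2) ⟩
      8 * d ≤⟨ units-enough ⟩
      length units ∎
      where lem : ∀ d → d + (d + suc d) + 3 * d + 1 ≡ 6 * d + 2
            lem = solve-∀
    pool-fit : d + 2 * b₀ + 3 * d ≤ length pool
    pool-fit = begin
      d + 2 * b₀ + 3 * d ≡⟨ cong (λ z → d + 2 * z + 3 * d) b₀≡ ⟩
      d + 2 * (d + suc d) + 3 * d ≡⟨ lem d ⟩
      8 * d + 2 ≤⟨ +-monoʳ-≤ (8 * d) (*-monoʳ-≤ 2 d>0) ⟩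
      8 * d + 2 * d ≡⟨ sym (*-distribʳ-+ d 8 2) ⟩
      10 * d ≤⟨ pool-enough ⟩
      length pool ∎
      where lem : ∀ d → d + 2 * (d + suc d) + 3 * d ≡ 8 * d + 2
            lem = solve-∀
    fewer : N ^ duration i j * (N ^ duration i j * fails (suc i) j + N ^ time (suc i) j * G (rate i j) (N ∸ rate i j) (duration i j) μ)
          + N ^ (duration i j + time (suc i) j) * G (d * d) ca (duration i j) ((target j + μ) * 4 ^ i)
          ≤ fails i (suc j)
    fewer = +-mono-≤
      (*-monoʳ-≤ (N ^ duration i j) (+-monoʳ-≤ _ (*-monoʳ-≤ (N ^ time (suc i) j) (G-mono-≤ _ _ (duration i j) (≤-trans (m∸n≤m (length bs) (target j)) le)))))
      (*-monoʳ-≤ (N ^ (duration i j + time (suc i) j)) (G-mono-≤ _ _ (duration i j) (≤-trans (≤-reflexive (cong (_* 4 ^ i) (sym size≡))) (*-monoˡ-≤ (4 ^ i) le))))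

  K₀-exponent : ∀ i j → i + j ≡ I → 2 ^ I ≤ 2 ^ i * 16 ^ j
  K₀-exponent i j refl = ≤-trans (≤-reflexive (^-distribˡ-+-* 2 i j)) (*-monoʳ-≤ (2 ^ i) (^-monoˡ-≤ j {2} {16} (≤ᵇ⇒≤ 2 16 _)))

  2^i*4^i : ∀ i → 2 ^ i * 4 ^ i ≡ 8 ^ i
  2^i*4^i i = sym (^-distribʳ-* 2 4 i)

  4^i*4^i : ∀ i → 4 ^ i * 4 ^ i ≡ 16 ^ i
  4^i*4^i i = sym (^-distribʳ-* 4 4 i)

  store-rare : ∀ i j → i + j ≡ I → K₀ * storeFail i j ≤ N ^ duration i j
  store-rare i j e = subst (λ z → K₀ * storeFail i j ≤ z ^ duration i j) (m+[n∸m]≡n d*d≤N)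
    (G-tail {d * d} {ca} (duration i j) (3 * 16 ^ j * 4 ^ i) (2 * A′) (2 ^ I) (*-mono-≤ d>0 d>0)
      (≤-trans (*-monoʳ-≤ 2 (≤-trans (≤-reflexive (m+[n∸m]≡n d*d≤N)) N-upper)) (≤-reflexive (sym (*-assoc 2 A′ (d * d))))) long)
    where
    open ≤-Reasoning
    long : 2 * A′ * (3 * 16 ^ j * 4 ^ i + 2 ^ I) ≤ duration i j
    long = begin
      2 * A′ * (3 * 16 ^ j * 4 ^ i + 2 ^ I)
        ≤⟨ *-monoʳ-≤ (2 * A′) (+-mono-≤ (*-monoʳ-≤ (3 * 16 ^ j) (^-monoˡ-≤ i {4} {8} (≤ᵇ⇒≤ 4 8 _))) (≤-trans (K₀-exponent i j e) (*-monoˡ-≤ (16 ^ j) (^-monoˡ-≤ i {2} {8} (≤ᵇ⇒≤ 2 8 _))))) ⟩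
      2 * A′ * (3 * 16 ^ j * 8 ^ i + 8 ^ i * 16 ^ j) ≡⟨ lem A′ (16 ^ j) (8 ^ i) ⟩
      8 * A′ * (8 ^ i * 16 ^ j) ≤⟨ *-monoˡ-≤ (8 ^ i * 16 ^ j) (*-monoˡ-≤ A′ (≤ᵇ⇒≤ 8 128 _)) ⟩
      duration i j ∎
      where lem : ∀ A p q → 2 * A * (3 * p * q + q * p) ≡ 8 * A * (q * p)
            lem = solve-∀

  -- A round succeeds with probability at least of order 1/(A′ 4^i), so 4^i (16^j + 2^I) rounds are
  -- needed up to a constant. The duration has 8^i instead of 4^i because 2^I ≤ 2^i 16^j: the
  -- surplus 2^i secures the error 1/K₀ even when few links are left.
  commit-rare : ∀ i j → i + j ≡ I → K₀ * commitFail i j ≤ N ^ duration i j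
  commit-rare i j e = subst (λ z → K₀ * commitFail i j ≤ z ^ duration i j) (m+[n∸m]≡n (rate≤N i j e))
    (G-tail {rate i j} {N ∸ rate i j} (duration i j) (3 * 16 ^ j) (32 * A′ * 4 ^ i) (2 ^ I)
      (*-mono-≤ (*-mono-≤ (m≤n+m 1 (target j)) (m^n>0 4 i)) d>0) frequent long)
    where
    open ≤-Reasoning
    frequent : 2 * (rate i j + (N ∸ rate i j)) ≤ 32 * A′ * 4 ^ i * rate i j
    frequent = begin
      2 * (rate i j + (N ∸ rate i j)) ≡⟨ cong (2 *_) (m+[n∸m]≡n (rate≤N i j e)) ⟩
      2 * N ≤⟨ *-monoʳ-≤ 2 N-upper ⟩
      2 * (A′ * (d * d)) ≡⟨ cong (λ z → 2 * (A′ * (z * d))) (trans (cong (16 ^_) (sym e)) (^-distribˡ-+-* 16 i j)) ⟩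
      2 * (A′ * (16 ^ i * 16 ^ j * d)) ≤⟨ *-monoʳ-≤ 2 (*-monoʳ-≤ A′ (*-monoˡ-≤ d (*-monoʳ-≤ (16 ^ i) (16^j≤ j)))) ⟩
      2 * (A′ * (16 ^ i * (16 * (target j + 1)) * d)) ≡⟨ cong (λ z → 2 * (A′ * (z * (16 * (target j + 1)) * d))) (sym (4^i*4^i i)) ⟩
      2 * (A′ * (4 ^ i * 4 ^ i * (16 * (target j + 1)) * d)) ≡⟨ lem A′ (4 ^ i) (target j + 1) d ⟩
      32 * A′ * 4 ^ i * rate i j ∎
      where lem : ∀ A p t d → 2 * (A * (p * p * (16 * t) * d)) ≡ 32 * A * p * (t * p * d)
            lem = solve-∀
    long : 32 * A′ * 4 ^ i * (3 * 16 ^ j + 2 ^ I) ≤ duration i j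
    long = begin
      32 * A′ * 4 ^ i * (3 * 16 ^ j + 2 ^ I)
        ≤⟨ *-monoʳ-≤ (32 * A′ * 4 ^ i) (+-mono-≤ (≤-trans (≤-reflexive (sym (*-identityˡ _))) (*-monoˡ-≤ (3 * 16 ^ j) (m^n>0 2 i))) (K₀-exponent i j e)) ⟩
      32 * A′ * 4 ^ i * (2 ^ i * (3 * 16 ^ j) + 2 ^ i * 16 ^ j) ≡⟨ lem A′ (4 ^ i) (2 ^ i) (16 ^ j) ⟩
      128 * A′ * (2 ^ i * 4 ^ i * 16 ^ j) ≡⟨ cong (λ z → 128 * A′ * (z * 16 ^ j)) (2^i*4^i i) ⟩
      duration i j ∎
      where lem : ∀ A p q r → 32 * A * p * (q * (3 * r) + q * r) ≡ 128 * A * (q * p * r)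
            lem = solve-∀

  -- A union bound over the levels, with two risks per level: storing and committing.
  fails-rare : ∀ j i → i + j ≡ suc I → K₀ * fails i j ≤ 2 * j * N ^ time i j
  fails-rare zero i e = ≤-trans (≤-reflexive (*-zeroʳ K₀)) z≤n
  fails-rare (suc j) i e = begin
    K₀ * fails i (suc j)
      ≡⟨ lem₁ K₀ n (fails (suc i) j) m (commitFail i j) (N ^ (duration i j + time (suc i) j)) (storeFail i j) ⟩
    n * (n * (K₀ * fails (suc i) j) + m * (K₀ * commitFail i j)) + N ^ (duration i j + time (suc i) j) * (K₀ * storeFail i j)
      ≤⟨ +-mono-≤ (*-monoʳ-≤ n (+-mono-≤ (*-monoʳ-≤ n (fails-rare j (suc i) (trans (sym (+-suc i j)) e))) (*-monoʳ-≤ m (commit-rare i j i+j≡I))))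
                  (*-monoʳ-≤ (N ^ (duration i j + time (suc i) j)) (store-rare i j i+j≡I)) ⟩
    n * (n * (2 * j * m) + m * n) + N ^ (duration i j + time (suc i) j) * n
      ≡⟨ cong (λ z → n * (n * (2 * j * m) + m * n) + z * n) (^-distribˡ-+-* N (duration i j) (time (suc i) j)) ⟩
    n * (n * (2 * j * m) + m * n) + n * m * n ≡⟨ lem₂ n m j ⟩
    2 * suc j * (n * (n * m))
      ≡⟨ cong (2 * suc j *_) (sym (trans (^-distribˡ-+-* N (duration i j) _) (cong (n *_) (^-distribˡ-+-* N (duration i j) (time (suc i) j))))) ⟩
    2 * suc j * N ^ time i (suc j) ∎
    where
    open ≤-Reasoning
    i+j≡I : i + j ≡ I
    i+j≡I = suc-injective (trans (sym (+-suc i j)) e)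
    n m : ℕ
    n = N ^ duration i j
    m = N ^ time (suc i) j
    lem₁ : ∀ K n f m c p s → K * (n * (n * f + m * c) + p * s) ≡ n * (n * (K * f) + m * (K * c)) + p * (K * s)
    lem₁ = solve-∀
    lem₂ : ∀ n m j → n * (n * (2 * j * m) + m * n) + n * m * n ≡ 2 * suc j * (n * (n * m))
    lem₂ = solve-∀

  -- Passing from (i, j+1) to (i+1, j) multiplies the duration by 8/16, so the total is at most
  -- twice the first stage, which consists of two halves.
  time-linear : ∀ j i → time i (suc j) ≤ 4 * duration i j
  time-linear zero i = begin
    duration i 0 + (duration i 0 + 0) ≤⟨ *-monoˡ-≤ (duration i 0) (≤ᵇ⇒≤ 2 4 _) ⟩
    4 * duration i 0 ∎
    where open ≤-Reasoning
  time-linear (suc j) i = begin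
    t + (t + time (suc i) (suc j)) ≤⟨ +-monoʳ-≤ t (+-monoʳ-≤ t (time-linear j (suc i))) ⟩
    t + (t + 4 * duration (suc i) j) ≡⟨ lem Cc (8 ^ i) (16 ^ j) ⟩
    4 * t ∎
    where
    open ≤-Reasoning
    t = duration i (suc j)
    lem : ∀ Γ p q → Γ * (p * (16 * q)) + (Γ * (p * (16 * q)) + 4 * (Γ * (8 * p * q))) ≡ 4 * (Γ * (p * (16 * q)))
    lem = solve-∀

  total-time : time 0 (suc I) ≤ 4 * Cc * d
  total-time = ≤-trans (time-linear I 0) (≤-reflexive (lem Cc d))
    where lem : ∀ Γ d → 4 * (Γ * (1 * d)) ≡ 4 * Γ * d
          lem = solve-∀

  2I≤ : ∀ I → 2 * I ≤ 1 + 2 ^ I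
  2I≤ zero = z≤n
  2I≤ (suc zero) = ≤ᵇ⇒≤ 2 3 _
  2I≤ (suc (suc I)) = begin
    2 * suc (suc I) ≡⟨ *-distribˡ-+ 2 1 (suc I) ⟩
    2 + 2 * suc I ≤⟨ +-mono-≤ (*-monoʳ-≤ 2 (m^n>0 2 I)) (2I≤ (suc I)) ⟩
    2 ^ suc I + (1 + 2 ^ suc I) ≡⟨ lem (2 ^ I) ⟩
    1 + 2 ^ suc (suc I) ∎
    where open ≤-Reasoning
          lem : ∀ p → 2 * p + (1 + 2 * p) ≡ 1 + 2 * (2 * p)
          lem = solve-∀

  -- The 2(I + 1) risks of size 1/K₀ add up to at most 4/2^I, since I + 1 ≤ 2^I and 2I ≤ 1 + 2^I.
  fails-final : 2 ^ I * fails 0 (suc I) ≤ 4 * N ^ time 0 (suc I)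
  fails-final = *-cancelˡ-≤ K₀ {{m^n≢0 2 (2 ^ I)}} (begin
    K₀ * (2 ^ I * fails 0 (suc I)) ≡⟨ lem₁ K₀ (2 ^ I) (fails 0 (suc I)) ⟩
    2 ^ I * (K₀ * fails 0 (suc I)) ≤⟨ *-monoʳ-≤ (2 ^ I) (fails-rare (suc I) 0 refl) ⟩
    2 ^ I * (2 * suc I * n) ≤⟨ *-monoʳ-≤ (2 ^ I) (*-monoˡ-≤ n (*-monoʳ-≤ 2 1+I≤)) ⟩
    2 ^ I * (2 * 2 ^ I * n) ≡⟨ lem₂ (2 ^ I) n ⟩
    2 * n * (2 ^ I * 2 ^ I) ≡⟨ cong (2 * n *_) (trans (sym (^-distribˡ-+-* 2 I I)) (cong (λ z → 2 ^ (I + z)) (sym (+-identityʳ I)))) ⟩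
    2 * n * 2 ^ (2 * I) ≤⟨ *-monoʳ-≤ (2 * n) (^-monoʳ-≤ 2 (2I≤ I)) ⟩
    2 * n * (2 * K₀) ≡⟨ lem₃ n K₀ ⟩
    K₀ * (4 * n) ∎)
    where
    open ≤-Reasoning
    n : ℕ
    n = N ^ time 0 (suc I)
    1+I≤ : suc I ≤ 2 ^ I
    1+I≤ = go I
      where go : ∀ I → suc I ≤ 2 ^ I
            go zero = ≤-refl
            go (suc I) = ≤-trans (+-mono-≤ (m^n>0 2 I) (go I)) (≤-reflexive (cong (2 ^ I +_) (sym (+-identityʳ _))))
    lem₁ : ∀ K p f → K * (p * f) ≡ p * (K * f)
    lem₁ = solve-∀
    lem₂ : ∀ p n → p * (2 * p * n) ≡ 2 * n * (p * p)
    lem₂ = solve-∀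
    lem₃ : ∀ n K → 2 * n * (2 * K) ≡ K * (4 * n)
    lem₃ = solve-∀

  repaired : ∀ {T bs E} → 4 * (128 * A′) * 16 ^ I ≤ T → Cycle bs E → length bs ≤ 3 * 16 ^ I → Σ[ F ∈ ℕ ] W T E F × 2 ^ I * F ≤ 4 * N ^ T
  repaired {T} {bs} {E} T-large Γ few = N ^ s * F , subst (λ z → W z E (N ^ s * F)) s+t (idle s (run (suc I) 0 refl Γ few)) , (begin
        2 ^ I * (N ^ s * F) ≡⟨ lem (2 ^ I) (N ^ s) F ⟩
        N ^ s * (2 ^ I * F) ≤⟨ *-monoʳ-≤ (N ^ s) fails-final ⟩
        N ^ s * (4 * N ^ time 0 (suc I)) ≡⟨ lem (N ^ s) 4 (N ^ time 0 (suc I)) ⟩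
        4 * (N ^ s * N ^ time 0 (suc I)) ≡⟨ cong (4 *_) (trans (sym (^-distribˡ-+-* N s (time 0 (suc I)))) (cong (N ^_) s+t)) ⟩
        4 * N ^ T ∎)
      where
      open ≤-Reasoning
      F s : ℕ
      F = fails 0 (suc I)
      s = T ∸ time 0 (suc I)
      s+t : s + time 0 (suc I) ≡ T
      s+t = m∸n+n≡m (≤-trans total-time T-large)
      lem : ∀ a b c → a * (b * c) ≡ b * (a * c)
      lem = solve-∀

-- The repair bounds the failures by a number depending on the graph and the hyperedges reached,
-- whereas `reveal` needs a function of the recorded pairs alone. The largest admissible number
-- serves all cases.
largest : ∀ p c .{{_ : NonZero p}} → ∃ λ f → p * f ≤ c × (∀ F → p * F ≤ c → F ≤ f)
largest p c = c / p , ≤-trans (≤-reflexive (*-comm p (c / p))) (m/n*n≤m c p)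
  , λ F h → subst (_≤ c / p) (trans (cong (_/ p) (*-comm p F)) (m*n/n≡m F p)) (/-monoˡ-≤ p h)

module Victory (Gm : Game) (Lay : Layout (Game.dims Gm)) (I A′ M T : ℕ)
  (T-large : 4 * (128 * A′) * 16 ^ I ≤ T) (d≡ : Layout.d Lay ≡ 16 ^ I)
  (N-upper : Game.N Gm ≤ A′ * (16 ^ I * 16 ^ I)) (N-lower : 4 * (16 ^ I * 16 ^ I) ≤ Game.N Gm)
  (u-large : 10 * Layout.d Lay ≤ Layout.u Lay) (reserve-large : 11 * Layout.d Lay ≤ # (not ∘ Layout.Rm Lay))
  (defects-rare : Layout.d Lay * PhaseB.Ex Gm M (RandomPhase.defects (Game.ℓ′ Gm) (Game.ρ Gm) (Game.ρ Gm + Game.r Gm) (Layout.d Lay) (Layout.k Lay) (Layout.q Lay))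
    ≤ 3 * Game.N Gm ^ M) where
  open Game Gm
  open PhaseB Gm
  open Layout Lay
  open RandomPhase ℓ′ ρ (ρ + r) using (defects; defects-zero)

  opaque
    the-core : ∀ {w} → Expanding d k q w → Core w d k Lm Rm
    the-core X = core X Lm Rm Lm-large Rm-large

  module _ {w : List (Fin ℓ′ × Fin ρ)} {E : List Edge} (X : Expanding d k q w) (rec : ∀ {j : Fin ℓ′} {t : Fin ρ} → (j , t) ∈ w → edge (inj₁ (suc j)) t (inj₁ (inject₁ j)) (inj₁ j) ∈ E) where
    open Opening {board} Lay w (the-core X) E
    open Closing {board} Lay w (the-core X) X E rec using (ham)

    units-fit : 8 * 16 ^ I ≤ length units
    units-fit = subst (λ z → 8 * z ≤ length units) d≡ (+-cancelʳ-≤ (d + d) _ _ (begin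
      8 * d + (d + d) ≡⟨ lem d ⟩
      10 * d ≤⟨ u-large ⟩
      u ≤⟨ units-many ⟩
      length units + (d + d) ∎))
      where open ≤-Reasoning
            lem : ∀ d → 8 * d + (d + d) ≡ 10 * d
            lem = solve-∀

    pool-fits : 10 * 16 ^ I ≤ length pool
    pool-fits = subst (λ z → 10 * z ≤ length pool) d≡ (+-cancelʳ-≤ d _ _ (begin
      10 * d + d ≡⟨ +-comm (10 * d) d ⟩
      11 * d ≤⟨ reserve-large ⟩
      # (not ∘ Rm) ≤⟨ pool-many ⟩
      length pool + d ∎))
      where open ≤-Reasoning

    few : length bs₀ ≤ 3 * 16 ^ I
    few = subst (λ z → length bs₀ ≤ 3 * z) d≡ (≤-trans bs₀-length (≤-trans (+-monoʳ-≤ d (+-monoˡ-≤ d (≤-trans (m^n>0 16 I) (≤-reflexive (sym d≡))))) (≤-reflexive (lem d))))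
      where lem : ∀ d → d + (d + d) ≡ 3 * d
            lem = solve-∀

    repair-in-time : Σ[ F ∈ ℕ ] W T E F × 2 ^ I * F ≤ 4 * N ^ T
    repair-in-time = Schedule.repaired Gm plan I A′ N-upper N-lower (cong₂ (λ x y → x + suc y) d≡ d≡) units-fit pool-fits ham {T} {bs₀} {E} T-large start few

  quotas : ∃ λ f → 2 ^ I * f ≤ 4 * N ^ T × (∀ F → 2 ^ I * F ≤ 4 * N ^ T → F ≤ f)
  quotas = largest (2 ^ I) (4 * N ^ T) {{m^n≢0 2 I}}

  quota : ℕ
  quota = proj₁ quotas

  φ : List (Fin ℓ′ × Fin ρ) → ℕ
  φ w = defects d k q (reverse w) * N ^ T + quota

  after-reveal : ∀ w E → Recorded w E → W T E (φ w)
  after-reveal w E rec = cases (defects d k q (reverse w)) refl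
    where
    cases : ∀ D → defects d k q (reverse w) ≡ D → W T E (D * N ^ T + quota)
    cases (suc D) _ = W-mono {T} {E} {N ^ T} {suc D * N ^ T + quota} (≤-trans (m≤m+n (N ^ T) (D * N ^ T)) (m≤m+n (N ^ T + D * N ^ T) quota)) (W-lose {T} {E})
    cases zero eq = conclude (repair-in-time {reverse w} {E} (defects-zero {d} {k} {q} {reverse w} eq) (λ {j} {t} m → rec {j} {t} (∈-resp-↭ (↭-reverse w) m)))
      where
      conclude : Σ[ F ∈ ℕ ] W T E F × 2 ^ I * F ≤ 4 * N ^ T → W T E quota
      conclude (F , win , bound) = W-mono {T} {E} {F} {quota} (proj₂ (proj₂ quotas) F bound) win

  -- A sequence with defects is given up entirely, which costs at most 3/d ≤ 3/2^I; the repair costs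
  -- at most 4/2^I. Hence the 7.
  victory : Σ[ F ∈ ℕ ] W (M + T) [] F × 2 ^ I * F ≤ 7 * N ^ (M + T)
  victory = _ , reveal M φ [] [] (λ ()) after-reveal , (begin
    2 ^ I * Ex M (λ w → φ (reverse w ++ []))
      ≡⟨ cong (2 ^ I *_) (trans (Ex-cong M straight) (trans (Ex-+ M _ _) (cong₂ _+_ (trans (Ex-cong M (λ w → *-comm (defects d k q w) (N ^ T))) (Ex-*ˡ M (N ^ T) (defects d k q)))
          (trans (Ex-const M quota) (cong (λ z → z ^ M * quota) N≡))))) ⟩
    2 ^ I * (N ^ T * ex + N ^ M * quota) ≡⟨ lem₁ (2 ^ I) (N ^ T) ex (N ^ M) quota ⟩
    N ^ T * (2 ^ I * ex) + N ^ M * (2 ^ I * quota)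
      ≤⟨ +-mono-≤ (*-monoʳ-≤ (N ^ T) (≤-trans (*-monoˡ-≤ ex (≤-trans (^-monoˡ-≤ I {2} {16} (≤ᵇ⇒≤ 2 16 _)) (≤-reflexive (sym d≡)))) defects-rare)) (*-monoʳ-≤ (N ^ M) (proj₁ (proj₂ quotas))) ⟩
    N ^ T * (3 * N ^ M) + N ^ M * (4 * N ^ T) ≡⟨ lem₂ (N ^ T) (N ^ M) ⟩
    7 * (N ^ M * N ^ T) ≡⟨ cong (7 *_) (sym (^-distribˡ-+-* N M T)) ⟩
    7 * N ^ (M + T) ∎)
    where
    open ≤-Reasoning
    ex : ℕ
    ex = Ex M (defects d k q)
    straight : ∀ w → φ (reverse w ++ []) ≡ defects d k q w * N ^ T + quota
    straight w = cong (λ v → defects d k q v * N ^ T + quota)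
      (trans (cong reverse (++-identityʳ (reverse w))) (reverse-involutive w))
    lem₁ : ∀ p t e m u → p * (t * e + m * u) ≡ t * (p * e) + m * (p * u)
    lem₁ = solve-∀
    lem₂ : ∀ t m → t * (3 * m) + m * (4 * t) ≡ 7 * (m * t)
    lem₂ = solve-∀

-- Offers as finite sets, and games as trees

offerᵢ : ∀ {n r} → Offer n r → Offer (suc n) (suc r)
offerᵢ (p , e) = inside ∷ p , cong suc e

offerₒ : ∀ {n r} → Offer n r → Offer (suc n) r
offerₒ (p , e) = outside ∷ p , e

offer-≡ : ∀ {n r} {A B : Offer n r} → proj₁ A ≡ proj₁ B → A ≡ B
offer-≡ {A = p , e} {.p , e′} refl = cong (p ,_) (≡-irrelevant e e′)

offers : ∀ n r → List (Offer n r)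
offers zero zero = ([] , refl) ∷ []
offers zero (suc r) = []
offers (suc n) zero = map offerₒ (offers n zero)
offers (suc n) (suc r) = map offerᵢ (offers n r) ++ map offerₒ (offers n (suc r))

∈-offers : ∀ n r (A : Offer n r) → A ∈ offers n r
∈-offers zero zero ([] , refl) = here refl
∈-offers (suc n) zero (outside ∷ p , e) = ∈-map⁺ offerₒ (∈-offers n zero (p , e))
∈-offers (suc n) (suc r) (outside ∷ p , e) = ∈-++⁺ʳ (map offerᵢ (offers n r)) (∈-map⁺ offerₒ (∈-offers n (suc r) (p , e)))
∈-offers (suc n) (suc r) (inside ∷ p , e) = ∈-++⁺ˡ (subst (_∈ map offerᵢ (offers n r)) (offer-≡ refl) (∈-map⁺ offerᵢ (∈-offers n r (p , suc-injective e))))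

offerₒ-injective : ∀ {n r} {A B : Offer n r} → offerₒ A ≡ offerₒ B → A ≡ B
offerₒ-injective e = offer-≡ (∷-inj (cong proj₁ e))
  where ∷-inj : ∀ {n x} {p q : Subset n} → x ∷ p ≡ x ∷ q → p ≡ q
        ∷-inj refl = refl

offerᵢ-injective : ∀ {n r} {A B : Offer n r} → offerᵢ A ≡ offerᵢ B → A ≡ B
offerᵢ-injective e = offer-≡ (∷-inj (cong proj₁ e))
  where ∷-inj : ∀ {n x} {p q : Subset n} → x ∷ p ≡ x ∷ q → p ≡ q
        ∷-inj refl = refl

offers-unique : ∀ n r → Unique (offers n r)
offers-unique zero zero = [] ∷ []
offers-unique zero (suc r) = []
offers-unique (suc n) zero = UP.map⁺ offerₒ-injective (offers-unique n zero)
offers-unique (suc n) (suc r) = UP.++⁺ (UP.map⁺ offerᵢ-injective (offers-unique n r)) (UP.map⁺ offerₒ-injective (offers-unique n (suc r))) disj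
  where
  disj : ∀ {A} → ¬ (A ∈ map offerᵢ (offers n r) × A ∈ map offerₒ (offers n (suc r)))
  disj (m , m′) with ∈-map⁻ offerᵢ m | ∈-map⁻ offerₒ m′
  ... | _ , _ , refl | _ , _ , ()

length-offers : ∀ n r → length (offers n r) ≡ n C r
length-offers zero zero = refl
length-offers zero (suc r) = refl
length-offers (suc n) zero = trans (length-map offerₒ (offers n zero)) (length-offers n zero)
length-offers (suc n) (suc r) = begin
  length (map offerᵢ (offers n r) ++ map offerₒ (offers n (suc r))) ≡⟨ length-++ (map offerᵢ (offers n r)) ⟩
  length (map offerᵢ (offers n r)) + length (map offerₒ (offers n (suc r))) ≡⟨ cong₂ _+_ (trans (length-map _ (offers n r)) (length-offers n r)) (trans (length-map _ (offers n (suc r))) (length-offers n (suc r))) ⟩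
  n C r + n C suc r ≡⟨ nCk+nC[k+1]≡[n+1]C[k+1] n r ⟩
  suc n C suc r ∎
  where open ≡-Reasoning

addEdge : ∀ {n r s} (A : Offer n r) → Response n r s A → List (Subset n) → List (Subset n)
addEdge A nothing E = E
addEdge A (just (B , _)) E = (proj₁ A ∪ B) ∷ E

edgesOf-∷ : ∀ {n r s} A (B : Response n r s A) h → edgesOf ((A , B) ∷ h) ≡ addEdge A B (edgesOf h)
edgesOf-∷ A nothing h = refl
edgesOf-∷ A (just _) h = refl

sequences : ∀ {O : Set} → List O → ∀ T → List (Vec O T)
sequences os zero = [] ∷ []
sequences os (suc T) = concatMap (λ A → map (A ∷_) (sequences os T)) os

branches-unique : ∀ {O : Set} {T} (g : O → List (Vec O T)) {os} → Unique os → (∀ A → Unique (g A)) →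
  Unique (concatMap (λ A → map (A ∷_) (g A)) os)
branches-unique g [] h = []
branches-unique {O} {T} g {A ∷ os} (A∉ ∷ u) h = UP.++⁺ (UP.map⁺ (λ { refl → refl }) (h A)) (branches-unique g u h) disj
  where
  heads : ∀ os {ω} → ω ∈ concatMap (λ A → map (A ∷_) (g A)) os → Data.Vec.head ω ∈ os
  heads (B ∷ os) m with ∈-++⁻ (map (B ∷_) (g B)) m
  ... | inj₁ k with ∈-map⁻ (B ∷_) k
  ...   | _ , _ , refl = here refl
  heads (B ∷ os) m | inj₂ k = there (heads os k)
  disj : ∀ {ω} → ¬ (ω ∈ map (A ∷_) (g A) × ω ∈ concatMap (λ A → map (A ∷_) (g A)) os)
  disj (m , m′) with ∈-map⁻ (A ∷_) m
  ... | _ , _ , refl = All.lookup A∉ (heads os m′) refl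

sequences-unique : ∀ {O : Set} {os : List O} → Unique os → ∀ T → Unique (sequences os T)
sequences-unique u zero = [] ∷ []
sequences-unique u (suc T) = branches-unique (λ _ → sequences _ T) u (λ _ → sequences-unique u T)

length-branches : ∀ {O : Set} {T} (g : O → List (Vec O T)) os → length (concatMap (λ A → map (A ∷_) (g A)) os) ≡ ∑ os (length ∘ g)
length-branches g [] = refl
length-branches g (A ∷ os) = trans (length-++ (map (A ∷_) (g A))) (cong₂ _+_ (length-map (A ∷_) (g A)) (length-branches g os))

length-sequences : ∀ {O : Set} (os : List O) T → length (sequences os T) ≡ length os ^ T
length-sequences os zero = refl
length-sequences os (suc T) = trans (length-branches (λ _ → sequences os T) os) (trans (∑-const os _) (cong (length os *_) (length-sequences os T)))

module Trees (n r s : ℕ) .{{_ : NonZero n}} where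

  -- A strategy tree in which at most F of the offer sequences of length T lead to failure.
  data Win : ℕ → List (Subset n) → ℕ → Set where
    stop : ∀ {T E F} → ContainsLooseHamCycle s E → Win T E F
    lose : ∀ {T E F} → (n C r) ^ T ≤ F → Win T E F
    step : ∀ {T E F} (f : Offer n r → ℕ) → (∀ A → Σ[ B ∈ Response n r s A ] Win T (addEdge A B E) (f A)) →
      ∑ (offers n r) f ≤ F → Win (suc T) E F

  Win-mono : ∀ {T E F F′} → F ≤ F′ → Win T E F → Win T E F′
  Win-mono le (stop h) = stop h
  Win-mono le (lose h) = lose (≤-trans h le)
  Win-mono le (step f ch h) = step f ch (≤-trans h le)

  -- A strategy sees only the history. Replaying the past offers from the root finds the current
  -- subtree, which carries the response; stopped and lost positions absorb all further offers.
  Position : Set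
  Position = Σ[ T ∈ ℕ ] Σ[ E ∈ List (Subset n) ] Σ[ F ∈ ℕ ] Win T E F

  respond : Position → (A : Offer n r) → Response n r s A
  respond (_ , _ , _ , step f ch h) A = proj₁ (ch A)
  respond _ A = nothing

  next : Position → Offer n r → Position
  next (_ , _ , _ , step f ch h) A = _ , _ , _ , proj₂ (ch A)
  next p A = p

  locate : Position → List (Round n r s) → Position
  locate p [] = p
  locate p ((A , _) ∷ h) = next (locate p h) A

  strategy : Position → Strategy n r s
  strategy p h A = respond (locate p h) A

  -- The offer sequences that certainly succeed: every sequence below `stop` and none below `lose`.
  goods : ∀ {T E F} → Win T E F → List (Vec (Offer n r) T)
  goods {T} (stop h) = sequences (offers n r) T
  goods (lose h) = []
  goods (step f ch h) = concatMap (λ A → map (A ∷_) (goods (proj₂ (ch A)))) (offers n r)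

  goods-unique : ∀ {T E F} (w : Win T E F) → Unique (goods w)
  goods-unique {T} (stop h) = sequences-unique (offers-unique n r) T
  goods-unique (lose h) = []
  goods-unique (step f ch h) = branches-unique (λ A → goods (proj₂ (ch A))) (offers-unique n r) (λ A → goods-unique (proj₂ (ch A)))

  goods-many : ∀ {T E F} (w : Win T E F) → (n C r) ^ T ≤ F + length (goods w)
  goods-many {T} {E} {F} (stop h) = ≤-trans (≤-reflexive (trans (cong (_^ T) (sym (length-offers n r))) (sym (length-sequences (offers n r) T)))) (m≤n+m _ F)
  goods-many {F = F} (lose h) = ≤-trans h (m≤m+n F 0)
  goods-many {suc T} {E} {F} (step f ch h) = begin
    (n C r) * (n C r) ^ T ≡⟨ trans (cong (_* (n C r) ^ T) (sym (length-offers n r))) (sym (∑-const (offers n r) _)) ⟩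
    ∑ (offers n r) (λ _ → (n C r) ^ T) ≤⟨ ∑-mono (offers n r) (λ A → goods-many (proj₂ (ch A))) ⟩
    ∑ (offers n r) (λ A → f A + length (goods (proj₂ (ch A)))) ≡⟨ ∑-+ (offers n r) f _ ⟩
    ∑ (offers n r) f + ∑ (offers n r) (λ A → length (goods (proj₂ (ch A)))) ≤⟨ +-monoˡ-≤ _ h ⟩
    F + ∑ (offers n r) (λ A → length (goods (proj₂ (ch A)))) ≡⟨ cong (F +_) (sym (length-branches (λ A → goods (proj₂ (ch A))) (offers n r))) ⟩
    F + length (concatMap (λ A → map (A ∷_) (goods (proj₂ (ch A)))) (offers n r)) ∎
    where open ≤-Reasoning

  -- A stopped position ignores every offer, so the hyperedges present when the cycle was completed
  -- are exactly the final ones.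
  after-stop : ∀ p h {T E F} {ham : ContainsLooseHamCycle s E} → locate p h ≡ (T , E , F , stop ham) → edgesOf h ≡ E →
    ∀ {T′} (ω : Vec (Offer n r) T′) → edgesOf (play (strategy p) h ω) ≡ E
  after-stop p h eq edges [] = edges
  after-stop p h eq edges (A ∷ ω) = after-stop p ((A , strategy p h A) ∷ h) (cong (λ q → next q A) eq)
    (trans (edgesOf-∷ A (strategy p h A) h) (trans (cong (λ q → addEdge A (respond q A) (edgesOf h)) eq) edges)) ω

  goods-ham : ∀ p h {T E F} (w : Win T E F) → locate p h ≡ (T , E , F , w) → edgesOf h ≡ E →
    ∀ {ω} → ω ∈ goods w → ContainsLooseHamCycle s (edgesOf (play (strategy p) h ω))
  goods-ham p h (stop ham) eq edges {ω} m = subst (ContainsLooseHamCycle s) (sym (after-stop p h eq edges ω)) ham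
  goods-ham p h {suc T} {E} (step f ch le) eq edges {A ∷ ω} m with branch (offers n r) m
    where
    branch : ∀ os {ω : Vec (Offer n r) T} → A ∷ ω ∈ concatMap (λ A → map (A ∷_) (goods (proj₂ (ch A)))) os → ω ∈ goods (proj₂ (ch A))
    branch (B ∷ os) m with ∈-++⁻ (map (B ∷_) (goods (proj₂ (ch B)))) m
    ... | inj₁ k with ∈-map⁻ (B ∷_) k
    ...   | _ , mω , refl = mω
    branch (B ∷ os) m | inj₂ k = branch os k
  ... | mω = goods-ham p ((A , strategy p h A) ∷ h) (proj₂ (ch A)) (cong (λ q → next q A) eq)
    (trans (edgesOf-∷ A (strategy p h A) h) (cong₂ (λ q E′ → addEdge A (respond q A) E′) eq edges)) mω

-- Embedding the board into the vertex set

vset : ∀ {n} → List (Fin n) → Subset n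
vset xs = Sub.⋃ (map ⁅_⁆ xs)

module _ {n : ℕ} where

  ∈-vset⁺ : ∀ {x : Fin n} {xs} → x ∈ xs → x Sub.∈ vset xs
  ∈-vset⁺ {x} {y ∷ xs} (here refl) = SubP.x∈p∪q⁺ (inj₁ (SubP.x∈⁅x⁆ x))
  ∈-vset⁺ {x} {y ∷ xs} (there m) = SubP.x∈p∪q⁺ {p = ⁅ y ⁆} (inj₂ (∈-vset⁺ m))

  ∈-vset⁻ : ∀ {x : Fin n} xs → x Sub.∈ vset xs → x ∈ xs
  ∈-vset⁻ [] m = ⊥-elim (SubP.∉⊥ m)
  ∈-vset⁻ (y ∷ xs) m with SubP.x∈p∪q⁻ ⁅ y ⁆ (vset xs) m
  ... | inj₁ k = here (SubP.x∈⁅y⁆⇒x≡y y k)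
  ... | inj₂ k = there (∈-vset⁻ xs k)

  vset-≡ : ∀ {xs ys : List (Fin n)} → (∀ {x} → x ∈ xs → x ∈ ys) → (∀ {x} → x ∈ ys → x ∈ xs) → vset xs ≡ vset ys
  vset-≡ {xs} {ys} h k = SubP.⊆-antisym (λ m → ∈-vset⁺ (h (∈-vset⁻ xs m))) (λ m → ∈-vset⁺ (k (∈-vset⁻ ys m)))

  vset-++ : ∀ (xs ys : List (Fin n)) → vset xs ∪ vset ys ≡ vset (xs ++ ys)
  vset-++ [] ys = SubP.∪-identityˡ (vset ys)
  vset-++ (x ∷ xs) ys = trans (SubP.∪-assoc ⁅ x ⁆ (vset xs) (vset ys)) (cong (⁅ x ⁆ ∪_) (vset-++ xs ys))

  vset-disjoint : ∀ {xs ys : List (Fin n)} → (∀ {x} → x ∈ xs → x ∉ ys) → vset xs ∩ vset ys ≡ Sub.⊥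
  vset-disjoint {xs} {ys} h = SubP.Empty-unique λ { (x , m) → let p , q = SubP.x∈p∩q⁻ (vset xs) (vset ys) m in h (∈-vset⁻ xs p) (∈-vset⁻ ys q) }

∣insert∣ : ∀ {n} (x : Fin n) (p : Subset n) → x Sub.∉ p → ∣ ⁅ x ⁆ ∪ p ∣ ≡ suc ∣ p ∣
∣insert∣ zero (inside ∷ p) h = ⊥-elim (h Data.Vec.here)
∣insert∣ {suc n} zero (outside ∷ p) h = cong suc (cong ∣_∣ (SubP.∪-identityˡ p))
∣insert∣ (suc x) (inside ∷ p) h = cong suc (∣insert∣ x p (h ∘ Data.Vec.there))
∣insert∣ (suc x) (outside ∷ p) h = ∣insert∣ x p (h ∘ Data.Vec.there)

∣vset∣ : ∀ {n} {xs : List (Fin n)} → Unique xs → ∣ vset xs ∣ ≡ length xs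
∣vset∣ {n} {[]} u = SubP.∣⊥∣≡0 n
∣vset∣ {n} {x ∷ xs} (x∉ ∷ u) = trans (∣insert∣ x (vset xs) (λ m → All.lookup x∉ (∈-vset⁻ xs m) refl)) (cong suc (∣vset∣ u))

tabulate-unique⁻ : ∀ {n} {f : Fin n → A} → Unique (tabulate f) → ∀ {i j} → f i ≡ f j → i ≡ j
tabulate-unique⁻ {n = suc n} u {zero} {zero} e = refl
tabulate-unique⁻ {n = suc n} {f} (f∉ ∷ u) {zero} {suc j} e = ⊥-elim (All.lookup f∉ (∈-tabulate⁺ {f = f ∘ suc} j) e)
tabulate-unique⁻ {n = suc n} {f} (f∉ ∷ u) {suc i} {zero} e = ⊥-elim (All.lookup f∉ (∈-tabulate⁺ {f = f ∘ suc} i) (sym e))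
tabulate-unique⁻ {n = suc n} (f∉ ∷ u) {suc i} {suc j} e = cong suc (tabulate-unique⁻ u e)

injective⇒surjective : ∀ {n} (f : Fin n → Fin n) → (∀ {i j} → f i ≡ f j → i ≡ j) → ∀ y → ∃ λ x → f x ≡ y
injective⇒surjective {n} f inj y with FinP.any? (λ x → f x FinP.≟ y)
... | yes p = p
... | no none = ⊥-elim (<-irrefl refl (≤-trans (≤-reflexive (cong suc (sym (trans (length-map f (allFin n)) (length-allFin n)))))
  (≤-trans (unique-length-≤ {xs = y ∷ map f (allFin n)} {allFin n} (AllP.¬Any⇒All¬ _ y∉ ∷ UP.map⁺ inj (UP.allFin⁺ n)) (λ _ → ∈-allFin _)) (≤-reflexive (length-allFin n)))))
  where
  y∉ : y ∉ map f (allFin n)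
  y∉ m with ∈-map⁻ f m
  ... | x , _ , e = none (x , sym e)

-- Reads a walk of n links as a function on its n + 1 vertices, so that the end of one link is
-- literally the start of the next.
walk-vertices : ∀ {V L : Set} {Ok : V → L → V → Set} {n u z} (g : Fin n → V × L) → Walk Ok u (tabulate g) z →
  Σ[ f ∈ (Fin (suc n) → V) ] f zero ≡ u × f (fromℕ n) ≡ z × (∀ i → proj₁ (g i) ≡ f (inject₁ i)) × (∀ i → Ok (f (inject₁ i)) (proj₂ (g i)) (f (suc i)))
walk-vertices {n = zero} {u} g [] = (λ _ → u) , refl , refl , (λ ()) , (λ ())
walk-vertices {V} {Ok = Ok} {n = suc n} {u} g (ok ∷ w) with walk-vertices (g ∘ suc) w
... | f , refl , e₂ , e₃ , e₄ = f′ , refl , e₂ , e₃′ , e₄′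
  where
  f′ : Fin (suc (suc n)) → V
  f′ zero = proj₁ (g zero)
  f′ (suc i) = f i
  e₃′ : ∀ i → proj₁ (g i) ≡ f′ (inject₁ i)
  e₃′ zero = refl
  e₃′ (suc i) = e₃ i
  e₄′ : ∀ i → Ok (f′ (inject₁ i)) (proj₂ (g i)) (f′ (suc i))
  e₄′ zero = ok
  e₄′ (suc i) = e₄ i

top-view : ∀ {n} (k : Fin (suc n)) → (∃ λ i → k ≡ inject₁ i) ⊎ k ≡ fromℕ n
top-view {zero} zero = inj₂ refl
top-view {suc n} zero = inj₁ (zero , refl)
top-view {suc n} (suc k) with top-view k
... | inj₁ (i , e) = inj₁ (suc i , cong suc e)
... | inj₂ e = inj₂ (cong suc e)

mod-cast : ∀ a {n} .{{_ : NonZero n}} (q : Fin n) c → a ≡ toℕ q + c * n → a mod n ≡ q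
mod-cast a {n} q c e = FinP.toℕ-injective (begin
  toℕ (a mod n) ≡⟨ FinP.toℕ-fromℕ< _ ⟩
  a % n ≡⟨ cong (_% n) e ⟩
  (toℕ q + c * n) % n ≡⟨ [m+kn]%n≡m%n (toℕ q) c n ⟩
  toℕ q % n ≡⟨ m<n⇒m%n≡m (FinP.toℕ<n q) ⟩
  toℕ q ∎)
  where open ≡-Reasoning

module Embedding (D : Dims) (s′ n : ℕ) .{{n≢0 : NonZero n}}
  (ι : Dims.J D ⊎ (Dims.Block D × Fin s′) → Fin n) (ι-injective : ∀ {x y : Dims.J D ⊎ (Dims.Block D × Fin s′)} → ι x ≡ ι y → x ≡ y)
  (size≡ : (suc (Dims.ℓ′ D) + Dims.e D) * (2 + s′) ≡ n) where
  open Dims D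

  s S m : ℕ
  s = 3 + s′
  S = 2 + s′
  m = suc ℓ′ + e

  ιj : J → Fin n
  ιj v = ι (inj₁ v)

  ιt : Fin ρ → Fin n
  ιt t = ι (inj₁ (inj₂ t))

  ιb : Block → Fin s′ → Fin n
  ιb β k = ι (inj₂ (β , k))

  blockList : Block → List (Fin n)
  blockList β = map (ιb β) (allFin s′)

  corners : J → Fin ρ → J → Block → List (Fin n)
  corners u t w β = ιj u ∷ ιt t ∷ ιj w ∷ blockList β

  edge : J → Fin ρ → J → Block → Subset n
  edge u t w β = vset (corners u t w β)

  edge-sym : ∀ u t w β → edge u t w β ≡ edge w t u β
  edge-sym u t w β = vset-≡ flip flip
    where
    flip : ∀ {u w x} → x ∈ corners u t w β → x ∈ corners w t u β
    flip (here p) = there (there (here p))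
    flip (there (here p)) = there (here p)
    flip (there (there (here p))) = here p
    flip (there (there (there p))) = there (there (there p))

  board : ℕ → Board
  board r = record { dims = D ; Edge = Subset n ; edge = edge ; edge-sym = edge-sym ; r = r }

  module _ {r : ℕ} {E : List (Subset n)} (H : HamCycle (board r) E) where
    open HamCycle H

    entry : Fin m → J × Fin ρ × Block
    entry = proj₁ (enumerate es size)

    entry≡ : tabulate entry ≡ es
    entry≡ = proj₂ (enumerate es size)

    jn : Fin m → J
    jn i = proj₁ (entry i)

    tk : Fin m → Fin ρ
    tk i = proj₁ (proj₂ (entry i))

    bl : Fin m → Block
    bl i = proj₂ (proj₂ (entry i))

    unique-field : ∀ {Y : Set} (p : J × Fin ρ × Block → Y) → Unique (map p es) → ∀ {i j} → p (entry i) ≡ p (entry j) → i ≡ j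
    unique-field p u = tabulate-unique⁻ (subst Unique (trans (cong (map p) (sym entry≡)) (map-tabulate entry p)) u)

    ∈-field : ∀ {Y : Set} (p : J × Fin ρ × Block → Y) i → p (entry i) ∈ map p es
    ∈-field p i = ∈-map⁺ p (subst (entry i ∈_) entry≡ (∈-tabulate⁺ {f = entry} i))

    -- The vertex order along the cycle: position i * S holds the i-th junction, the next position
    -- its token, the remaining ones its block. The second junction of a hyperedge opens the next
    -- group.
    cell : Fin m → Fin S → J ⊎ (Block × Fin s′)
    cell i zero = inj₁ (jn i)
    cell i (suc zero) = inj₁ (inj₂ (tk i))
    cell i (suc (suc k)) = inj₂ (bl i , k)

    clash : ∀ {i i′} → jn i ≢ inj₂ (tk i′)
    clash {i} {i′} e = disjoint (∈-field (proj₁ ∘ proj₂) i′) (subst (_∈ map proj₁ es) e (∈-field proj₁ i))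

    cell-injective : ∀ {i j i′ j′} → cell i j ≡ cell i′ j′ → i ≡ i′ × j ≡ j′
    cell-injective {j = zero} {j′ = zero} e = unique-field proj₁ junctions-unique (inj₁-injective e) , refl
    cell-injective {i} {zero} {i′} {suc zero} e = ⊥-elim (clash {i} {i′} (inj₁-injective e))
    cell-injective {j = zero} {j′ = suc (suc _)} ()
    cell-injective {i} {suc zero} {i′} {zero} e = ⊥-elim (clash {i′} {i} (inj₁-injective (sym e)))
    cell-injective {j = suc zero} {j′ = suc zero} e = unique-field (proj₁ ∘ proj₂) tokens-unique (inj-inj e) , refl
      where inj-inj : ∀ {x y : Fin ρ} → inj₁ {B = Block × Fin s′} (inj₂ {A = X} x) ≡ inj₁ (inj₂ y) → x ≡ y
            inj-inj refl = refl
    cell-injective {j = suc zero} {j′ = suc (suc _)} ()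
    cell-injective {j = suc (suc _)} {j′ = zero} ()
    cell-injective {j = suc (suc _)} {j′ = suc zero} ()
    cell-injective {j = suc (suc k)} {j′ = suc (suc k′)} e = unique-field (proj₂ ∘ proj₂) blocks-unique (inj-block e) , cong (λ z → suc (suc z)) (inj-k e)
      where inj-block : ∀ {x y : Block} {k k′ : Fin s′} → inj₂ {A = J} (x , k) ≡ inj₂ (y , k′) → x ≡ y
            inj-block refl = refl
            inj-k : ∀ {x y : Block} {k k′ : Fin s′} → inj₂ {A = J} (x , k) ≡ inj₂ (y , k′) → k ≡ k′
            inj-k refl = refl

    coords : Fin n → Fin m × Fin S
    coords x = remQuot S (cast (sym size≡) x)

    place : Fin m → Fin S → Fin n
    place i j = cast size≡ (combine i j)

    toℕ-place : ∀ i j → toℕ (place i j) ≡ toℕ i * S + toℕ j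
    toℕ-place i j = trans (FinP.toℕ-cast size≡ (combine i j)) (trans (FinP.toℕ-combine i j) (cong (_+ toℕ j) (*-comm S (toℕ i))))

    coords-place : ∀ i j → coords (place i j) ≡ (i , j)
    coords-place i j = trans (cong (remQuot S) (FinP.cast-involutive (sym size≡) size≡ (combine i j))) (FinP.remQuot-combine i j)

    place-coords : ∀ x → place (proj₁ (coords x)) (proj₂ (coords x)) ≡ x
    place-coords x = trans (cong (cast size≡) (FinP.combine-remQuot {m} S (cast (sym size≡) x))) (FinP.cast-involutive size≡ (sym size≡) x)

    layout : Fin n → Fin n
    layout x = ι (cell (proj₁ (coords x)) (proj₂ (coords x)))

    layout-place : ∀ i j → layout (place i j) ≡ ι (cell i j)
    layout-place i j = cong (λ c → ι (cell (proj₁ c) (proj₂ c))) (coords-place i j)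

    layout-injective : ∀ {x y} → layout x ≡ layout y → x ≡ y
    layout-injective {x} {y} e with cell-injective (ι-injective e)
    ... | p , q = trans (sym (place-coords x)) (trans (cong₂ place p q) (place-coords y))

    inverse : Fin n → Fin n
    inverse y = proj₁ (injective⇒surjective layout layout-injective y)

    layout-inverse : ∀ y → layout (inverse y) ≡ y
    layout-inverse y = proj₂ (injective⇒surjective layout layout-injective y)

    ordering : Permutation′ n
    ordering = permutation layout inverse layout-inverse (λ x → layout-injective (layout-inverse (layout x)))

    visited = walk-vertices {Ok = Linked′} entry (subst (λ ys → Walk Linked′ o ys o) (sym entry≡) walk)
      where
      Linked′ : J → Fin ρ × Block → J → Set
      Linked′ = Board.Linked (board r) E

    f : Fin (suc m) → J
    f = proj₁ visited

    f-closed : f zero ≡ f (fromℕ m)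
    f-closed = trans (proj₁ (proj₂ visited)) (sym (proj₁ (proj₂ (proj₂ visited))))

    f-jn : ∀ i → jn i ≡ f (inject₁ i)
    f-jn = proj₁ (proj₂ (proj₂ (proj₂ visited)))

    linked : ∀ i → edge (jn i) (tk i) (f (suc i)) (bl i) ∈ E
    linked i = subst (λ v → edge v (tk i) (f (suc i)) (bl i) ∈ E) (sym (f-jn i)) (proj₂ (proj₂ (proj₂ (proj₂ visited))) i)

    at : Fin m → ℕ → Fin n
    at i a = layout ((toℕ i * S + a) mod n)

    at-inside : ∀ i (j : Fin S) → at i (toℕ j) ≡ ι (cell i j)
    at-inside i j = trans (cong layout (mod-cast (toℕ i * S + toℕ j) (place i j) 0 (trans (sym (toℕ-place i j)) (sym (+-identityʳ _))))) (layout-place i j)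

    -- The last vertex of a segment opens the following group. For the final segment the position is
    -- n, which wraps around to 0, where the closed walk has the same junction.
    at-end : ∀ i → at i S ≡ ιj (f (suc i))
    at-end i with suc (toℕ i) <? m
    ... | yes i<m = trans (cong layout (mod-cast (toℕ i * S + S) (place i⁺ zero) 0 eq)) (trans (layout-place i⁺ zero) (cong ιj (trans (f-jn i⁺) (cong f up))))
      where
      i⁺ : Fin m
      i⁺ = fromℕ< i<m
      up : inject₁ i⁺ ≡ suc i
      up = FinP.toℕ-injective (trans (FinP.toℕ-inject₁ i⁺) (FinP.toℕ-fromℕ< i<m))
      eq : toℕ i * S + S ≡ toℕ (place i⁺ zero) + 0
      eq = trans (+-comm (toℕ i * S) S) (sym (trans (+-identityʳ _) (trans (toℕ-place i⁺ zero) (trans (+-identityʳ _) (cong (_* S) (FinP.toℕ-fromℕ< i<m))))))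
    ... | no i≮m = trans (cong layout (mod-cast (toℕ i * S + S) (place zero zero) 1 eq)) (trans (layout-place zero zero) (cong ιj (trans (f-jn zero) (trans f-closed (cong f up)))))
      where
      last : suc (toℕ i) ≡ m
      last = ≤-antisym (FinP.toℕ<n i) (≮⇒≥ i≮m)
      up : fromℕ m ≡ suc i
      up = FinP.toℕ-injective (trans (FinP.toℕ-fromℕ m) (sym last))
      eq : toℕ i * S + S ≡ toℕ (place zero zero) + 1 * n
      eq = trans (+-comm (toℕ i * S) S) (trans (cong (_* S) last) (trans size≡ (sym (trans (cong (_+ (n + 0)) (toℕ-place zero zero)) (+-identityʳ n)))))

    segment-edge : ∀ i → segment s ordering (toℕ i) ≡ edge (jn i) (tk i) (f (suc i)) (bl i)
    segment-edge i = trans (cong Sub.⋃ (map-∘ (allFin s))) (vset-≡ to from)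
      where
      g : Fin s → Fin n
      g j = at i (toℕ j)
      target : List (Fin n)
      target = corners (jn i) (tk i) (f (suc i)) (bl i)
      g-inner : ∀ k → g (suc (suc (inject₁ k))) ≡ ιb (bl i) k
      g-inner k = trans (cong (λ z → at i (suc (suc z))) (FinP.toℕ-inject₁ k)) (at-inside i (suc (suc k)))
      g-top : g (suc (suc (fromℕ s′))) ≡ ιj (f (suc i))
      g-top = trans (cong (λ z → at i (suc (suc z))) (FinP.toℕ-fromℕ s′)) (at-end i)
      g-in : ∀ j → g j ∈ target
      g-in zero = here (at-inside i zero)
      g-in (suc zero) = there (here (at-inside i (suc zero)))
      g-in (suc (suc k)) with top-view k
      ... | inj₁ (k′ , refl) = there (there (there (subst (_∈ blockList (bl i)) (sym (g-inner k′)) (∈-map⁺ (ιb (bl i)) (∈-allFin k′)))))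
      ... | inj₂ refl = there (there (here g-top))
      to : ∀ {x} → x ∈ map g (allFin s) → x ∈ target
      to m with ∈-map⁻ g m
      ... | j , _ , refl = g-in j
      hit : ∀ {x} j → g j ≡ x → x ∈ map g (allFin s)
      hit j refl = ∈-map⁺ g (∈-allFin j)
      from : ∀ {x} → x ∈ target → x ∈ map g (allFin s)
      from (here refl) = hit zero (at-inside i zero)
      from (there (here refl)) = hit (suc zero) (at-inside i (suc zero))
      from (there (there (here refl))) = hit (suc (suc (fromℕ s′))) g-top
      from (there (there (there k))) with ∈-map⁻ (ιb (bl i)) k
      ... | k′ , _ , refl = hit (suc (suc (inject₁ k′))) (g-inner k′)

    ham⇒loose : ContainsLooseHamCycle s E
    ham⇒loose = ordering , m , size≡ , λ i → subst (_∈ E) (sym (segment-edge i)) (linked i)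

pairs-unique : ∀ a b → Unique (pairs a b)
pairs-unique a b = go (UP.allFin⁺ a)
  where
  heads : ∀ js {o : Fin a × Fin b} → o ∈ concatMap (λ j → map (j ,_) (allFin b)) js → proj₁ o ∈ js
  heads (j ∷ js) m with ∈-++⁻ (map (j ,_) (allFin b)) m
  ... | inj₁ k with ∈-map⁻ (j ,_) k
  ...   | _ , _ , refl = here refl
  heads (j ∷ js) m | inj₂ k = there (heads js k)
  go : ∀ {js : List (Fin a)} → Unique js → Unique (concatMap (λ j → map (j ,_) (allFin b)) js)
  go [] = []
  go {j ∷ js} (j∉ ∷ u) = UP.++⁺ (UP.map⁺ (λ { refl → refl }) (UP.allFin⁺ b)) (go u) disj
    where
    disj : ∀ {o} → ¬ (o ∈ map (j ,_) (allFin b) × o ∈ concatMap (λ j → map (j ,_) (allFin b)) js)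
    disj (m , m′) with ∈-map⁻ (j ,_) m
    ... | _ , _ , refl = All.lookup j∉ (heads js m′) refl

module _ (D : Dims) (s′ n : ℕ) .{{n≢0 : NonZero n}}
  (ι : Dims.J D ⊎ (Dims.Block D × Fin s′) → Fin n) (ι-injective : ∀ {x y : Dims.J D ⊎ (Dims.Block D × Fin s′)} → ι x ≡ ι y → x ≡ y)
  (size≡ : (suc (Dims.ℓ′ D) + Dims.e D) * (2 + s′) ≡ n) where
  open Dims D
  open Embedding D s′ n ι ι-injective size≡

  ιx : X → Fin n
  ιx x = ιj (inj₁ x)

  ιx-injective : ∀ {x y} → ιx x ≡ ιx y → x ≡ y
  ιx-injective e with ι-injective e
  ... | refl = refl

  ιt-injective : ∀ {x y} → ιt x ≡ ιt y → x ≡ y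
  ιt-injective e with ι-injective e
  ... | refl = refl

  ιx≢ιt : ∀ {x t} → ιx x ≢ ιt t
  ιx≢ιt e with ι-injective e
  ... | ()

  ιj-injective : ∀ {v w} → ιj v ≡ ιj w → v ≡ w
  ιj-injective e with ι-injective e
  ... | refl = refl

  ιj∉block : ∀ v β → ιj v ∉ blockList β
  ιj∉block v β m with ∈-map⁻ (ιb β) m
  ... | k , _ , e with ι-injective e
  ...   | ()

  block-unique : ∀ β → Unique (blockList β)
  block-unique β = UP.map⁺ inj (UP.allFin⁺ s′)
    where inj : ∀ {k k′} → ιb β k ≡ ιb β k′ → k ≡ k′
          inj e with ι-injective e
          ... | refl = refl

  cons-unique : ∀ {v : Fin n} {ws} → v ∉ ws → Unique ws → Unique (v ∷ ws)
  cons-unique v∉ u = AllP.¬Any⇒All¬ _ v∉ ∷ u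

  length-block : ∀ β → length (blockList β) ≡ s′
  length-block β = trans (length-map (ιb β) (allFin s′)) (length-allFin s′)

  module TwoOffers where
    open Trees n 2 s

    enc : X × Fin ρ → Offer n 2
    enc (x , t) = vset (ιx x ∷ ιt t ∷ []) , ∣vset∣ (cons-unique (λ { (here e) → ιx≢ιt e ; (there ()) }) (cons-unique {ιt t} (λ ()) []))

    enc-set : ∀ {x t x′ t′} → vset (ιx x ∷ ιt t ∷ []) ≡ vset (ιx x′ ∷ ιt t′ ∷ []) → x ≡ x′ × t ≡ t′
    enc-set {x} {t} {x′} {t′} e = first (∈-vset⁻ (ιx x′ ∷ ιt t′ ∷ []) (subst (ιx x Sub.∈_) e (∈-vset⁺ {xs = ιx x ∷ ιt t ∷ []} (here refl)))) , second (∈-vset⁻ (ιx x′ ∷ ιt t′ ∷ []) (subst (ιt t Sub.∈_) e (∈-vset⁺ {xs = ιx x ∷ ιt t ∷ []} (there (here refl)))))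
      where
      first : ιx x ∈ ιx x′ ∷ ιt t′ ∷ [] → x ≡ x′
      first (here p) = ιx-injective p
      first (there (here p)) = ⊥-elim (ιx≢ιt p)
      second : ιt t ∈ ιx x′ ∷ ιt t′ ∷ [] → t ≡ t′
      second (here p) = ⊥-elim (ιx≢ιt (sym p))
      second (there (here p)) = ιt-injective p

    encs : List (Offer n 2)
    encs = map enc (pairs (suc ℓ′) ρ)

    encs-unique : Unique encs
    encs-unique = UP.map⁺ inj (pairs-unique (suc ℓ′) ρ)
      where inj : ∀ {o o′} → enc o ≡ enc o′ → o ≡ o′
            inj e = let p , q = enc-set (cong proj₁ e) in cong₂ _,_ p q

    others : List (Offer n 2)
    others = proj₁ (unique-⊆⇒↭ {ys = offers n 2} encs-unique (λ _ → ∈-offers n 2 _))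

    offers↭ : offers n 2 ↭ encs ++ others
    offers↭ = proj₂ (unique-⊆⇒↭ {ys = offers n 2} encs-unique (λ _ → ∈-offers n 2 _))

    N≡ : suc ℓ′ * ρ + length others ≡ n C 2
    N≡ = sym (trans (sym (length-offers n 2)) (trans (↭-length offers↭) (trans (length-++ encs) (cong (_+ length others) (trans (length-map enc (pairs (suc ℓ′) ρ)) (length-pairs (suc ℓ′) ρ))))))

    Decoded : Offer n 2 → Set
    Decoded A = ∃ λ x → ∃ λ t → proj₁ A ≡ vset (ιx x ∷ ιt t ∷ [])

    decode : ∀ A → Dec (Decoded A)
    decode A = FinP.any? λ x → FinP.any? λ t → Vec-≡-dec _≟ᵇ_ (proj₁ A) (vset (ιx x ∷ ιt t ∷ []))

    module _ {T : ℕ} {E : List (Subset n)} {f₀ : ℕ} (f : X → Fin ρ → ℕ)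
      (reply : ∀ x t → Reply (board (length others)) Win T E x t (f x t) ⊎ Win T E (f x t)) (stay : Win T E f₀) where

      φ : ∀ {A : Offer n 2} → Dec (Decoded A) → ℕ
      φ (yes (x , t , _)) = f x t
      φ (no _) = f₀

      child : ∀ A (d : Dec (Decoded A)) → Σ[ B ∈ Response n 2 s A ] Win T (addEdge {n} {2} {s} A B E) (φ {A} d)
      child A (no _) = nothing , stay
      child A (yes (x , t , e)) with reply x t
      ... | inj₂ w = nothing , w
      ... | inj₁ (w , β , w≢x , w≢t , win) = just (vset (ιj w ∷ blockList β) , card , disj) , subst (λ z → Win T (z ∷ E) (f x t)) (sym edge≡) win
        where
        card : ∣ vset (ιj w ∷ blockList β) ∣ ≡ suc s′
        card = trans (∣vset∣ (cons-unique (ιj∉block w β) (block-unique β))) (cong suc (length-block β))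
        apart : ∀ {z} → z ∈ ιx x ∷ ιt t ∷ [] → z ∉ ιj w ∷ blockList β
        apart (here refl) (here q) = w≢x (sym (ιj-injective q))
        apart (here refl) (there m) = ιj∉block _ β m
        apart (there (here refl)) (here q) = w≢t (sym (ιj-injective q))
        apart (there (here refl)) (there m) = ιj∉block _ β m
        disj : proj₁ A ∩ vset (ιj w ∷ blockList β) ≡ Sub.⊥
        disj = trans (cong (_∩ vset (ιj w ∷ blockList β)) e) (vset-disjoint {xs = ιx x ∷ ιt t ∷ []} {ys = ιj w ∷ blockList β} apart)
        edge≡ : proj₁ A ∪ vset (ιj w ∷ blockList β) ≡ edge (inj₁ x) t w β
        edge≡ = trans (cong (_∪ vset (ιj w ∷ blockList β)) e) (vset-++ (ιx x ∷ ιt t ∷ []) (ιj w ∷ blockList β))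

      φ-enc : ∀ x t (d : Dec (Decoded (enc (x , t)))) → φ {enc (x , t)} d ≡ f x t
      φ-enc x t (no none) = ⊥-elim (none (x , t , refl))
      φ-enc x t (yes (x′ , t′ , e)) with enc-set {x} {t} {x′} {t′} e
      ... | refl , refl = refl

      φ-other : ∀ A → A ∈ others → (d : Dec (Decoded A)) → φ {A} d ≡ f₀
      φ-other A m (no _) = refl
      φ-other A m (yes (x , t , e)) = ⊥-elim (Unique-disj encs (Unique-resp-↭ offers↭ (offers-unique n 2))
        (subst (_∈ encs) (sym (offer-≡ e)) (∈-map⁺ enc (∈-allpairs x t))) m)
        where
        ∈-allpairs : ∀ x t → (x , t) ∈ pairs (suc ℓ′) ρ
        ∈-allpairs x t = go (∈-allFin x)
          where
          go : ∀ {js} → x ∈ js → (x , t) ∈ concatMap (λ j → map (j ,_) (allFin ρ)) js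
          go (here refl) = ∈-++⁺ˡ (∈-map⁺ (x ,_) (∈-allFin t))
          go {j ∷ js} (there k) = ∈-++⁺ʳ (map (j ,_) (allFin ρ)) (go k)

      superstep : Win (suc T) E (∑ (allFin (suc ℓ′)) (λ x → ∑ (allFin ρ) (f x)) + length others * f₀)
      superstep = step (λ A → φ {A} (decode A)) (λ A → child A (decode A)) (≤-reflexive (begin
        ∑ (offers n 2) (λ A → φ {A} (decode A)) ≡⟨ trans (∑-↭ _ offers↭) (∑-++ encs others _) ⟩
        ∑ encs (λ A → φ {A} (decode A)) + ∑ others (λ A → φ {A} (decode A))
          ≡⟨ cong₂ _+_ (trans (∑-map enc (pairs (suc ℓ′) ρ) _) (trans (∑-cong (pairs (suc ℓ′) ρ) (λ o → φ-enc (proj₁ o) (proj₂ o) (decode (enc o)))) (∑-pairs (suc ℓ′) ρ (λ o → f (proj₁ o) (proj₂ o)))))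
               (trans (∑-cong-∈ others (λ A m → φ-other A m (decode A))) (∑-const others f₀)) ⟩
        ∑ (allFin (suc ℓ′)) (λ x → ∑ (allFin ρ) (f x)) + length others * f₀ ∎))
        where open ≡-Reasoning

    game : Game
    game = record
      { board = board (length others)
      ; W = Win
      ; W-mono = Win-mono
      ; W-lose = λ {T} → lose (≤-reflexive (cong (_^ T) (sym N≡)))
      ; W-ham = λ H → stop (ham⇒loose {length others} H)
      ; superstep = superstep }

  module OneOffer where
    open Trees n 1 s

    single : Fin n → Offer n 1
    single v = ⁅ v ⁆ , SubP.∣⁅x⁆∣≡1 v

    single-injective : ∀ {v w : Fin n} → ⁅ v ⁆ ≡ ⁅ w ⁆ → v ≡ w
    single-injective {v} {w} e = SubP.x∈⁅y⁆⇒x≡y w (subst (v Sub.∈_) e (SubP.x∈⁅x⁆ v))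

    module Coded {k : ℕ} (ν : Fin k → Fin n) (ν-injective : ∀ {i j : Fin k} → ν i ≡ ν j → i ≡ j) where
      codes : List (Offer n 1)
      codes = map (single ∘ ν) (allFin k)

      codes-unique : Unique codes
      codes-unique = UP.map⁺ (λ e → ν-injective (single-injective (cong proj₁ e))) (UP.allFin⁺ k)

      others : List (Offer n 1)
      others = proj₁ (unique-⊆⇒↭ {ys = offers n 1} codes-unique (λ _ → ∈-offers n 1 _))

      offers↭ : offers n 1 ↭ codes ++ others
      offers↭ = proj₂ (unique-⊆⇒↭ {ys = offers n 1} codes-unique (λ _ → ∈-offers n 1 _))

      total : k + length others ≡ n C 1
      total = sym (trans (sym (length-offers n 1)) (trans (↭-length offers↭) (trans (length-++ codes) (cong (_+ length others) (trans (length-map (single ∘ ν) (allFin k)) (length-allFin k))))))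

      Decoded : Offer n 1 → Set
      Decoded A = ∃ λ i → proj₁ A ≡ ⁅ ν i ⁆

      decode : ∀ A → Dec (Decoded A)
      decode A = FinP.any? λ i → Vec-≡-dec _≟ᵇ_ (proj₁ A) ⁅ ν i ⁆

      select-code : ∀ (f : Fin k → ℕ) (f₀ : ℕ) {A} → Dec (Decoded A) → ℕ
      select-code f f₀ (yes (i , _)) = f i
      select-code f f₀ (no _) = f₀

      ∑-select : ∀ f f₀ → ∑ (offers n 1) (λ A → select-code f f₀ {A} (decode A)) ≡ ∑ (allFin k) f + length others * f₀
      ∑-select f f₀ = begin
        ∑ (offers n 1) φ ≡⟨ trans (∑-↭ φ offers↭) (∑-++ codes others φ) ⟩
        ∑ codes φ + ∑ others φ ≡⟨ cong₂ _+_ (trans (∑-map (single ∘ ν) (allFin k) φ) (∑-cong (allFin k) (λ i → coded i (decode (single (ν i))))))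
              (trans (∑-cong-∈ others (λ A m → uncoded A m (decode A))) (∑-const others f₀)) ⟩
        ∑ (allFin k) f + length others * f₀ ∎
        where
        open ≡-Reasoning
        φ : Offer n 1 → ℕ
        φ A = select-code f f₀ {A} (decode A)
        coded : ∀ i (d : Dec (Decoded (single (ν i)))) → select-code f f₀ {single (ν i)} d ≡ f i
        coded i (no none) = ⊥-elim (none (i , refl))
        coded i (yes (j , e)) = cong f (sym (ν-injective (single-injective e)))
        uncoded : ∀ A → A ∈ others → (d : Dec (Decoded A)) → select-code f f₀ {A} d ≡ f₀
        uncoded A m (no _) = refl
        uncoded A m (yes (i , e)) = ⊥-elim (Unique-disj codes (Unique-resp-↭ offers↭ (offers-unique n 1))
          (subst (_∈ codes) (sym (offer-≡ e)) (∈-map⁺ (single ∘ ν) (∈-allFin i))) m)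

    module CX = Coded ιx ιx-injective
    module CT = Coded ιt ιt-injective

    -- Outcomes of two rounds in which the first offer is not in X or the second is not in R.
    wasted : ℕ
    wasted = suc ℓ′ * length CT.others + length CX.others * (n C 1)

    N≡ : suc ℓ′ * ρ + wasted ≡ (n C 1) * (n C 1)
    N≡ = begin
      suc ℓ′ * ρ + (suc ℓ′ * length CT.others + length CX.others * (n C 1)) ≡⟨ lem (suc ℓ′) ρ (length CT.others) (length CX.others) (n C 1) ⟩
      suc ℓ′ * (ρ + length CT.others) + length CX.others * (n C 1) ≡⟨ cong (λ z → suc ℓ′ * z + length CX.others * (n C 1)) CT.total ⟩
      suc ℓ′ * (n C 1) + length CX.others * (n C 1) ≡⟨ sym (*-distribʳ-+ (n C 1) (suc ℓ′) (length CX.others)) ⟩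
      (suc ℓ′ + length CX.others) * (n C 1) ≡⟨ cong (_* (n C 1)) CX.total ⟩
      (n C 1) * (n C 1) ∎
      where
      open ≡-Reasoning
      lem : ∀ l p a b m → l * p + (l * a + b * m) ≡ l * (p + a) + b * m
      lem = solve-∀

    W : ℕ → List (Subset n) → ℕ → Set
    W T = Win (T * 2)

    module _ {T : ℕ} {E : List (Subset n)} {f₀ : ℕ} (f : X → Fin ρ → ℕ)
      (reply : ∀ x t → Reply (board wasted) W T E x t (f x t) ⊎ W T E (f x t)) (stay : W T E f₀) where

      second : ∀ x A (d : Dec (CT.Decoded A)) → Σ[ B ∈ Response n 1 s A ] W T (addEdge {n} {1} {s} A B E) (CT.select-code (f x) f₀ {A} d)
      second x A (no _) = nothing , stay
      second x A (yes (t , e)) with reply x t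
      ... | inj₂ w = nothing , w
      ... | inj₁ (w , β , w≢x , w≢t , win) = just (vset (ιx x ∷ ιj w ∷ blockList β) , card , disj) , subst (λ z → W T (z ∷ E) (f x t)) (sym edge≡) win
        where
        card : ∣ vset (ιx x ∷ ιj w ∷ blockList β) ∣ ≡ 2 + s′
        card = trans (∣vset∣ (cons-unique x∉ (cons-unique (ιj∉block w β) (block-unique β)))) (cong (2 +_) (length-block β))
          where x∉ : ιx x ∉ ιj w ∷ blockList β
                x∉ (here q) = w≢x (sym (ιj-injective q))
                x∉ (there m) = ιj∉block _ β m
        apart : ∀ {z} → z ∈ ιt t ∷ [] → z ∉ ιx x ∷ ιj w ∷ blockList β
        apart (here refl) (here q) = ιx≢ιt (sym q)
        apart (here refl) (there (here q)) = w≢t (sym (ιj-injective q))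
        apart (here refl) (there (there m)) = ιj∉block _ β m
        ⁅⁆≡ : proj₁ A ≡ vset (ιt t ∷ [])
        ⁅⁆≡ = trans e (sym (SubP.∪-identityʳ ⁅ ιt t ⁆))
        disj : proj₁ A ∩ vset (ιx x ∷ ιj w ∷ blockList β) ≡ Sub.⊥
        disj = trans (cong (_∩ vset (ιx x ∷ ιj w ∷ blockList β)) ⁅⁆≡) (vset-disjoint {xs = ιt t ∷ []} {ys = ιx x ∷ ιj w ∷ blockList β} apart)
        edge≡ : proj₁ A ∪ vset (ιx x ∷ ιj w ∷ blockList β) ≡ edge (inj₁ x) t w β
        edge≡ = trans (cong (_∪ vset (ιx x ∷ ιj w ∷ blockList β)) ⁅⁆≡) (trans (vset-++ (ιt t ∷ []) (ιx x ∷ ιj w ∷ blockList β))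
          (vset-≡ {xs = ιt t ∷ ιx x ∷ ιj w ∷ blockList β} {ys = ιx x ∷ ιt t ∷ ιj w ∷ blockList β} exch exch))
          where exch : ∀ {a b z : Fin n} {rest} → z ∈ a ∷ b ∷ rest → z ∈ b ∷ a ∷ rest
                exch (here q) = there (here q)
                exch (there (here q)) = here q
                exch (there (there q)) = there (there q)

      rowFails : X → ℕ
      rowFails x = ∑ (allFin ρ) (f x) + length CT.others * f₀

      row : ∀ x → Win (suc (T * 2)) E (rowFails x)
      row x = step (λ A → CT.select-code (f x) f₀ {A} (CT.decode A)) (λ A → second x A (CT.decode A)) (≤-reflexive (CT.∑-select (f x) f₀))

      -- After a first offer outside X the second offer is ignored as well, which keeps the rounds
      -- grouped in pairs.
      idle-row : Win (suc (T * 2)) E ((n C 1) * f₀)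
      idle-row = step (λ _ → f₀) (λ A → nothing , stay) (≤-reflexive (trans (∑-const (offers n 1) f₀) (cong (_* f₀) (length-offers n 1))))

      first : ∀ A (d : Dec (CX.Decoded A)) → Σ[ B ∈ Response n 1 s A ] Win (suc (T * 2)) (addEdge {n} {1} {s} A B E) (CX.select-code rowFails ((n C 1) * f₀) {A} d)
      first A (no _) = nothing , idle-row
      first A (yes (x , _)) = nothing , row x

      superstep : W (suc T) E (∑ (allFin (suc ℓ′)) (λ x → ∑ (allFin ρ) (f x)) + wasted * f₀)
      superstep = step (λ A → CX.select-code rowFails ((n C 1) * f₀) {A} (CX.decode A)) (λ A → first A (CX.decode A)) (≤-reflexive (begin
        ∑ (offers n 1) (λ A → CX.select-code rowFails ((n C 1) * f₀) {A} (CX.decode A)) ≡⟨ CX.∑-select rowFails ((n C 1) * f₀) ⟩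
        ∑ (allFin (suc ℓ′)) rowFails + length CX.others * ((n C 1) * f₀)
          ≡⟨ cong (_+ length CX.others * ((n C 1) * f₀)) (trans (∑-+ (allFin (suc ℓ′)) (λ x → ∑ (allFin ρ) (f x)) (λ _ → length CT.others * f₀)) (cong (∑ (allFin (suc ℓ′)) (λ x → ∑ (allFin ρ) (f x)) +_)
               (trans (∑-const (allFin (suc ℓ′)) (length CT.others * f₀)) (cong (_* (length CT.others * f₀)) (length-allFin (suc ℓ′)))))) ⟩
        S₀ + suc ℓ′ * (length CT.others * f₀) + length CX.others * ((n C 1) * f₀)
          ≡⟨ lem S₀ (suc ℓ′) (length CT.others) f₀ (length CX.others) (n C 1) ⟩
        S₀ + wasted * f₀ ∎))
        where
        open ≡-Reasoning
        S₀ : ℕ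
        S₀ = ∑ (allFin (suc ℓ′)) (λ x → ∑ (allFin ρ) (f x))
        lem : ∀ S l a f b m → S + l * (a * f) + b * (m * f) ≡ S + (l * a + b * m) * f
        lem = solve-∀

    game : Game
    game = record
      { board = board wasted
      ; W = W
      ; W-mono = Win-mono
      ; W-lose = λ {T} → lose (≤-reflexive (trans (sym (trans (cong (_^ T) (cong ((n C 1) *_) (sym (*-identityʳ (n C 1))))) (trans (^-*-assoc (n C 1) 2 T) (cong ((n C 1) ^_) (*-comm 2 T)))))
                              (cong (_^ T) (sym N≡))))
      ; W-ham = λ H → stop (ham⇒loose {wasted} H)
      ; superstep = λ {T} → superstep {T} }

-- Concrete dimensions and the inequalities between the parameters

isRight : ∀ {a b} → Fin a ⊎ Fin b → Bool
isRight (inj₁ _) = false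
isRight (inj₂ _) = true

rightPart : ∀ a b → Fin (a + b) → Bool
rightPart a b j = isRight (splitAt a j)

#-all : ∀ n → # {n} (λ _ → true) ≡ n
#-all n = trans (#≡∑ (λ _ → true)) (trans (∑-const (allFin n) 1) (trans (*-identityʳ _) (length-allFin n)))

rightPart-suc : ∀ a b j → rightPart (suc a) b (suc j) ≡ rightPart a b j
rightPart-suc a b j with splitAt a j
... | inj₁ _ = refl
... | inj₂ _ = refl

#-rightPart : ∀ a b → # (rightPart a b) ≡ b
#-rightPart zero b = #-all b
#-rightPart (suc a) b = trans (#-suc (rightPart (suc a) b)) (trans (#-cong (rightPart-suc a b)) (#-rightPart a b))

#-leftPart : ∀ a b → # (not ∘ rightPart a b) ≡ a
#-leftPart zero b = #-false {b} (λ _ → refl)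
#-leftPart (suc a) b = trans (#-suc (not ∘ rightPart (suc a) b)) (cong suc (trans (#-cong (λ j → cong not (rightPart-suc a b j))) (#-leftPart a b)))

-- Of the slots, 3 * 10d belong to the units and p are main; a unit uses two of its three slots, and
-- the third separates it from the next unit. Bad slots may spoil 2d units, leaving the 8d that the
-- stages need. Of the 11d reserve tokens at most d become junctions, leaving 10d. The number of
-- main tokens then follows from ρ = suc ℓ′ + 2e.
dimsOf : (d p : ℕ) → Dims
dimsOf d p = record { ℓ′ = 10 * d * 3 + p ; ρ = 11 * d + suc (p + 21 * d) ; e = d }

module _ (d p k q : ℕ) (enough : q + d ≤ p) where

  open Dims (dimsOf d p)

  unit-slot : Fin (10 * d) → Fin 3 → Fin ℓ′
  unit-slot i c = combine i c ↑ˡ p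

  toℕ-unit : ∀ i c → toℕ (unit-slot i c) ≡ 3 * toℕ i + toℕ c
  toℕ-unit i c = trans (FinP.toℕ-↑ˡ (combine i c) p) (FinP.toℕ-combine i c)

  -- The junctions fall into consecutive triples, and division with remainder by 3 makes the triple
  -- unique.
  In : X → Fin (10 * d) → Set
  In x i = ∃ λ (c : Fin 3) → toℕ x ≡ 3 * toℕ i + toℕ c

  In-functional : ∀ {x i i′} → In x i → In x i′ → i ≡ i′
  In-functional {x} {i} {i′} (c , e) (c′ , e′) = FinP.combine-injectiveˡ i c i′ c′ (FinP.toℕ-injective
    (trans (FinP.toℕ-combine i c) (trans (sym e) (trans e′ (sym (FinP.toℕ-combine i′ c′))))))

  next-in : ∀ z → suc (3 * z + 0) ≡ 3 * z + 1
  next-in = solve-∀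

  next-in′ : ∀ z → suc (3 * z + 1) ≡ 3 * z + 2
  next-in′ = solve-∀

  unit-not-main : ∀ i c → rightPart (10 * d * 3) p (unit-slot i c) ≡ false
  unit-not-main i c = cong isRight (FinP.splitAt-↑ˡ (10 * d * 3) (combine i c) p)

  layoutOf : Layout (dimsOf d p)
  layoutOf = record
    { u = 10 * d ; d = d ; k = k ; q = q
    ; sa = λ i → unit-slot i zero ; sb = λ i → unit-slot i (suc zero)
    ; joined = λ i → FinP.toℕ-injective (trans (cong suc (toℕ-unit i zero)) (trans (next-in (toℕ i)) (sym (trans (FinP.toℕ-inject₁ _) (toℕ-unit i (suc zero))))))
    ; near = In ; near-functional = In-functional
    ; near-a = λ i → zero , trans (FinP.toℕ-inject₁ _) (toℕ-unit i zero)
    ; near-c = λ i → suc zero , trans (cong suc (toℕ-unit i zero)) (next-in (toℕ i))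
    ; near-b = λ i → suc (suc zero) , trans (cong suc (toℕ-unit i (suc zero))) (next-in′ (toℕ i))
    ; a≢b = λ i e → <-irrefl (trans (sym (trans (FinP.toℕ-inject₁ _) (toℕ-unit i zero))) (trans (cong toℕ e) (trans (cong suc (toℕ-unit i (suc zero))) (next-in′ (toℕ i))))) (+-monoʳ-< (3 * toℕ i) (s≤s z≤n))
    ; Lm = rightPart (10 * d * 3) p ; Rm = rightPart (11 * d) (suc (p + 21 * d))
    ; Lm-a = λ i → unit-not-main i zero ; Lm-b = λ i → unit-not-main i (suc zero)
    ; t₀ = (11 * d) ↑ʳ zero
    ; e≡d = refl
    ; ρ≡ = lem d p
    ; Lm-large = ≤-trans enough (≤-reflexive (sym (#-rightPart (10 * d * 3) p)))
    ; Rm-large = ≤-trans enough (≤-trans (≤-trans (m≤m+n p (21 * d)) (n≤1+n _)) (≤-reflexive (sym (#-rightPart (11 * d) (suc (p + 21 * d))))))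
    ; Rres-large = ≤-trans (≤-trans (≤-reflexive (cong (d +_) (sym (+-identityʳ d)))) (*-monoˡ-≤ d (≤ᵇ⇒≤ 2 11 _))) (≤-reflexive (sym (#-leftPart (11 * d) (suc (p + 21 * d)))))
    }
    where
    lem : ∀ d p → 11 * d + suc (p + 21 * d) ≡ suc (10 * d * 3 + p) + d + d
    lem = solve-∀

module Final (Gm : Game) (t I A′ : ℕ) (t-large : 4 ≤ t) (lay : Layout (Game.dims Gm))
  (d≡ : Layout.d lay ≡ 16 ^ I) (u≡ : Layout.u lay ≡ 10 * 16 ^ I) (k≡ : Layout.k lay ≡ 3 + 2 * (t * (1 + 66 * (8 * t))))
  (q≡ : Layout.q lay ≡ 8 * t * 16 ^ I) (reserve≡ : # (not ∘ Layout.Rm lay) ≡ 11 * 16 ^ I)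
  (2A′≡ : 2 * A′ ≡ t * (8 * t * (8 * t)))
  (N-upper : Game.N Gm ≤ A′ * (16 ^ I * 16 ^ I))
  (N-lower : 2 * (8 * t) * (2 * (8 * t)) * (16 ^ I * 16 ^ I) ≤ Game.N Gm)
  (dims-small : Game.ℓ′ Gm + Game.ρ Gm + 16 ^ I ≤ 66 * (8 * t) * 16 ^ I) where
  open Game Gm using (N; W; ℓ′; ρ; r)
  open PhaseB Gm using (Ex; N≡)
  open RandomPhase ℓ′ ρ (ρ + r) using (defects)

  -- The scale is d: N lies between n₀ d² and A′ d², and all dimensions together are at most L d.
  -- The value of κ is what the union bound over all pairs of sets requires of the M rounds; k = 3 +
  -- 2κ is then large enough for sparsity. T is the length of the repair schedule.
  d q₀ κ n₀ L B₀ M T : ℕ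
  d = 16 ^ I
  q₀ = 8 * t
  κ = t * (1 + 66 * q₀)
  n₀ = 2 * q₀ * (2 * q₀)
  L = 66 * q₀
  B₀ = κ * (q₀ * q₀)
  M = B₀ * d
  T = 4 * (128 * A′) * d

  d>0 : 1 ≤ d
  d>0 = m^n>0 16 I

  q₀>0 : 1 ≤ q₀
  q₀>0 = *-mono-≤ {1} {8} {1} {t} (s≤s z≤n) (≤-trans (s≤s z≤n) t-large)

  B-small : 8 * B₀ ≤ (3 + 2 * κ) * n₀
  B-small = ≤-trans (m≤m+n (8 * B₀) (12 * (q₀ * q₀))) (≤-reflexive (lem κ q₀))
    where lem : ∀ κ q → 8 * (κ * (q * q)) + 12 * (q * q) ≡ (3 + 2 * κ) * (2 * q * (2 * q))
          lem = solve-∀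

  k-large : 16 * (L * L) ≤ 2 ^ (2 * κ)
  k-large = begin
    16 * (L * L) ≡⟨ lem L ⟩
    4 * L * (4 * L) ≤⟨ *-mono-≤ 4L≤ 4L≤ ⟩
    2 ^ κ * 2 ^ κ ≡⟨ sym (^-distribˡ-+-* 2 κ κ) ⟩
    2 ^ (κ + κ) ≡⟨ cong (λ z → 2 ^ (κ + z)) (sym (+-identityʳ κ)) ⟩
    2 ^ (2 * κ) ∎
    where
    open ≤-Reasoning
    lem : ∀ L → 16 * (L * L) ≡ 4 * L * (4 * L)
    lem = solve-∀
    4L≤ : 4 * L ≤ 2 ^ κ
    4L≤ = ≤-trans (*-mono-≤ {4} {t} {L} {1 + L} t-large (n≤1+n L)) (n≤2^n κ)

  B-large : 2 * A′ * (1 + (ℓ′ + ρ + d)) ≤ B₀ * d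
  B-large = begin
    2 * A′ * (1 + (ℓ′ + ρ + d)) ≡⟨ cong (_* (1 + (ℓ′ + ρ + d))) 2A′≡ ⟩
    t * (q₀ * q₀) * (1 + (ℓ′ + ρ + d)) ≤⟨ *-monoʳ-≤ (t * (q₀ * q₀)) (+-mono-≤ d>0 dims-small) ⟩
    t * (q₀ * q₀) * (d + L * d) ≡⟨ lem t q₀ L d ⟩
    t * (1 + L) * (q₀ * q₀) * d ∎
    where
    open ≤-Reasoning
    lem : ∀ t q L d → t * (q * q) * (d + L * d) ≡ t * (1 + L) * (q * q) * d
    lem = solve-∀

  N-lower′ : n₀ * (d * d) ≤ RandomPhase.N ℓ′ ρ (ρ + r)
  N-lower′ = subst (n₀ * (d * d) ≤_) (sym N≡) N-lower

  N-upper′ : RandomPhase.N ℓ′ ρ (ρ + r) ≤ A′ * (d * d)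
  N-upper′ = subst (_≤ A′ * (d * d)) (sym N≡) N-upper

  q₂-large : 2 * RandomPhase.N ℓ′ ρ (ρ + r) ≤ t * q₀ * (d * (q₀ * d))
  q₂-large = begin
    2 * RandomPhase.N ℓ′ ρ (ρ + r) ≤⟨ *-monoʳ-≤ 2 N-upper′ ⟩
    2 * (A′ * (d * d)) ≡⟨ sym (*-assoc 2 A′ (d * d)) ⟩
    2 * A′ * (d * d) ≡⟨ cong (_* (d * d)) 2A′≡ ⟩
    t * (q₀ * q₀) * (d * d) ≡⟨ lem t q₀ d ⟩
    t * q₀ * (d * (q₀ * d)) ∎
    where
    open ≤-Reasoning
    lem : ∀ t q d → t * (q * q) * (d * d) ≡ t * q * (d * (q * d))
    lem = solve-∀

  7+66q₀≤ : 7 + L ≤ 4 * κ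
  7+66q₀≤ = begin
    7 + L ≤⟨ +-monoˡ-≤ L (≤-trans (≤ᵇ⇒≤ 7 (4 + 66) _) (+-monoʳ-≤ 4 (*-monoʳ-≤ 66 q₀>0))) ⟩
    4 + L + L ≤⟨ +-monoʳ-≤ (4 + L) (m≤n*m L 3) ⟩
    4 + L + 3 * L ≡⟨ lem L ⟩
    4 * (1 * (1 + L)) ≤⟨ *-monoʳ-≤ 4 (*-monoˡ-≤ (1 + L) (≤-trans (s≤s z≤n) t-large)) ⟩
    4 * κ ∎
    where
    open ≤-Reasoning
    lem : ∀ L → 4 + L + 3 * L ≡ 4 * (1 * (1 + L))
    lem = solve-∀

  -- This is where q₀ = 8t comes from. The requirement of k(d + 1) edges costs about t q₀ * 4κ d
  -- rounds, since k is about 2κ and d + 1 ≤ 2d. With q₀ = 8t this is half of M, and the other half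
  -- covers the union bound and the lower order terms.
  B-large₂ : t * q₀ * (suc ((3 + 2 * κ) * suc d) + (ℓ′ + ρ + d)) ≤ B₀ * d
  B-large₂ = begin
    t * q₀ * (suc ((3 + 2 * κ) * suc d) + (ℓ′ + ρ + d))
      ≤⟨ *-monoʳ-≤ (t * q₀) (+-mono-≤ (+-mono-≤ d>0 (*-monoʳ-≤ (3 + 2 * κ) (+-monoˡ-≤ d d>0))) dims-small) ⟩
    t * q₀ * (d + (3 + 2 * κ) * (d + d) + L * d) ≡⟨ lem₁ t q₀ κ L d ⟩
    t * q₀ * d * (7 + L + 4 * κ) ≤⟨ *-monoʳ-≤ (t * q₀ * d) (+-monoˡ-≤ (4 * κ) 7+66q₀≤) ⟩
    t * q₀ * d * (4 * κ + 4 * κ) ≡⟨ lem₂ t q₀ d κ ⟩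
    κ * (q₀ * (8 * t)) * d ∎
    where
    open ≤-Reasoning
    lem₁ : ∀ t q κ L d → t * q * (d + (3 + 2 * κ) * (d + d) + L * d) ≡ t * q * d * (7 + L + 4 * κ)
    lem₁ = solve-∀
    lem₂ : ∀ t q d κ → t * q * d * (4 * κ + 4 * κ) ≡ κ * (q * (8 * t)) * d
    lem₂ = solve-∀

  transport : ∀ {d₁ k₁ q₁ d₂ k₂ q₂} → d₁ ≡ d₂ → k₁ ≡ k₂ → q₁ ≡ q₂ →
    d₂ * Ex M (defects d₂ k₂ q₂) ≤ 3 * N ^ M → d₁ * Ex M (defects d₁ k₁ q₁) ≤ 3 * N ^ M
  transport refl refl refl h = h

  defects-rare : Layout.d lay * Ex M (defects (Layout.d lay) (Layout.k lay) (Layout.q lay)) ≤ 3 * N ^ M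
  defects-rare = transport d≡ k≡ q≡ (subst (λ z → d * Ex M (defects d (3 + 2 * κ) (q₀ * d)) ≤ 3 * z ^ M) N≡
    (RandomBound.defects-small ℓ′ ρ (ρ + r) d (2 * κ) n₀ A′ L B₀ (q₀ * d) (t * q₀)
      d>0 (*-mono-≤ {1} {2 * q₀} {1} {2 * q₀} 2q₀>0 2q₀>0) (*-mono-≤ {1} {q₀} {1} {d} q₀>0 d>0) N-lower′ N-upper′ dims-small B-small k-large B-large q₂-large B-large₂))
    where
    2q₀>0 : 1 ≤ 2 * q₀
    2q₀>0 = ≤-trans q₀>0 (m≤n*m q₀ 2)

  conclusion : Σ[ F ∈ ℕ ] W (M + T) [] F × 2 ^ I * F ≤ 7 * N ^ (M + T)
  conclusion = Victory.victory Gm lay I A′ M T ≤-refl d≡ N-upper four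
    (≤-reflexive (trans (cong (10 *_) d≡) (sym u≡))) (≤-reflexive (trans (cong (11 *_) d≡) (sym reserve≡))) defects-rare
    where
    four : 4 * (16 ^ I * 16 ^ I) ≤ N
    four = ≤-trans (*-monoˡ-≤ (16 ^ I * 16 ^ I) (*-mono-≤ {2} {2 * q₀} {2} {2 * q₀} (*-monoʳ-≤ 2 q₀>0) (*-monoʳ-≤ 2 q₀>0))) N-lower

-- Surplus rounds are ignored at the beginning, which leaves the probability of failure unchanged.
padded : ∀ (Gm : Game) {T T′ I} → let open Game Gm in
  Σ[ F ∈ ℕ ] W T [] F × 2 ^ I * F ≤ 7 * N ^ T → T ≤ T′ → Σ[ F ∈ ℕ ] W T′ [] F × 2 ^ I * F ≤ 7 * N ^ T′
padded Gm {T} {T′} {I} (F , w , bound) T≤ = N ^ k * F , subst (λ z → W z [] (N ^ k * F)) k+T (GameLemmas.idle Gm k w) , (begin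
  2 ^ I * (N ^ k * F) ≡⟨ lem (2 ^ I) (N ^ k) F ⟩
  N ^ k * (2 ^ I * F) ≤⟨ *-monoʳ-≤ (N ^ k) bound ⟩
  N ^ k * (7 * N ^ T) ≡⟨ lem (N ^ k) 7 (N ^ T) ⟩
  7 * (N ^ k * N ^ T) ≡⟨ cong (7 *_) (trans (sym (^-distribˡ-+-* N k T)) (cong (N ^_) k+T)) ⟩
  7 * N ^ T′ ∎)
  where
  open Game Gm using (N; W)
  open ≤-Reasoning
  k : ℕ
  k = T′ ∸ T
  k+T : k + T ≡ T′
  k+T = m∸n+n≡m T≤
  lem : ∀ a b c → a * (b * c) ≡ b * (a * c)
  lem = solve-∀

join-injective : ∀ a b {x y} → join a b x ≡ join a b y → x ≡ y
join-injective a b {x} {y} e = trans (sym (FinP.splitAt-join a b x)) (trans (cong (splitAt a) e) (FinP.splitAt-join a b y))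

cast-injective : ∀ {a b} .(eq : a ≡ b) {i j : Fin a} → cast eq i ≡ cast eq j → i ≡ j
cast-injective eq {i} {j} e = FinP.toℕ-injective (trans (sym (FinP.toℕ-cast eq i)) (trans (cong toℕ e) (FinP.toℕ-cast eq j)))

module Vertices (D : Dims) (s′ n : ℕ) (total : suc (Dims.ℓ′ D) + Dims.ρ D + (Dims.ℓ′ D + suc (Dims.e D)) * s′ ≡ n) where
  open Dims D

  code : J ⊎ (Block × Fin s′) → Fin (suc ℓ′ + ρ) ⊎ Fin ((ℓ′ + suc e) * s′)
  code (inj₁ v) = inj₁ (join (suc ℓ′) ρ v)
  code (inj₂ (β , k)) = inj₂ (combine (join ℓ′ (suc e) β) k)

  code-injective : ∀ {x y} → code x ≡ code y → x ≡ y
  code-injective {inj₁ v} {inj₁ w} e = cong inj₁ (join-injective (suc ℓ′) ρ (inj e))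
    where inj : ∀ {a b : ℕ} {i j : Fin a} → inj₁ {B = Fin b} i ≡ inj₁ j → i ≡ j
          inj refl = refl
  code-injective {inj₂ (β , k)} {inj₂ (γ , l)} eq = cong inj₂ (cong₂ _,_ (join-injective ℓ′ (suc e) (proj₁ both)) (proj₂ both))
    where
    inj : ∀ {a b : ℕ} {i j : Fin b} → inj₂ {A = Fin a} i ≡ inj₂ j → i ≡ j
    inj refl = refl
    both = FinP.combine-injective (join ℓ′ (suc e) β) k (join ℓ′ (suc e) γ) l (inj eq)

  ι : J ⊎ (Block × Fin s′) → Fin n
  ι x = cast total (join (suc ℓ′ + ρ) ((ℓ′ + suc e) * s′) (code x))

  ι-injective : ∀ {x y} → ι x ≡ ι y → x ≡ y
  ι-injective eq = code-injective (join-injective (suc ℓ′ + ρ) ((ℓ′ + suc e) * s′) (cast-injective total eq))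

2*nC2 : ∀ n → 2 * (n C 2) + n ≡ n * n
2*nC2 zero = refl
2*nC2 (suc n) = begin
  2 * (suc n C 2) + suc n ≡⟨ cong (λ z → 2 * z + suc n) (trans (sym (nCk+nC[k+1]≡[n+1]C[k+1] n 1)) (cong (_+ (n C 2)) (nC1≡n n))) ⟩
  2 * (n + (n C 2)) + suc n ≡⟨ lem₁ n (n C 2) ⟩
  2 * (n C 2) + n + (2 * n + 1) ≡⟨ cong (_+ (2 * n + 1)) (2*nC2 n) ⟩
  n * n + (2 * n + 1) ≡⟨ lem₂ n ⟩
  suc n * suc n ∎
  where
  open ≡-Reasoning
  lem₁ : ∀ n c → 2 * (n + c) + suc n ≡ 2 * c + n + (2 * n + 1)
  lem₁ = solve-∀
  lem₂ : ∀ n → n * n + (2 * n + 1) ≡ suc n * suc n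
  lem₂ = solve-∀

nC2≤n² : ∀ n → n C 2 ≤ n * n
nC2≤n² n = ≤-trans (m≤n*m (n C 2) 2) (≤-trans (m≤m+n _ n) (≤-reflexive (2*nC2 n)))

-- Doubling m leaves room both for the factor 1/2 in n(n - 1)/2 and for the linear term.
m²≤nC2 : ∀ m n → 1 ≤ m → 2 * m ≤ n → m * m ≤ n C 2
m²≤nC2 m n m>0 2m≤n = *-cancelˡ-≤ 4 (+-cancelʳ-≤ (2 * n) _ _ (begin
  4 * (m * m) + 2 * n ≤⟨ +-mono-≤ (≤-trans (≤-reflexive (lem₁ m)) (*-mono-≤ 2m≤n 2m≤n)) (*-monoˡ-≤ n (≤-trans (*-monoʳ-≤ 2 m>0) 2m≤n)) ⟩
  n * n + n * n ≡⟨ cong₂ _+_ (sym (2*nC2 n)) (sym (2*nC2 n)) ⟩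
  2 * (n C 2) + n + (2 * (n C 2) + n) ≡⟨ lem₂ (n C 2) n ⟩
  4 * (n C 2) + 2 * n ∎))
  where
  open ≤-Reasoning
  lem₁ : ∀ m → 4 * (m * m) ≡ 2 * m * (2 * m)
  lem₁ = solve-∀
  lem₂ : ∀ c n → 2 * c + n + (2 * c + n) ≡ 4 * c + 2 * n
  lem₂ = solve-∀

module Instance (s′ n m I p t A′ : ℕ) .{{n≢0 : NonZero n}} (t-large : 5 ≤ t)
  (2A′≡ : 2 * A′ ≡ t * (8 * t * (8 * t))) (A′≥ : 1024 * ((2 + s′) * (2 + s′)) * (8 * t * (8 * t)) ≤ A′)
  (n≡ : m * (2 + s′) ≡ n) (m≡ : suc (10 * 16 ^ I * 3 + p) + 16 ^ I ≡ m)
  (m-lower : 2 * (8 * t) * 16 ^ I ≤ m) (m-upper : m ≤ 32 * (8 * t) * 16 ^ I) where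

  d q₀ : ℕ
  d = 16 ^ I
  q₀ = 8 * t

  D : Dims
  D = dimsOf d p

  open Dims D

  d>0 : 1 ≤ d
  d>0 = m^n>0 16 I

  q₀-large : 40 ≤ q₀
  q₀-large = *-monoʳ-≤ 8 t-large

  m>0 : 1 ≤ m
  m>0 = ≤-trans (*-mono-≤ {1} {2 * q₀} {1} {d} (≤-trans (≤-trans (s≤s z≤n) q₀-large) (m≤n*m q₀ 2)) d>0) m-lower

  2m≤n : 2 * m ≤ n
  2m≤n = ≤-trans (≤-reflexive (*-comm 2 m)) (≤-trans (*-monoʳ-≤ m (m≤m+n 2 s′)) (≤-reflexive n≡))

  p-large : q₀ * d + d ≤ p
  p-large = +-cancelʳ-≤ (32 * d) _ _ (begin
    q₀ * d + d + 32 * d ≡⟨ lem₁ q₀ d ⟩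
    q₀ * d + 33 * d ≤⟨ +-monoʳ-≤ (q₀ * d) (*-monoˡ-≤ d (≤-trans (≤ᵇ⇒≤ 33 40 _) q₀-large)) ⟩
    q₀ * d + q₀ * d ≡⟨ lem₂ q₀ d ⟩
    2 * q₀ * d ≤⟨ m-lower ⟩
    m ≡⟨ sym m≡ ⟩
    suc (10 * d * 3 + p) + d ≡⟨ lem₃ d p ⟩
    p + 31 * d + 1 ≤⟨ +-monoʳ-≤ (p + 31 * d) d>0 ⟩
    p + 31 * d + d ≡⟨ lem₄ p d ⟩
    p + 32 * d ∎)
    where
    open ≤-Reasoning
    lem₁ : ∀ q d → q * d + d + 32 * d ≡ q * d + 33 * d
    lem₁ = solve-∀
    lem₂ : ∀ q d → q * d + q * d ≡ 2 * q * d
    lem₂ = solve-∀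
    lem₃ : ∀ d p → suc (10 * d * 3 + p) + d ≡ p + 31 * d + 1
    lem₃ = solve-∀
    lem₄ : ∀ p d → p + 31 * d + d ≡ p + 32 * d
    lem₄ = solve-∀

  lay : Layout D
  lay = layoutOf d p (3 + 2 * (t * (1 + 66 * q₀))) (q₀ * d) p-large

  -- The m links of the final cycle use m junctions and m tokens, whichever tokens become junctions;
  -- with m blocks of s′ vertices this gives all n vertices.
  J-count : suc ℓ′ + ρ ≡ 2 * m
  J-count = trans (lem d p) (cong (2 *_) m≡)
    where lem : ∀ d p → suc (10 * d * 3 + p) + (11 * d + suc (p + 21 * d)) ≡ 2 * (suc (10 * d * 3 + p) + d)
          lem = solve-∀

  total : suc ℓ′ + ρ + (ℓ′ + suc e) * s′ ≡ n
  total = trans (cong₂ (λ x y → x + y * s′) J-count (trans (+-suc ℓ′ e) m≡)) (trans (lem m s′) n≡)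
    where lem : ∀ m s → 2 * m + m * s ≡ m * (2 + s)
          lem = solve-∀

  open Vertices D s′ n total

  size≡ : (suc ℓ′ + e) * (2 + s′) ≡ n
  size≡ = trans (cong (_* (2 + s′)) m≡) n≡

  dims-small : ℓ′ + ρ + d ≤ 66 * q₀ * d
  dims-small = begin
    ℓ′ + ρ + d ≤⟨ +-monoˡ-≤ d (n≤1+n (ℓ′ + ρ)) ⟩
    suc ℓ′ + ρ + d ≡⟨ cong (_+ d) J-count ⟩
    2 * m + d ≤⟨ +-mono-≤ (*-monoʳ-≤ 2 m-upper) (m≤n*m d (2 * q₀) {{>-nonZero (≤-trans (≤-trans (s≤s z≤n) q₀-large) (m≤n*m q₀ 2))}}) ⟩
    2 * (32 * q₀ * d) + 2 * q₀ * d ≡⟨ lem q₀ d ⟩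
    66 * q₀ * d ∎
    where
    open ≤-Reasoning
    lem : ∀ q d → 2 * (32 * q * d) + 2 * q * d ≡ 66 * q * d
    lem = solve-∀

  n²-upper : n * n ≤ A′ * (d * d)
  n²-upper = begin
    n * n ≡⟨ cong₂ _*_ (sym n≡) (sym n≡) ⟩
    m * (2 + s′) * (m * (2 + s′)) ≤⟨ *-mono-≤ (*-monoˡ-≤ (2 + s′) m-upper) (*-monoˡ-≤ (2 + s′) m-upper) ⟩
    32 * q₀ * d * (2 + s′) * (32 * q₀ * d * (2 + s′)) ≡⟨ lem q₀ d (2 + s′) ⟩
    1024 * ((2 + s′) * (2 + s′)) * (q₀ * q₀) * (d * d) ≤⟨ *-monoˡ-≤ (d * d) A′≥ ⟩
    A′ * (d * d) ∎
    where
    open ≤-Reasoning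
    lem : ∀ q d S → 32 * q * d * S * (32 * q * d * S) ≡ 1024 * (S * S) * (q * q) * (d * d)
    lem = solve-∀

  m²-lower : 2 * q₀ * (2 * q₀) * (d * d) ≤ m * m
  m²-lower = ≤-trans (≤-reflexive (lem (2 * q₀) d)) (*-mono-≤ m-lower m-lower)
    where lem : ∀ q d → q * q * (d * d) ≡ q * d * (q * d)
          lem = solve-∀

  rounds : ℕ
  rounds = t * (1 + 66 * q₀) * (q₀ * q₀) + 4 * (128 * A′)

  in-time : t * (1 + 66 * q₀) * (q₀ * q₀) * d + 4 * (128 * A′) * d ≤ rounds * n
  in-time = ≤-trans (≤-reflexive (sym (*-distribʳ-+ d (t * (1 + 66 * q₀) * (q₀ * q₀)) (4 * (128 * A′))))) (*-monoʳ-≤ rounds d≤n)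
    where
    d≤n : d ≤ n
    d≤n = ≤-trans (≤-trans (m≤n*m d (2 * q₀) {{>-nonZero (≤-trans (≤-trans (s≤s z≤n) q₀-large) (m≤n*m q₀ 2))}}) m-lower) (≤-trans (m≤n*m m 2) 2m≤n)

  reserve≡ : # (not ∘ rightPart (11 * d) (suc (p + 21 * d))) ≡ 11 * d
  reserve≡ = #-leftPart (11 * d) (suc (p + 21 * d))

  4≤t : 4 ≤ t
  4≤t = ≤-trans (n≤1+n 4) t-large

  module Play (Gm : Game) (dims≡ : Game.dims Gm ≡ D) (N-upper : Game.N Gm ≤ n * n) (N-lower : m * m ≤ Game.N Gm) where

    play-for : ∀ {D′} → D′ ≡ D → Σ[ l ∈ Layout D′ ] Layout.d l ≡ d × Layout.u l ≡ 10 * d × Layout.k l ≡ 3 + 2 * (t * (1 + 66 * q₀)) × Layout.q l ≡ q₀ * d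
      × # (not ∘ Layout.Rm l) ≡ 11 * d × Dims.ℓ′ D′ + Dims.ρ D′ + d ≤ 66 * q₀ * d
    play-for refl = lay , refl , refl , refl , refl , reserve≡ , dims-small

    outcome : Σ[ F ∈ ℕ ] Game.W Gm (rounds * n) [] F × 2 ^ I * F ≤ 7 * Game.N Gm ^ (rounds * n)
    outcome = go (play-for dims≡)
      where
      go : _ → _
      go (l , d≡ , u≡ , k≡ , q≡ , res≡ , small) = padded Gm {I = I}
        (Final.conclusion Gm t I A′ 4≤t l d≡ u≡ k≡ q≡ res≡ 2A′≡ (≤-trans N-upper n²-upper) (≤-trans m²-lower N-lower) small) in-time

  two : Σ[ F ∈ ℕ ] Trees.Win n 2 (3 + s′) (rounds * n) [] F × 2 ^ I * F ≤ 7 * (n C 2) ^ (rounds * n)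
  two = subst (λ z → Σ[ F ∈ ℕ ] Trees.Win n 2 (3 + s′) (rounds * n) [] F × 2 ^ I * F ≤ 7 * z ^ (rounds * n)) N≡
    (Play.outcome game refl (≤-trans (≤-reflexive N≡) (nC2≤n² n)) (≤-trans (m²≤nC2 m n m>0 2m≤n) (≤-reflexive (sym N≡))))
    where open TwoOffers D s′ n ι ι-injective size≡

  one : Σ[ F ∈ ℕ ] Trees.Win n 1 (3 + s′) (rounds * n * 2) [] F × 2 ^ I * F ≤ 7 * ((n C 1) * (n C 1)) ^ (rounds * n)
  one = subst (λ z → Σ[ F ∈ ℕ ] Trees.Win n 1 (3 + s′) (rounds * n * 2) [] F × 2 ^ I * F ≤ 7 * z ^ (rounds * n)) N≡
    (Play.outcome game refl (≤-reflexive (trans N≡ n²)) (≤-trans (*-mono-≤ m≤n m≤n) (≤-reflexive (sym (trans N≡ n²)))))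
    where
    open OneOffer D s′ n ι ι-injective size≡
    n² : (n C 1) * (n C 1) ≡ n * n
    n² = cong₂ _*_ (nC1≡n n) (nC1≡n n)
    m≤n : m ≤ n
    m≤n = ≤-trans (m≤n*m m 2) 2m≤n

-- Choice of the constants and the theorem

record Constants (s′ : ℕ) : Set where
  field
    t A′ : ℕ
    t-large : 5 ≤ t
    2A′≡ : 2 * A′ ≡ t * (8 * t * (8 * t))
    A′≥ : 1024 * ((2 + s′) * (2 + s′)) * (8 * t * (8 * t)) ≤ A′

opaque
  -- From m ≤ 32 q₀ d and n = m S follows n² ≤ 1024 S² q₀² d², so A′ = 1024 S² q₀². The relation 2A′
  -- = t q₀² then forces t = 2048 S², which depends on s only; q₀ = 8t is fixed afterwards.
  constants : ∀ s′ → Constants s′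
  constants s′ = record
    { t = 2048 * S² ; A′ = 1024 * S² * (8 * (2048 * S²) * (8 * (2048 * S²)))
    ; t-large = ≤-trans (≤ᵇ⇒≤ 5 2048 _) (m≤m*n 2048 S²)
    ; 2A′≡ = double S² (8 * (2048 * S²) * (8 * (2048 * S²)))
    ; A′≥ = ≤-refl }
    where
    S² : ℕ
    S² = (2 + s′) * (2 + s′)
    double : ∀ x y → 2 * (1024 * x * y) ≡ 2048 * x * y
    double x y = trans (sym (*-assoc 2 (1024 * x) y)) (cong (_* y) (sym (*-assoc 2 1024 x)))

-- The number m is located between consecutive powers of 16 times 2q₀. The stages divide by 16, so d
-- has to be such a power, at the price of a factor 16 between the two bounds on m.
record Scale (q₀ m : ℕ) : Set where
  field
    I : ℕ
    lower : 2 * q₀ * 16 ^ I ≤ m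
    upper : m < 2 * q₀ * 16 ^ suc I

-- The upward search ends within m steps, because I < 16^I.
scale : ∀ q₀ m → 1 ≤ q₀ → 2 * q₀ ≤ m → Scale q₀ m
scale q₀ m q₀>0 large = go m 0 (≤-reflexive (sym (+-identityʳ m))) (≤-trans (≤-reflexive (*-identityʳ (2 * q₀))) large)
  where
  I<16^I : ∀ I → I < 16 ^ I
  I<16^I zero = s≤s z≤n
  I<16^I (suc I) = ≤-trans (+-mono-≤ (m^n>0 16 I) (I<16^I I)) (+-monoʳ-≤ (16 ^ I) (m≤m+n (16 ^ I) _))
  go : ∀ fuel I → m ≤ fuel + I → 2 * q₀ * 16 ^ I ≤ m → Scale q₀ m
  go fuel I f lo with m <? 2 * q₀ * 16 ^ suc I
  ... | yes up = record { I = I ; lower = lo ; upper = up }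
  go zero I f lo | no _ = ⊥-elim (<-irrefl refl (≤-trans (I<16^I I) (≤-trans (m≤n*m (16 ^ I) (2 * q₀) {{>-nonZero (≤-trans q₀>0 (m≤n*m q₀ 2))}}) (≤-trans lo f))))
  go (suc fuel) I f lo | no up = go fuel (suc I) (≤-trans f (≤-reflexive (sym (+-suc fuel I)))) (≮⇒≥ up)

scale-max : ∀ {q₀ m} (Sc : Scale q₀ m) I₀ → 2 * q₀ * 16 ^ I₀ ≤ m → I₀ ≤ Scale.I Sc
scale-max {q₀} {m} Sc I₀ h = ≮⇒≥ λ lt → <-irrefl refl (≤-trans (Scale.upper Sc) (≤-trans (*-monoʳ-≤ (2 * q₀) (^-monoʳ-≤ 16 lt)) h))

module Attempt (s′ : ℕ) where
  open Constants (constants s′)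

  q₀ c₀ S : ℕ
  q₀ = 8 * t
  c₀ = t * (1 + 66 * q₀) * (q₀ * q₀) + 4 * (128 * A′)
  S = 2 + s′

  q₀>0 : 40 ≤ q₀
  q₀>0 = *-monoʳ-≤ 8 t-large

  threshold : ℕ → ℕ
  threshold I₀ = 2 * q₀ * 16 ^ I₀ * S

  -- The tree is fixed before I₀ is quantified: a single strategy for each n must satisfy the bounds
  -- for all error levels. Where n is too small or not divisible, the tree may simply give up.
  Outcome : (n r : ℕ) .{{_ : NonZero n}} → ℕ → Set
  Outcome n r T = Σ[ F ∈ ℕ ] Trees.Win n r (3 + s′) T [] F × (∀ I₀ → S ∣ n → threshold I₀ ≤ n → 2 ^ I₀ * F ≤ 7 * (n C r) ^ T)

  Won : (n r : ℕ) .{{_ : NonZero n}} → ℕ → ℕ → Set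
  Won n r T I = Σ[ F ∈ ℕ ] Trees.Win n r (3 + s′) T [] F × 2 ^ I * F ≤ 7 * (n C r) ^ T

  module _ (n r T : ℕ) .{{n≢0 : NonZero n}}
    (win : ∀ (m I p : ℕ) → m * S ≡ n → suc (10 * 16 ^ I * 3 + p) + 16 ^ I ≡ m → 2 * q₀ * 16 ^ I ≤ m → m ≤ 32 * q₀ * 16 ^ I → Won n r T I) where

    give-up : (∀ I₀ → S ∣ n → ¬ (threshold I₀ ≤ n)) → Outcome n r T
    give-up small = (n C r) ^ T , Trees.lose ≤-refl , λ I₀ S∣n le → ⊥-elim (small I₀ S∣n le)

    unscale : ∀ m I₀ → n ≡ m * S → threshold I₀ ≤ n → 2 * q₀ * 16 ^ I₀ ≤ m
    unscale m I₀ n≡ h = *-cancelʳ-≤ _ m S (≤-trans h (≤-reflexive n≡))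

    with-scale : ∀ m → n ≡ m * S → Scale q₀ m → Outcome n r T
    with-scale m n≡ Sc = finish (win m I p (sym n≡) m≡ lower upper′)
      where
      open Scale Sc
      d : ℕ
      d = 16 ^ I
      room : 31 * d + 1 ≤ m
      room = begin
        31 * d + 1 ≤⟨ +-monoʳ-≤ (31 * d) (m^n>0 16 I) ⟩
        31 * d + d ≡⟨ +-comm (31 * d) d ⟩
        32 * d ≤⟨ *-monoˡ-≤ d (≤-trans (≤ᵇ⇒≤ 32 40 _) (≤-trans q₀>0 (m≤n*m q₀ 2))) ⟩
        2 * q₀ * d ≤⟨ lower ⟩
        m ∎
        where open ≤-Reasoning
      p : ℕ
      p = m ∸ (31 * d + 1)
      m≡ : suc (10 * d * 3 + p) + d ≡ m
      m≡ = trans (lem d p) (m+[n∸m]≡n room)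
        where lem : ∀ d p → suc (10 * d * 3 + p) + d ≡ 31 * d + 1 + p
              lem = solve-∀
      upper′ : m ≤ 32 * q₀ * d
      upper′ = ≤-trans (<⇒≤ upper) (≤-reflexive (lem q₀ d))
        where lem : ∀ q d → 2 * q * (16 * d) ≡ 32 * q * d
              lem = solve-∀
      finish : Won n r T I → Outcome n r T
      finish (F , w , bound) = F , w , λ I₀ _ h → ≤-trans (*-monoˡ-≤ F (^-monoʳ-≤ 2 (scale-max Sc I₀ (unscale m I₀ n≡ h)))) bound

    attempt : Outcome n r T
    attempt with S ∣? n
    ... | no S∤n = give-up (λ I₀ S∣n _ → S∤n S∣n)
    ... | yes (divides m n≡) with 2 * q₀ ≤? m
    ...   | yes large = with-scale m n≡ (scale q₀ m (≤-trans (s≤s z≤n) q₀>0) large)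
    ...   | no few = give-up (λ I₀ _ h → few (≤-trans (m≤m*n (2 * q₀) (16 ^ I₀) {{m^n≢0 16 I₀}}) (unscale m I₀ n≡ h)))

  attempt₂ : ∀ n .{{_ : NonZero n}} → Outcome n 2 (c₀ * n)
  attempt₂ n = attempt n 2 (c₀ * n) (λ m I p n≡ m≡ lo up → Instance.two s′ n m I p t A′ t-large 2A′≡ A′≥ n≡ m≡ lo up)

  attempt₁ : ∀ n .{{_ : NonZero n}} → Outcome n 1 (c₀ * 2 * n)
  attempt₁ n = attempt n 1 (c₀ * 2 * n) (λ m I p n≡ m≡ lo up → convert I (Instance.one s′ n m I p t A′ t-large 2A′≡ A′≥ n≡ m≡ lo up))
    where
    swap-factors : ∀ c n → c * n * 2 ≡ c * 2 * n
    swap-factors = solve-∀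
    convert : ∀ I → Σ[ F ∈ ℕ ] Trees.Win n 1 (3 + s′) (c₀ * n * 2) [] F × 2 ^ I * F ≤ 7 * ((n C 1) * (n C 1)) ^ (c₀ * n) → Won n 1 (c₀ * 2 * n) I
    convert I (F , w , bound) = F , subst (λ z → Trees.Win n 1 (3 + s′) z [] F) (swap-factors c₀ n) w
      , ≤-trans bound (≤-reflexive (cong (7 *_) squares))
      where
      squares : ((n C 1) * (n C 1)) ^ (c₀ * n) ≡ (n C 1) ^ (c₀ * 2 * n)
      squares = trans (cong (_^ (c₀ * n)) (cong ((n C 1) *_) (sym (*-identityʳ (n C 1)))))
        (trans (^-*-assoc (n C 1) 2 (c₀ * n)) (cong ((n C 1) ^_) (trans (*-comm 2 (c₀ * n)) (swap-factors c₀ n))))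

  Conclusion : ℕ → ℕ → Set
  Conclusion r c = Σ ((n : ℕ) → Strategy n r (3 + s′)) λ σ →
    (k : ℕ) → ∃ λ (N : ℕ) → (n : ℕ) .{{_ : NonZero n}} → N ≤ n → S ∣ n →
      ∃ λ (good : List (Vec (Offer n r) (c * n))) →
        Unique good
        × All (λ ω → ContainsLooseHamCycle (3 + s′) (hypergraph (σ n) ω)) good
        × k * (n C r) ^ (c * n) ≤ suc k * length good

  module _ (r c : ℕ) (outcome : ∀ (n : ℕ) .{{_ : NonZero n}} → Outcome n r (c * n)) where

    start-of : ∀ n → Trees.Position (suc n) r (3 + s′)
    start-of n = c * suc n , [] , proj₁ (outcome (suc n)) , proj₁ (proj₂ (outcome (suc n)))

    σ : ∀ n → Strategy n r (3 + s′)
    σ zero h A = nothing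
    σ (suc n) = Trees.strategy (suc n) r (3 + s′) (start-of n)

    -- If at most a fraction 1/(k+1) of the sequences fails, the remaining ones make up at least
    -- k/(k+1).
    majority : ∀ k F P len → suc k * F ≤ P → P ≤ F + len → k * P ≤ suc k * len
    majority k F P len few all = +-cancelʳ-≤ P _ _ (begin
      k * P + P ≡⟨ +-comm (k * P) P ⟩
      suc k * P ≤⟨ *-monoʳ-≤ (suc k) all ⟩
      suc k * (F + len) ≡⟨ *-distribˡ-+ (suc k) F len ⟩
      suc k * F + suc k * len ≤⟨ +-monoˡ-≤ (suc k * len) few ⟩
      P + suc k * len ≡⟨ +-comm P _ ⟩
      suc k * len + P ∎)
      where open ≤-Reasoning

    conclude : Conclusion r c
    -- The level 7(k+1) is enough: 2^(7(k+1)) ≥ 7(k+1) turns the failure bound 7/2^I into 1/(k+1).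
    conclude = σ , λ k → threshold (7 * suc k) , large k
      where
      threshold>0 : ∀ I₀ → 1 ≤ threshold I₀
      threshold>0 I₀ = *-mono-≤ {1} {2 * q₀ * 16 ^ I₀} {1} {S} (*-mono-≤ {1} {2 * q₀} {1} {16 ^ I₀} (≤-trans (≤-trans (s≤s z≤n) q₀>0) (m≤n*m q₀ 2)) (m^n>0 16 I₀)) (s≤s z≤n)
      large : ∀ k n .{{_ : NonZero n}} → threshold (7 * suc k) ≤ n → S ∣ n → _
      large k zero le _ = ⊥-elim (<-irrefl refl (≤-trans (threshold>0 (7 * suc k)) le))
      large k (suc n) le S∣n = Trees.goods (suc n) r (3 + s′) w , Trees.goods-unique (suc n) r (3 + s′) w
        , All.tabulate (λ m → Trees.goods-ham (suc n) r (3 + s′) (start-of n) [] w refl refl m)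
        , majority k F P (length (Trees.goods (suc n) r (3 + s′) w)) few (Trees.goods-many (suc n) r (3 + s′) w)
        where
        F P : ℕ
        F = proj₁ (outcome (suc n))
        P = (suc n C r) ^ (c * suc n)
        w : Trees.Win (suc n) r (3 + s′) (c * suc n) [] F
        w = proj₁ (proj₂ (outcome (suc n)))
        few : suc k * F ≤ P
        few = *-cancelˡ-≤ 7 (≤-trans (≤-reflexive (sym (*-assoc 7 (suc k) F)))
          (≤-trans (*-monoˡ-≤ F (n≤2^n (7 * suc k))) (proj₂ (proj₂ (outcome (suc n))) (7 * suc k) S∣n le)))

theorem4 : (s r : ℕ) → 3 ≤ s → (r ≡ 1 ⊎ r ≡ 2) →
    ∃ λ (c : ℕ) → Σ ((n : ℕ) → Strategy n r s) λ σ →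
    (k : ℕ) → ∃ λ (N : ℕ) → (n : ℕ) .{{_ : NonZero n}} → N ≤ n → (s ∸ 1) ∣ n →
    ∃ λ (good : List (Vec (Offer n r) (c * n))) →
    Unique good
    × All (λ ω → ContainsLooseHamCycle s (hypergraph (σ n) ω)) good
    × k * (n C r) ^ (c * n) ≤ suc k * length good
theorem4 (suc (suc (suc s′))) .1 (s≤s (s≤s (s≤s z≤n))) (inj₁ refl) = c₀ * 2 , conclude 1 (c₀ * 2) (λ n → attempt₁ n)
  where open Attempt s′
theorem4 (suc (suc (suc s′))) .2 (s≤s (s≤s (s≤s z≤n))) (inj₂ refl) = c₀ , conclude 2 c₀ (λ n → attempt₂ n)
  where open Attempt s′
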